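{- In the calculus $\Pi^D_1$, normal bisimilarity coincides with context bisimilarity: for all closed processes $P,Q$ of $\Pi^D_1$, $P\cong Q$ if and only if $P\approx Q$.
   Context: The calculus $\Pi^D_1$ (strictly higher-order pi-calculus with unary process parameterization). Names: channel names $a,b,c,d,m,\dots$; process variables $X,Y,Z$. Terms: $T ::= 0 \mid X \mid a(X).T \mid \overline{a}T'.T \mid T\,|\,T' \mid (c)T \mid \langle X\rangle T \mid T\langle T'\rangle$. In $a(X).T$ the variable $X$ is bound; in $(c)T$ the name $c$ is bound; in the parameterization (abstraction) $\langle X\rangle T$ the variable $X$ is bound; $T\langle T'\rangle$ is application. Free names $fn$, free variables $fv$ are defined as usual; closed processes have no free variables; a process is non-parameterized if it is not of the form $\langle X\rangle T$. Processes are well-typed and strictly abstraction-passing: every transmitted object and every process variable has the type of an abstraction $\langle Y\rangle T$, so variables occur applied, $X\langle T'\rangle$. $T\{A/X\}$ is capture-avoiding substitution; for a term $E[X]$ with a distinguished variable $X$, $E[A]$ denotes $E\{A/X\}$. Abbreviations: $\overline{m}A$ means $\overline{m}A.0$; replication is the derived operator $!\phi.P := (c)(Q_c\,|\,\overline{c}Q_c)$ with $Q_c := c(X).(\phi.(X\,|\,P)\,|\,\overline{c}X)$, $c$ fresh. Structural congruence $\equiv$: $\alpha$-conversion, $T|0\equiv T$, associativity and commutativity of $|$, $(c)(d)T\equiv(d)(c)T$, $(c)\lambda.T\equiv 0$ if the subject of prefix $\lambda$ is $c$, $(c)(T|T')\equiv (c)T\,|\,T'$ if $c\notin fn(T')$,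 and $(\langle X\rangle T)\langle T'\rangle\equiv T\{T'/X\}$. Labelled transitions (plus symmetric versions): $a(X).T\xrightarrow{a(A)}T\{A/X\}$; $\overline{a}A.T\xrightarrow{\overline{a}A}T$; if $T\xrightarrow{\lambda}T'$ and $c\notin n(\lambda)$ then $(c)T\xrightarrow{\lambda}(c)T'$; if $T\xrightarrow{(\vec c)\overline{a}A}T'$ and $d\in fn(A)\setminus\{\vec c,a\}$ then $(d)T\xrightarrow{(d\vec c)\overline{a}A}T'$; if $T\xrightarrow{\lambda}T'$ and $bn(\lambda)\cap fn(T_1)=\emptyset$ then $T|T_1\xrightarrow{\lambda}T'|T_1$; if $T_1\xrightarrow{a(A)}T_1'$ and $T_2\xrightarrow{(\vec c)\overline{a}A}T_2'$ then $T_1|T_2\xrightarrow{\tau}(\vec c)(T_1'|T_2')$; and transitions are closed under $\equiv$. $\Rightarrow$ is the reflexive-transitive closure of $\xrightarrow{\tau}$, $\stackrel{\lambda}{\Rightarrow}$ is $\Rightarrow\xrightarrow{\lambda}\Rightarrow$, and $\stackrel{\hat\lambda}{\Rightarrow}$ is $\Rightarrow$ if $\lambda=\tau$ and $\stackrel{\lambda}{\Rightarrow}$ otherwise. Context bisimulation: a symmetric relation $\mathcal R$ on closed processes such that whenever $P\mathcal R Q$: (1) if $P\xrightarrow{\alpha}P'$ with $\alpha$ equal to $\tau$ or $a(A)$, then $Q\stackrel{\hat\alpha}{\Rightarrow}Q'$ with $P'\mathcal R Q'$; (2) if $P\xrightarrow{(\vec c)\overline{a}A}P'$ then $Q\stackrel{(\vec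 d)\overline{a}B}{\Rightarrow}Q'$ for some $\vec d,B,Q'$ such that for every $E[X]$ with $\{\vec c,\vec d\}\cap fn(E)=\emptyset$, $(\vec c)(E[A]\,|\,P')\,\mathcal R\,(\vec d)(E[B]\,|\,Q')$. Context bisimilarity $\approx$ is the union of all context bisimulations. Normal bisimulation: with the trigger $Tr_m := \langle Z\rangle\overline{m}Z$, a symmetric relation $\mathcal R$ on closed $\Pi^D_1$ processes such that whenever $P\mathcal R Q$: (1) if $P\xrightarrow{\tau}P'$ then $Q\Rightarrow Q'$ with $P'\mathcal R Q'$; (2) if $P\xrightarrow{a(Tr_m)}P'$ with $m$ fresh, then $Q\stackrel{a(Tr_m)}{\Rightarrow}Q'$ with $P'\mathcal R Q'$; (3) if $P\xrightarrow{(\vec c)\overline{a}A}P'$ then $Q\stackrel{(\vec d)\overline{a}B}{\Rightarrow}Q'$ for some $\vec d,B,Q'$ with $(\vec c)(P'\,|\,!m(Z).A\langle Z\rangle)\,\mathcal R\,(\vec d)(Q'\,|\,!m(Z).B\langle Z\rangle)$ for fresh $m$. Normal bisimilarity $\cong$ is the union of all normal bisimulations.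
   Formalization: The derived replication transmits the process Q_c, which is not an abstraction and so is ill-typed in this calculus; here it is transmitted as the abstraction ⟨Y⟩Q_c with Y unused, and run as X⟨⟨Y⟩0⟩. -}

module Defs where

open import Data.Empty using (⊥)
open import Data.Fin.Base using (Fin; zero; suc)
open import Data.Nat.Base using (ℕ; zero; suc; _+_)
open import Data.Product.Base using (Σ; _×_; ∃₂; ∃-syntax)
open import Data.Sum.Base using (_⊎_)
open import Function.Base using (id; _∘_)
open import Level using (0ℓ) renaming (suc to lsuc)
open import Relation.Binary.Core using (Rel)
open import Relation.Binary.Definitions using (Symmetric)
open import Relation.Binary.PropositionalEquality.Core using (_≡_)
open import Relation.Binary.Construct.Closure.ReflexiveTransitive using (Star)
open import Relation.Nullary.Negation.Core using (¬_)

infix  3 _≅_ _≈_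
infix  4 _≋_ _—[_]→_ _⇒_ _⇒[_]_ _⇒̂[_]_
infix  4 _∈fn_ _∉fn_
infixr 6 _∥_
infixl 8 _·_
infix  9 _[_]

-- Terms are intrinsically typed.  Since the calculus is strictly
-- abstraction-passing, every variable and every transmitted object is of
-- kind abs; as the trigger ⟨Z⟩ m̄Z transmits its own parameter, abs is the
-- recursive type of functions from abs to proc.

data Kind : Set where
  proc abs : Kind

-- Both sorts of binder are nameless.  Process variables are well-scoped de
-- Bruijn indices: Term n s has its free variables among Fin n.  Channel
-- names are unscoped de Bruijn indices, so that infinitely many free names
-- are always available; ν binds index 0 and shifts the others by one.
-- α-convertible terms are thereby identified.

data Term : ℕ → Kind → Set where
  var : ∀ {n} → Fin n → Term n abs                            -- X
  ƛ   : ∀ {n} → Term (suc n) proc → Term n abs                -- ⟨X⟩T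
  𝟎   : ∀ {n} → Term n proc                                   -- 0
  inp : ∀ {n} → ℕ → Term (suc n) proc → Term n proc           -- a(X).T
  out : ∀ {n} → ℕ → Term n abs → Term n proc → Term n proc    -- āA.T
  _∥_ : ∀ {n} → Term n proc → Term n proc → Term n proc       -- T | T′
  ν   : ∀ {n} → Term n proc → Term n proc                     -- (c)T
  _·_ : ∀ {n} → Term n abs → Term n abs → Term n proc         -- T⟨T′⟩

Proc : Set
Proc = Term 0 proc

Abs : Set
Abs = Term 0 abs

lift : (ℕ → ℕ) → ℕ → ℕ
lift ρ zero    = zero
lift ρ (suc a) = suc (ρ a)

lift^ : ℕ → (ℕ → ℕ) → ℕ → ℕ
lift^ zero    ρ = ρ
lift^ (suc k) ρ = lift (lift^ k ρ)

renN : ∀ {n s} → (ℕ → ℕ) → Term n s → Term n s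
renN ρ (var x)     = var x
renN ρ (ƛ T)       = ƛ (renN ρ T)
renN ρ 𝟎           = 𝟎
renN ρ (inp a T)   = inp (ρ a) (renN ρ T)
renN ρ (out a A T) = out (ρ a) (renN ρ A) (renN ρ T)
renN ρ (T ∥ T′)    = renN ρ T ∥ renN ρ T′
renN ρ (ν T)       = ν (renN (lift ρ) T)
renN ρ (A · B)     = renN ρ A · renN ρ B

_∈fn_ : ∀ {n s} → ℕ → Term n s → Set
a ∈fn var x     = ⊥
a ∈fn ƛ T       = a ∈fn T
a ∈fn 𝟎         = ⊥
a ∈fn inp b T   = a ≡ b ⊎ a ∈fn T
a ∈fn out b A T = a ≡ b ⊎ a ∈fn A ⊎ a ∈fn T
a ∈fn (T ∥ T′)  = a ∈fn T ⊎ a ∈fn T′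
a ∈fn ν T       = suc a ∈fn T
a ∈fn (A · B)   = a ∈fn A ⊎ a ∈fn B

_∉fn_ : ∀ {n s} → ℕ → Term n s → Set
a ∉fn T = ¬ a ∈fn T

swap : ℕ → ℕ
swap zero          = 1
swap (suc zero)    = 0
swap (suc (suc a)) = suc (suc a)

-- rot k sends k to 0 and each i < k to suc i, and fixes every i > k: it
-- makes the binder just outside a group of k binders the innermost one.
rot : ℕ → ℕ → ℕ
rot zero    = id
rot (suc k) = swap ∘ lift (rot k)

-- (c₁ … c_k)T
ν^ : ∀ {n} → ℕ → Term n proc → Term n proc
ν^ zero    T = T
ν^ (suc k) T = ν (ν^ k T)

ext : ∀ {n m} → (Fin n → Fin m) → Fin (suc n) → Fin (suc m)
ext ξ zero    = zero
ext ξ (suc x) = suc (ξ x)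

renV : ∀ {n m s} → (Fin n → Fin m) → Term n s → Term m s
renV ξ (var x)     = var (ξ x)
renV ξ (ƛ T)       = ƛ (renV (ext ξ) T)
renV ξ 𝟎           = 𝟎
renV ξ (inp a T)   = inp a (renV (ext ξ) T)
renV ξ (out a A T) = out a (renV ξ A) (renV ξ T)
renV ξ (T ∥ T′)    = renV ξ T ∥ renV ξ T′
renV ξ (ν T)       = ν (renV ξ T)
renV ξ (A · B)     = renV ξ A · renV ξ B

exts : ∀ {n m} → (Fin n → Term m abs) → Fin (suc n) → Term (suc m) abs
exts σ zero    = var zero
exts σ (suc x) = renV suc (σ x)

-- Avoids the capture of variables (under ƛ and inp) and of names (under ν).
sub : ∀ {n m s} → (Fin n → Term m abs) → Term n s → Term m s
sub σ (var x)     = σ x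
sub σ (ƛ T)       = ƛ (sub (exts σ) T)
sub σ 𝟎           = 𝟎
sub σ (inp a T)   = inp a (sub (exts σ) T)
sub σ (out a A T) = out a (sub σ A) (sub σ T)
sub σ (T ∥ T′)    = sub σ T ∥ sub σ T′
sub σ (ν T)       = ν (sub (renN suc ∘ σ) T)
sub σ (A · B)     = sub σ A · sub σ B

single : ∀ {n} → Term n abs → Fin (suc n) → Term n abs
single A zero    = A
single A (suc x) = var x

-- T{A/X}, where X is variable 0 of T
_[_] : ∀ {n s} → Term (suc n) s → Term n abs → Term n s
T [ A ] = sub (single A) T

data _≋_ : ∀ {n s} → Term n s → Term n s → Set where
  ≋-refl  : ∀ {n s} {T : Term n s} → T ≋ T
  ≋-sym   : ∀ {n s} {T U : Term n s} → T ≋ U → U ≋ T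
  ≋-trans : ∀ {n s} {T U V : Term n s} → T ≋ U → U ≋ V → T ≋ V

  ƛ-cong   : ∀ {n} {T T′ : Term (suc n) proc} → T ≋ T′ → ƛ T ≋ ƛ T′
  inp-cong : ∀ {n a} {T T′ : Term (suc n) proc} →
             T ≋ T′ → inp a T ≋ inp a T′
  out-cong : ∀ {n a} {A A′ : Term n abs} {T T′ : Term n proc} →
             A ≋ A′ → T ≋ T′ → out a A T ≋ out a A′ T′
  ∥-cong   : ∀ {n} {T T′ U U′ : Term n proc} →
             T ≋ T′ → U ≋ U′ → T ∥ U ≋ T′ ∥ U′
  ν-cong   : ∀ {n} {T T′ : Term n proc} → T ≋ T′ → ν T ≋ ν T′
  ·-cong   : ∀ {n} {A A′ B B′ : Term n abs} →
             A ≋ A′ → B ≋ B′ → A · B ≋ A′ · B′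

  ∥-identity : ∀ {n} {T : Term n proc} → T ∥ 𝟎 ≋ T
  ∥-assoc    : ∀ {n} {T U V : Term n proc} → (T ∥ U) ∥ V ≋ T ∥ (U ∥ V)
  ∥-comm     : ∀ {n} {T U : Term n proc} → T ∥ U ≋ U ∥ T
  ν-swap     : ∀ {n} {T : Term n proc} → ν (ν T) ≋ ν (ν (renN swap T))
  ν-inp      : ∀ {n} {T : Term (suc n) proc} → ν (inp 0 T) ≋ 𝟎
  ν-out      : ∀ {n} {A : Term n abs} {T : Term n proc} → ν (out 0 A T) ≋ 𝟎
  -- renN suc U is the general form of a term in which the name bound by
  -- the enclosing ν does not occur.
  ν-extrude  : ∀ {n} {T U : Term n proc} → ν (T ∥ renN suc U) ≋ ν T ∥ U
  β          : ∀ {n} {T : Term (suc n) proc} {A : Term n abs} →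
               ƛ T · A ≋ T [ A ]

-- send k a A stands for (c₁ … c_k)āA.  The name a lives in the scope of the
-- source; A, and the target of a transition with this label, live in that
-- scope extended with the k extruded names, which are their indices 0 … k-1.

data Label : Set where
  τ    : Label
  recv : ℕ → Abs → Label
  send : ℕ → ℕ → Abs → Label

bn : Label → ℕ
bn τ            = 0
bn (recv a A)   = 0
bn (send k a A) = k

renL : (ℕ → ℕ) → Label → Label
renL ρ τ            = τ
renL ρ (recv a A)   = recv (ρ a) (renN ρ A)
renL ρ (send k a A) = send k (ρ a) (renN (lift^ k ρ) A)

data _—[_]→_ : Proc → Label → Proc → Set where
  recv : ∀ {a T} A → inp a T —[ recv a A ]→ T [ A ]
  send : ∀ {a A T} → out a A T —[ send 0 a A ]→ T
  -- The label renL suc λ′ is one in which the name bound by ν is not free.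
  res  : ∀ {λ′ T T′} → T —[ renL suc λ′ ]→ T′ →
         ν T —[ λ′ ]→ ν (renN (rot (bn λ′)) T′)
  -- Under the k names already extruded, the name bound by ν is index k; it
  -- becomes the outermost of the suc k extruded names.
  open′ : ∀ {k a A T T′} → T —[ send k (suc a) A ]→ T′ → k ∈fn A →
          ν T —[ send (suc k) a A ]→ T′
  parˡ : ∀ {λ′ T T′ U} → T —[ λ′ ]→ T′ →
         T ∥ U —[ λ′ ]→ T′ ∥ renN (bn λ′ +_) U
  parʳ : ∀ {λ′ T T′ U} → T —[ λ′ ]→ T′ →
         U ∥ T —[ λ′ ]→ renN (bn λ′ +_) U ∥ T′
  -- The receiver does not know the k extruded names, hence the shift.
  comˡ : ∀ {k a A T T′ U U′} →
         renN (k +_) T —[ recv (k + a) A ]→ T′ → U —[ send k a A ]→ U′ →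
         T ∥ U —[ τ ]→ ν^ k (T′ ∥ U′)
  comʳ : ∀ {k a A T T′ U U′} →
         U —[ send k a A ]→ U′ → renN (k +_) T —[ recv (k + a) A ]→ T′ →
         U ∥ T —[ τ ]→ ν^ k (U′ ∥ T′)
  str  : ∀ {λ′ T T₁ T₁′ T′} → T ≋ T₁ → T₁ —[ λ′ ]→ T₁′ → T₁′ ≋ T′ →
         T —[ λ′ ]→ T′

_⇒_ : Rel Proc 0ℓ
_⇒_ = Star (λ P P′ → P —[ τ ]→ P′)

_⇒[_]_ : Proc → Label → Proc → Set
P ⇒[ λ′ ] P′ = ∃₂ λ P₁ P₂ → P ⇒ P₁ × P₁ —[ λ′ ]→ P₂ × P₂ ⇒ P′

_⇒̂[_]_ : Proc → Label → Proc → Set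
P ⇒̂[ τ ]          P′ = P ⇒ P′
P ⇒̂[ recv a A ]   P′ = P ⇒[ recv a A ] P′
P ⇒̂[ send k a A ] P′ = P ⇒[ send k a A ] P′

data NonOutput : Label → Set where
  τ    : NonOutput τ
  recv : ∀ a A → NonOutput (recv a A)

-- In output, E is a process with one variable X; shifting its names by k
-- (resp. l) expresses that the extruded names are not free in E.
record IsContextBisimulation (R : Rel Proc 0ℓ) : Set where
  field
    symmetric : Symmetric R
    nonOutput : ∀ {P Q α P′} → R P Q → NonOutput α → P —[ α ]→ P′ →
                ∃[ Q′ ] (Q ⇒̂[ α ] Q′ × R P′ Q′)
    output    : ∀ {P Q k a A P′} → R P Q → P —[ send k a A ]→ P′ →
                ∃[ l ] ∃[ B ] ∃[ Q′ ] (Q ⇒[ send l a B ] Q′ ×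
                  ((E : Term 1 proc) →
                    R (ν^ k (renN (k +_) E [ A ] ∥ P′))
                      (ν^ l (renN (l +_) E [ B ] ∥ Q′))))

_≈_ : Rel Proc (lsuc 0ℓ)
P ≈ Q = Σ (Rel Proc 0ℓ) λ R → IsContextBisimulation R × R P Q

-- Tr_m = ⟨Z⟩ m̄Z
Tr : ℕ → Abs
Tr m = ƛ (out m (var zero) 𝟎)

-- The replication (c)(Q_c | c̄Q_c) with Q_c = c(X).(φ.(X | P) | c̄X) passes
-- the process Q_c, which is not an abstraction.  To stay within the
-- abstraction-passing calculus, Q_c is transmitted as ⟨Y⟩Q_c with Y unused,
-- and run by applying it to a dummy argument.

thunk : ∀ {n} → Term n proc → Term n abs
thunk T = ƛ (renV suc T)

force : ∀ {n} → Term n abs → Term n proc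
force A = A · ƛ 𝟎

-- Q_c for φ = m(Z), where c is index 0; both m and P (whose variable 0 is
-- Z) live outside the scope of c.
copier : ∀ {n} → ℕ → Term (suc n) proc → Term n proc
copier m P =
  inp 0 (inp (suc m) (force (var (suc zero)) ∥ renV (ext suc) (renN suc P))
         ∥ out 0 (var zero) 𝟎)

-- !m(Z).P
!inp : ∀ {n} → ℕ → Term (suc n) proc → Term n proc
!inp m P = ν (copier m P ∥ out 0 (thunk (copier m P)) 𝟎)

-- !m(Z).A⟨Z⟩
server : ∀ {n} → ℕ → Term n abs → Term n proc
server m A = !inp m (renV suc A · var zero)

-- A and P′ (resp. B and Q′) live under k (resp. l) extruded names, where the
-- outer name m is index k + m (resp. l + m).
record IsNormalBisimulation (R : Rel Proc 0ℓ) : Set where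
  field
    symmetric : Symmetric R
    silent    : ∀ {P Q P′} → R P Q → P —[ τ ]→ P′ →
                ∃[ Q′ ] (Q ⇒ Q′ × R P′ Q′)
    input     : ∀ {P Q a m P′} → R P Q → m ∉fn P → m ∉fn Q →
                P —[ recv a (Tr m) ]→ P′ →
                ∃[ Q′ ] (Q ⇒[ recv a (Tr m) ] Q′ × R P′ Q′)
    output    : ∀ {P Q k a A P′} → R P Q → P —[ send k a A ]→ P′ →
                ∃[ l ] ∃[ B ] ∃[ Q′ ] (Q ⇒[ send l a B ] Q′ ×
                  (∀ m → m ∉fn P → m ∉fn Q →
                    k + m ∉fn A → k + m ∉fn P′ →
                    l + m ∉fn B → l + m ∉fn Q′ →
                    R (ν^ k (P′ ∥ server (k + m) A))
                      (ν^ l (Q′ ∥ server (l + m) B))))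

_≅_ : Rel Proc (lsuc 0ℓ)
P ≅ Q = Σ (Rel Proc 0ℓ) λ R → IsNormalBisimulation R × R P Q

{-# OPTIONS --safe #-}

-- To show that normal bisimilarity is a context bisimulation, consider pairs of
-- processes in which common code C runs next to two different processes P and Q
-- under test.  C refers by variables X to the objects it got from P (resp. Q), and
-- P and Q refer by variables Y to the objects they got from C.  Such a pair is kept
-- in the candidate relation if P and Q become normally bisimilar when each Y is
-- replaced by a trigger and each object behind an X is offered by a server.
--
-- A step of the pair is matched as follows.  Communications between the two parts,
-- and the calls X⟨D⟩ by C and Y⟨F⟩ by P, are inputs of a trigger or outputs of an
-- object or to a trigger by P in the test, so the clauses of normal bisimulation
-- answer them; a call moves code from one part to the other.  Since calls are
-- β-conversions, they are silent in the processes compared; the induction is on the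
-- number of β-steps needed to expose the acting prefixes, which no rearrangement of
-- the processes by the other laws of structural congruence changes.  The converse
-- inclusion takes a server as the context.
module Submission where

open import Defs
open import Data.Bool.Base using (Bool; true; false)
open import Data.Empty using (⊥-elim; ⊥)
open import Data.Fin.Base using (Fin; zero; suc)
open import Data.Maybe.Base using (Maybe; just; nothing; maybe)
open import Data.Nat.Base using (ℕ; zero; suc; _+_; pred; _≤_; _⊔_; s≤s; _<_; s≤s⁻¹; z≤n)
open import Data.Nat.Properties
  using (+-suc; suc-injective; _≟_; +-cancelˡ-≡; ≤-trans; m≤m⊔n; m≤n⊔m; m≤n⇒m≤1+n; m≤n+m;
    n<1+n; 1+n≰n; m+n≡0⇒m≡0; m+n≡0⇒n≡0; +-comm; +-assoc; +-identityʳ; ≰⇒>)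
open import Data.Product.Base using (Σ; _×_; _,_; proj₁; proj₂; ∃₂; ∃-syntax)
open import Data.Sum.Base using (_⊎_; inj₁; inj₂)
open import Function.Base using (_∘_; id)
open import Function.Bundles using (_⇔_; mk⇔)
open import Function.Definitions using (Injective)
open import Level using (0ℓ)
open import Relation.Binary.Construct.Closure.ReflexiveTransitive using (Star; ε; _◅_; _◅◅_; gmap)
open import Relation.Binary.Core using (Rel)
open import Relation.Binary.PropositionalEquality hiding ([_])
open import Relation.Nullary.Decidable.Core using (Dec; yes; no; _⊎-dec_)
open import Relation.Nullary.Negation.Core using (¬_)

-- Renamings and substitutions

-- Structural congruence contains β, so the shape of a process does not determine its transitions.
-- The work is therefore done with late transitions that are free of the congruence and record in
-- each derivation how many β-steps it uses. At cost 0 each acting prefix is written in one of the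
-- two parts, and the clauses of normal bisimulation answer directly. A positive cost is lowered by
-- contracting one active redex, which lies inside a part or arises from a call. The call is the
-- obstacle: the called object may itself be a variable that stands for an object of the other part,
-- so one β-step can take several hops before its code is found, and the β-count pays for only one
-- of them. The hops end because an object can refer only to variables that existed when it was
-- passed; hence the ranks. Freshness is the second obstacle. The public names of a configuration
-- are all natural numbers, yet every exchange of an object consumes a fresh name in the test, so
-- the test is formed under an injective renaming whose image omits infinitely many numbers.

module _ where

  lift-cong : ∀ {ρ ρ′ : ℕ → ℕ} → ρ ≗ ρ′ → lift ρ ≗ lift ρ′
  lift-cong e zero    = refl
  lift-cong e (suc a) = cong suc (e a)

  lift-id : ∀ {ρ : ℕ → ℕ} → ρ ≗ id → lift ρ ≗ id
  lift-id e zero    = refl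
  lift-id e (suc a) = cong suc (e a)

  lift-∘ : ∀ (ρ ρ′ : ℕ → ℕ) → lift ρ ∘ lift ρ′ ≗ lift (ρ ∘ ρ′)
  lift-∘ ρ ρ′ zero    = refl
  lift-∘ ρ ρ′ (suc a) = refl

  lift^-cong : ∀ k {ρ ρ′ : ℕ → ℕ} → ρ ≗ ρ′ → lift^ k ρ ≗ lift^ k ρ′
  lift^-cong zero    e = e
  lift^-cong (suc k) e = lift-cong (lift^-cong k e)

  lift^-id : ∀ k {ρ : ℕ → ℕ} → ρ ≗ id → lift^ k ρ ≗ id
  lift^-id zero    e = e
  lift^-id (suc k) e = lift-id (lift^-id k e)

  lift^-∘ : ∀ k (ρ ρ′ : ℕ → ℕ) → lift^ k ρ ∘ lift^ k ρ′ ≗ lift^ k (ρ ∘ ρ′)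
  lift^-∘ zero    ρ ρ′ a       = refl
  lift^-∘ (suc k) ρ ρ′ zero    = refl
  lift^-∘ (suc k) ρ ρ′ (suc a) = cong suc (lift^-∘ k ρ ρ′ a)

  lift^-lift : ∀ k (ρ : ℕ → ℕ) → lift^ k (lift ρ) ≗ lift^ (suc k) ρ
  lift^-lift zero    ρ a       = refl
  lift^-lift (suc k) ρ zero    = refl
  lift^-lift (suc k) ρ (suc a) = cong suc (lift^-lift k ρ a)

  lift^-+ : ∀ k l (ρ : ℕ → ℕ) → lift^ k (lift^ l ρ) ≗ lift^ (k + l) ρ
  lift^-+ zero    l ρ a = refl
  lift^-+ (suc k) l ρ a = lift-cong (lift^-+ k l ρ) a

  lift^-shift : ∀ k (ρ : ℕ → ℕ) a → lift^ k ρ (k + a) ≡ k + ρ a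
  lift^-shift zero    ρ a = refl
  lift^-shift (suc k) ρ a = cong suc (lift^-shift k ρ a)

  swap-involutive : swap ∘ swap ≗ id
  swap-involutive zero          = refl
  swap-involutive (suc zero)    = refl
  swap-involutive (suc (suc a)) = refl

  swap-lift² : ∀ (ρ : ℕ → ℕ) → swap ∘ lift (lift ρ) ≗ lift (lift ρ) ∘ swap
  swap-lift² ρ zero          = refl
  swap-lift² ρ (suc zero)    = refl
  swap-lift² ρ (suc (suc a)) = refl

  -- `rot-shift` and `rot-lift^` evaluate `rot k` on the two kinds of terms that matter: those that
  -- ignore the `k` inner binders, and those that ignore the binder being moved inwards.
  rot-shift : ∀ k → rot k ∘ (k +_) ≗ lift (k +_)
  rot-shift zero    zero    = refl
  rot-shift zero    (suc a) = refl
  rot-shift (suc k) zero rewrite rot-shift k zero = refl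
  rot-shift (suc k) (suc a) rewrite rot-shift k (suc a) = refl

  rot-lift^ : ∀ k → rot k ∘ lift^ k suc ≗ suc
  rot-lift^ zero    a       = refl
  rot-lift^ (suc k) zero    = refl
  rot-lift^ (suc k) (suc a) rewrite rot-lift^ k a = refl

  private variable
    n m o : ℕ
    s     : Kind

  renN-cong : ∀ {ρ ρ′ : ℕ → ℕ} → ρ ≗ ρ′ → (T : Term n s) → renN ρ T ≡ renN ρ′ T
  renN-cong e (var x)     = refl
  renN-cong e (ƛ T)       = cong ƛ (renN-cong e T)
  renN-cong e 𝟎           = refl
  renN-cong e (inp a T)   = cong₂ inp (e a) (renN-cong e T)
  renN-cong e (out a A T) rewrite e a = cong₂ (out _) (renN-cong e A) (renN-cong e T)
  renN-cong e (T ∥ U)     = cong₂ _∥_ (renN-cong e T) (renN-cong e U)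
  renN-cong e (ν T)       = cong ν (renN-cong (lift-cong e) T)
  renN-cong e (A · B)     = cong₂ _·_ (renN-cong e A) (renN-cong e B)

  renN-id : ∀ {ρ : ℕ → ℕ} → ρ ≗ id → (T : Term n s) → renN ρ T ≡ T
  renN-id e (var x)     = refl
  renN-id e (ƛ T)       = cong ƛ (renN-id e T)
  renN-id e 𝟎           = refl
  renN-id e (inp a T)   = cong₂ inp (e a) (renN-id e T)
  renN-id e (out a A T) rewrite e a = cong₂ (out _) (renN-id e A) (renN-id e T)
  renN-id e (T ∥ U)     = cong₂ _∥_ (renN-id e T) (renN-id e U)
  renN-id e (ν T)       = cong ν (renN-id (lift-id e) T)
  renN-id e (A · B)     = cong₂ _·_ (renN-id e A) (renN-id e B)

  renN-∘ : ∀ (ρ ρ′ : ℕ → ℕ) (T : Term n s) → renN ρ (renN ρ′ T) ≡ renN (ρ ∘ ρ′) T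
  renN-∘ ρ ρ′ (var x)     = refl
  renN-∘ ρ ρ′ (ƛ T)       = cong ƛ (renN-∘ ρ ρ′ T)
  renN-∘ ρ ρ′ 𝟎           = refl
  renN-∘ ρ ρ′ (inp a T)   = cong (inp _) (renN-∘ ρ ρ′ T)
  renN-∘ ρ ρ′ (out a A T) = cong₂ (out _) (renN-∘ ρ ρ′ A) (renN-∘ ρ ρ′ T)
  renN-∘ ρ ρ′ (T ∥ U)     = cong₂ _∥_ (renN-∘ ρ ρ′ T) (renN-∘ ρ ρ′ U)
  renN-∘ ρ ρ′ (ν T)       =
    cong ν (trans (renN-∘ (lift ρ) (lift ρ′) T) (renN-cong (lift-∘ ρ ρ′) T))
  renN-∘ ρ ρ′ (A · B)     = cong₂ _·_ (renN-∘ ρ ρ′ A) (renN-∘ ρ ρ′ B)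

  renN-square : ∀ {ρ₁ ρ₂ ρ₃ ρ₄ : ℕ → ℕ} → ρ₁ ∘ ρ₂ ≗ ρ₃ ∘ ρ₄ → (T : Term n s) →
                renN ρ₁ (renN ρ₂ T) ≡ renN ρ₃ (renN ρ₄ T)
  renN-square e T =
    trans (renN-∘ _ _ T) (trans (renN-cong e T) (sym (renN-∘ _ _ T)))

  renN-triangle : ∀ {ρ₁ ρ₂ ρ₃ : ℕ → ℕ} → ρ₁ ∘ ρ₂ ≗ ρ₃ → (T : Term n s) →
                  renN ρ₁ (renN ρ₂ T) ≡ renN ρ₃ T
  renN-triangle e T = trans (renN-∘ _ _ T) (renN-cong e T)

  ext-cong : ∀ {ξ ξ′ : Fin n → Fin m} → ξ ≗ ξ′ → ext ξ ≗ ext ξ′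
  ext-cong e zero    = refl
  ext-cong e (suc x) = cong suc (e x)

  renV-cong : ∀ {ξ ξ′ : Fin n → Fin m} → ξ ≗ ξ′ → (T : Term n s) → renV ξ T ≡ renV ξ′ T
  renV-cong e (var x)     = cong var (e x)
  renV-cong e (ƛ T)       = cong ƛ (renV-cong (ext-cong e) T)
  renV-cong e 𝟎           = refl
  renV-cong e (inp a T)   = cong (inp a) (renV-cong (ext-cong e) T)
  renV-cong e (out a A T) = cong₂ (out a) (renV-cong e A) (renV-cong e T)
  renV-cong e (T ∥ U)     = cong₂ _∥_ (renV-cong e T) (renV-cong e U)
  renV-cong e (ν T)       = cong ν (renV-cong e T)
  renV-cong e (A · B)     = cong₂ _·_ (renV-cong e A) (renV-cong e B)

  ext-∘ : ∀ (ξ : Fin m → Fin o) (ξ′ : Fin n → Fin m) → ext ξ ∘ ext ξ′ ≗ ext (ξ ∘ ξ′)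
  ext-∘ ξ ξ′ zero    = refl
  ext-∘ ξ ξ′ (suc x) = refl

  renV-∘ : ∀ (ξ : Fin m → Fin o) (ξ′ : Fin n → Fin m) (T : Term n s) →
           renV ξ (renV ξ′ T) ≡ renV (ξ ∘ ξ′) T
  renV-∘ ξ ξ′ (var x)     = refl
  renV-∘ ξ ξ′ (ƛ T)       =
    cong ƛ (trans (renV-∘ (ext ξ) (ext ξ′) T) (renV-cong (ext-∘ ξ ξ′) T))
  renV-∘ ξ ξ′ 𝟎           = refl
  renV-∘ ξ ξ′ (inp a T)   =
    cong (inp a) (trans (renV-∘ (ext ξ) (ext ξ′) T) (renV-cong (ext-∘ ξ ξ′) T))
  renV-∘ ξ ξ′ (out a A T) = cong₂ (out a) (renV-∘ ξ ξ′ A) (renV-∘ ξ ξ′ T)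
  renV-∘ ξ ξ′ (T ∥ U)     = cong₂ _∥_ (renV-∘ ξ ξ′ T) (renV-∘ ξ ξ′ U)
  renV-∘ ξ ξ′ (ν T)       = cong ν (renV-∘ ξ ξ′ T)
  renV-∘ ξ ξ′ (A · B)     = cong₂ _·_ (renV-∘ ξ ξ′ A) (renV-∘ ξ ξ′ B)

  renN-renV : ∀ (ρ : ℕ → ℕ) (ξ : Fin n → Fin m) (T : Term n s) →
              renN ρ (renV ξ T) ≡ renV ξ (renN ρ T)
  renN-renV ρ ξ (var x)     = refl
  renN-renV ρ ξ (ƛ T)       = cong ƛ (renN-renV ρ (ext ξ) T)
  renN-renV ρ ξ 𝟎           = refl
  renN-renV ρ ξ (inp a T)   = cong (inp _) (renN-renV ρ (ext ξ) T)
  renN-renV ρ ξ (out a A T) = cong₂ (out _) (renN-renV ρ ξ A) (renN-renV ρ ξ T)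
  renN-renV ρ ξ (T ∥ U)     = cong₂ _∥_ (renN-renV ρ ξ T) (renN-renV ρ ξ U)
  renN-renV ρ ξ (ν T)       = cong ν (renN-renV (lift ρ) ξ T)
  renN-renV ρ ξ (A · B)     = cong₂ _·_ (renN-renV ρ ξ A) (renN-renV ρ ξ B)

  Sub : ℕ → ℕ → Set
  Sub n m = Fin n → Term m abs

  exts-cong : ∀ {σ σ′ : Sub n m} → σ ≗ σ′ → exts σ ≗ exts σ′
  exts-cong e zero    = refl
  exts-cong e (suc x) = cong (renV suc) (e x)

  sub-cong : ∀ {σ σ′ : Sub n m} → σ ≗ σ′ → (T : Term n s) → sub σ T ≡ sub σ′ T
  sub-cong e (var x)     = e x
  sub-cong e (ƛ T)       = cong ƛ (sub-cong (exts-cong e) T)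
  sub-cong e 𝟎           = refl
  sub-cong e (inp a T)   = cong (inp a) (sub-cong (exts-cong e) T)
  sub-cong e (out a A T) = cong₂ (out a) (sub-cong e A) (sub-cong e T)
  sub-cong e (T ∥ U)     = cong₂ _∥_ (sub-cong e T) (sub-cong e U)
  sub-cong e (ν T)       = cong ν (sub-cong (cong (renN suc) ∘ e) T)
  sub-cong e (A · B)     = cong₂ _·_ (sub-cong e A) (sub-cong e B)

  exts-var : ∀ {σ : Sub n n} → σ ≗ var → exts σ ≗ var
  exts-var e zero    = refl
  exts-var e (suc x) = cong (renV suc) (e x)

  sub-var : ∀ {σ : Sub n n} → σ ≗ var → (T : Term n s) → sub σ T ≡ T
  sub-var e (var x)     = e x
  sub-var e (ƛ T)       = cong ƛ (sub-var (exts-var e) T)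
  sub-var e 𝟎           = refl
  sub-var e (inp a T)   = cong (inp a) (sub-var (exts-var e) T)
  sub-var e (out a A T) = cong₂ (out a) (sub-var e A) (sub-var e T)
  sub-var e (T ∥ U)     = cong₂ _∥_ (sub-var e T) (sub-var e U)
  sub-var e (ν T)       = cong ν (sub-var (cong (renN suc) ∘ e) T)
  sub-var e (A · B)     = cong₂ _·_ (sub-var e A) (sub-var e B)

  exts-ext : ∀ (σ : Sub m o) (ξ : Fin n → Fin m) → exts σ ∘ ext ξ ≗ exts (σ ∘ ξ)
  exts-ext σ ξ zero    = refl
  exts-ext σ ξ (suc x) = refl

  sub-renV : ∀ (σ : Sub m o) (ξ : Fin n → Fin m) (T : Term n s) →
             sub σ (renV ξ T) ≡ sub (σ ∘ ξ) T
  sub-renV σ ξ (var x)     = refl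
  sub-renV σ ξ (ƛ T)       =
    cong ƛ (trans (sub-renV (exts σ) (ext ξ) T) (sub-cong (exts-ext σ ξ) T))
  sub-renV σ ξ 𝟎           = refl
  sub-renV σ ξ (inp a T)   =
    cong (inp a) (trans (sub-renV (exts σ) (ext ξ) T) (sub-cong (exts-ext σ ξ) T))
  sub-renV σ ξ (out a A T) = cong₂ (out a) (sub-renV σ ξ A) (sub-renV σ ξ T)
  sub-renV σ ξ (T ∥ U)     = cong₂ _∥_ (sub-renV σ ξ T) (sub-renV σ ξ U)
  sub-renV σ ξ (ν T)       = cong ν (sub-renV (renN suc ∘ σ) ξ T)
  sub-renV σ ξ (A · B)     = cong₂ _·_ (sub-renV σ ξ A) (sub-renV σ ξ B)

  exts-renV : ∀ (ξ : Fin m → Fin o) (σ : Sub n m) →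
              renV (ext ξ) ∘ exts σ ≗ exts (renV ξ ∘ σ)
  exts-renV ξ σ zero    = refl
  exts-renV ξ σ (suc x) = trans (renV-∘ (ext ξ) suc (σ x)) (sym (renV-∘ suc ξ (σ x)))

  renV-sub : ∀ (ξ : Fin m → Fin o) (σ : Sub n m) (T : Term n s) →
             renV ξ (sub σ T) ≡ sub (renV ξ ∘ σ) T
  renV-sub ξ σ (var x)     = refl
  renV-sub ξ σ (ƛ T)       =
    cong ƛ (trans (renV-sub (ext ξ) (exts σ) T) (sub-cong (exts-renV ξ σ) T))
  renV-sub ξ σ 𝟎           = refl
  renV-sub ξ σ (inp a T)   =
    cong (inp a) (trans (renV-sub (ext ξ) (exts σ) T) (sub-cong (exts-renV ξ σ) T))
  renV-sub ξ σ (out a A T) = cong₂ (out a) (renV-sub ξ σ A) (renV-sub ξ σ T)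
  renV-sub ξ σ (T ∥ U)     = cong₂ _∥_ (renV-sub ξ σ T) (renV-sub ξ σ U)
  renV-sub ξ σ (ν T)       =
    cong ν (trans (renV-sub ξ (renN suc ∘ σ) T)
                  (sub-cong (λ x → sym (renN-renV suc ξ (σ x))) T))
  renV-sub ξ σ (A · B)     = cong₂ _·_ (renV-sub ξ σ A) (renV-sub ξ σ B)

  exts-renN : ∀ (ρ : ℕ → ℕ) (σ : Sub n m) → renN ρ ∘ exts σ ≗ exts (renN ρ ∘ σ)
  exts-renN ρ σ zero    = refl
  exts-renN ρ σ (suc x) = renN-renV ρ suc (σ x)

  renN-sub : ∀ (ρ : ℕ → ℕ) (σ : Sub n m) (T : Term n s) →
             renN ρ (sub σ T) ≡ sub (renN ρ ∘ σ) (renN ρ T)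
  renN-sub ρ σ (var x)     = refl
  renN-sub ρ σ (ƛ T)       =
    cong ƛ (trans (renN-sub ρ (exts σ) T) (sub-cong (exts-renN ρ σ) (renN ρ T)))
  renN-sub ρ σ 𝟎           = refl
  renN-sub ρ σ (inp a T)   =
    cong (inp _) (trans (renN-sub ρ (exts σ) T) (sub-cong (exts-renN ρ σ) (renN ρ T)))
  renN-sub ρ σ (out a A T) = cong₂ (out _) (renN-sub ρ σ A) (renN-sub ρ σ T)
  renN-sub ρ σ (T ∥ U)     = cong₂ _∥_ (renN-sub ρ σ T) (renN-sub ρ σ U)
  renN-sub ρ σ (ν T)       =
    cong ν (trans (renN-sub (lift ρ) (renN suc ∘ σ) T)
                  (sub-cong (λ x → renN-square (λ _ → refl) (σ x)) (renN (lift ρ) T)))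
  renN-sub ρ σ (A · B)     = cong₂ _·_ (renN-sub ρ σ A) (renN-sub ρ σ B)

  exts-sub : ∀ (θ : Sub m o) (σ : Sub n m) → sub (exts θ) ∘ exts σ ≗ exts (sub θ ∘ σ)
  exts-sub θ σ zero    = refl
  exts-sub θ σ (suc x) = trans (sub-renV (exts θ) suc (σ x)) (sym (renV-sub suc θ (σ x)))

  sub-sub : ∀ (θ : Sub m o) (σ : Sub n m) (T : Term n s) →
            sub θ (sub σ T) ≡ sub (sub θ ∘ σ) T
  sub-sub θ σ (var x)     = refl
  sub-sub θ σ (ƛ T)       =
    cong ƛ (trans (sub-sub (exts θ) (exts σ) T) (sub-cong (exts-sub θ σ) T))
  sub-sub θ σ 𝟎           = refl
  sub-sub θ σ (inp a T)   =
    cong (inp a) (trans (sub-sub (exts θ) (exts σ) T) (sub-cong (exts-sub θ σ) T))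
  sub-sub θ σ (out a A T) = cong₂ (out a) (sub-sub θ σ A) (sub-sub θ σ T)
  sub-sub θ σ (T ∥ U)     = cong₂ _∥_ (sub-sub θ σ T) (sub-sub θ σ U)
  sub-sub θ σ (ν T)       =
    cong ν (trans (sub-sub (renN suc ∘ θ) (renN suc ∘ σ) T)
                  (sub-cong (λ x → sym (renN-sub suc θ (σ x))) T))
  sub-sub θ σ (A · B)     = cong₂ _·_ (sub-sub θ σ A) (sub-sub θ σ B)

  wk : Term n s → Term (suc n) s
  wk = renV suc

  infixr 5 _◂_
  _◂_ : ∀ {X : Set} → X → (Fin n → X) → Fin (suc n) → X
  (x ◂ f) zero    = x
  (x ◂ f) (suc i) = f i

  wk-[] : ∀ (T : Term n s) (A : Term n abs) → wk T [ A ] ≡ T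
  wk-[] T A = trans (sub-renV (single A) suc T) (sub-var (λ _ → refl) T)

  sub-◂-wk : ∀ (A : Term m abs) (σ : Sub n m) (T : Term n s) → sub (A ◂ σ) (wk T) ≡ sub σ T
  sub-◂-wk A σ T = sub-renV (A ◂ σ) suc T

  sub-exts-wk : ∀ (σ : Sub n m) (T : Term n s) → sub (exts σ) (wk T) ≡ wk (sub σ T)
  sub-exts-wk σ T = trans (sub-renV (exts σ) suc T) (sym (renV-sub suc σ T))

  exts-[] : ∀ (σ : Sub n m) (T : Term (suc n) s) A → sub (exts σ) T [ A ] ≡ sub (A ◂ σ) T
  exts-[] σ T A = trans (sub-sub (single A) (exts σ) T) (sub-cong eq T)
    where
    eq : sub (single A) ∘ exts σ ≗ A ◂ σ
    eq zero    = refl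
    eq (suc x) = wk-[] (σ x) A

  sub-[] : ∀ (σ : Sub n m) (T : Term (suc n) s) A →
           sub σ (T [ A ]) ≡ sub (exts σ) T [ sub σ A ]
  sub-[] σ T A = trans (sub-sub σ (single A) T)
                       (trans (sub-cong eq T) (sym (exts-[] σ T (sub σ A))))
    where
    eq : sub σ ∘ single A ≗ sub σ A ◂ σ
    eq zero    = refl
    eq (suc x) = refl

  renN-[] : ∀ (ρ : ℕ → ℕ) (T : Term (suc n) s) A → renN ρ (T [ A ]) ≡ renN ρ T [ renN ρ A ]
  renN-[] ρ T A = trans (renN-sub ρ (single A) T) (sub-cong eq (renN ρ T))
    where
    eq : renN ρ ∘ single A ≗ single (renN ρ A)
    eq zero    = refl
    eq (suc x) = refl

  renV-[] : ∀ (ξ : Fin n → Fin m) (T : Term (suc n) s) A →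
            renV ξ (T [ A ]) ≡ renV (ext ξ) T [ renV ξ A ]
  renV-[] ξ T A = trans (renV-sub ξ (single A) T)
                        (trans (sub-cong eq T) (sym (sub-renV (single (renV ξ A)) (ext ξ) T)))
    where
    eq : renV ξ ∘ single A ≗ single (renV ξ A) ∘ ext ξ
    eq zero    = refl
    eq (suc x) = refl

  renN-ν^ : ∀ k (ρ : ℕ → ℕ) (T : Term n proc) → renN ρ (ν^ k T) ≡ ν^ k (renN (lift^ k ρ) T)
  renN-ν^ zero    ρ T = refl
  renN-ν^ (suc k) ρ T =
    cong ν (trans (renN-ν^ k (lift ρ) T) (cong (ν^ k) (renN-cong (lift^-lift k ρ) T)))

  renV-ν^ : ∀ k (ξ : Fin n → Fin m) (T : Term n proc) → renV ξ (ν^ k T) ≡ ν^ k (renV ξ T)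
  renV-ν^ zero    ξ T = refl
  renV-ν^ (suc k) ξ T = cong ν (renV-ν^ k ξ T)

  +-suc-≗ : ∀ k → (k +_) ∘ suc ≗ (suc k +_)
  +-suc-≗ k a = +-suc k a

  sub-ν^ : ∀ k (σ : Sub n m) (T : Term n proc) →
           sub σ (ν^ k T) ≡ ν^ k (sub (renN (k +_) ∘ σ) T)
  sub-ν^ zero    σ T = sub-cong (λ x → sym (renN-id (λ _ → refl) (σ x))) T
  sub-ν^ (suc k) σ T =
    cong ν (trans (sub-ν^ k (renN suc ∘ σ) T)
                  (cong (ν^ k) (sub-cong (λ x → renN-triangle (+-suc-≗ k) (σ x)) T)))

  ν^-+ : ∀ k l (T : Term n proc) → ν^ (k + l) T ≡ ν^ k (ν^ l T)
  ν^-+ zero    l T = refl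
  ν^-+ (suc k) l T = cong ν (ν^-+ k l T)

-- Structural congruence

module _ where

  private variable
    n m : ℕ
    s   : Kind
    b   : Bool
    T T′ U U′ V V′ : Term n s
    A A′ B B′ : Term n abs

  infix 4 _∼[_]_ _≡ₛ_

  -- One parallel step of structural congruence; β-conversion is available
  -- only under the flag true.  A β-step is prepended or appended to a step of
  -- the contractum, which keeps the relation stable under substitution while
  -- letting an induction on it pass from a redex to its contractum.
  data _∼[_]_ : ∀ {n s} → Term n s → Bool → Term n s → Set where
    var : ∀ {x : Fin n} → var x ∼[ b ] var x
    ƛ   : T ∼[ b ] T′ → ƛ T ∼[ b ] ƛ T′
    𝟎   : 𝟎 {n} ∼[ b ] 𝟎
    inp : ∀ {a} → T ∼[ b ] T′ → inp a T ∼[ b ] inp a T′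
    out : ∀ {a} → A ∼[ b ] A′ → T ∼[ b ] T′ → out a A T ∼[ b ] out a A′ T′
    _∥_ : T ∼[ b ] T′ → U ∼[ b ] U′ → T ∥ U ∼[ b ] T′ ∥ U′
    ν   : T ∼[ b ] T′ → ν T ∼[ b ] ν T′
    _·_ : A ∼[ b ] A′ → B ∼[ b ] B′ → A · B ∼[ b ] A′ · B′
    id→ : T ∼[ b ] T′ → T ∥ 𝟎 ∼[ b ] T′
    id← : T ∼[ b ] T′ → T ∼[ b ] T′ ∥ 𝟎
    as→ : T ∼[ b ] T′ → U ∼[ b ] U′ → V ∼[ b ] V′ → (T ∥ U) ∥ V ∼[ b ] T′ ∥ (U′ ∥ V′)
    as← : T ∼[ b ] T′ → U ∼[ b ] U′ → V ∼[ b ] V′ → T ∥ (U ∥ V) ∼[ b ] (T′ ∥ U′) ∥ V′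
    com : T ∼[ b ] T′ → U ∼[ b ] U′ → T ∥ U ∼[ b ] U′ ∥ T′
    swp : T ∼[ b ] T′ → U ≡ renN swap T′ → ν (ν T) ∼[ b ] ν (ν U)
    in→ : ν (inp 0 T) ∼[ b ] 𝟎
    in← : 𝟎 ∼[ b ] ν (inp 0 T)
    ou→ : ν (out 0 A T) ∼[ b ] 𝟎
    ou← : 𝟎 ∼[ b ] ν (out 0 A T)
    ex→ : T ∼[ b ] T′ → U ∼[ b ] U′ → V ≡ renN suc U → ν (T ∥ V) ∼[ b ] ν T′ ∥ U′
    ex← : T ∼[ b ] T′ → U ∼[ b ] U′ → V ≡ renN suc U′ → ν T ∥ U ∼[ b ] ν (T′ ∥ V)
    β→  : V ≡ T [ A ] → V ∼[ true ] U → ƛ T · A ∼[ true ] U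
    β←  : V ≡ U [ A ] → T ∼[ true ] V → T ∼[ true ] ƛ U · A

  ∼-refl : (T : Term n s) → T ∼[ b ] T
  ∼-refl (var x)     = var
  ∼-refl (ƛ T)       = ƛ (∼-refl T)
  ∼-refl 𝟎           = 𝟎
  ∼-refl (inp a T)   = inp (∼-refl T)
  ∼-refl (out a A T) = out (∼-refl A) (∼-refl T)
  ∼-refl (T ∥ U)     = ∼-refl T ∥ ∼-refl U
  ∼-refl (ν T)       = ν (∼-refl T)
  ∼-refl (A · B)     = ∼-refl A · ∼-refl B

  renN-∼ : ∀ ρ → T ∼[ b ] U → renN ρ T ∼[ b ] renN ρ U
  renN-∼ ρ var         = var
  renN-∼ ρ (ƛ e)       = ƛ (renN-∼ ρ e)
  renN-∼ ρ 𝟎           = 𝟎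
  renN-∼ ρ (inp e)     = inp (renN-∼ ρ e)
  renN-∼ ρ (out e f)   = out (renN-∼ ρ e) (renN-∼ ρ f)
  renN-∼ ρ (e ∥ f)     = renN-∼ ρ e ∥ renN-∼ ρ f
  renN-∼ ρ (ν e)       = ν (renN-∼ (lift ρ) e)
  renN-∼ ρ (e · f)     = renN-∼ ρ e · renN-∼ ρ f
  renN-∼ ρ (id→ e)     = id→ (renN-∼ ρ e)
  renN-∼ ρ (id← e)     = id← (renN-∼ ρ e)
  renN-∼ ρ (as→ e f g) = as→ (renN-∼ ρ e) (renN-∼ ρ f) (renN-∼ ρ g)
  renN-∼ ρ (as← e f g) = as← (renN-∼ ρ e) (renN-∼ ρ f) (renN-∼ ρ g)
  renN-∼ ρ (com e f)   = com (renN-∼ ρ e) (renN-∼ ρ f)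
  renN-∼ ρ (swp {T′ = T′} e refl) =
    swp (renN-∼ (lift (lift ρ)) e) (renN-square (sym ∘ swap-lift² ρ) T′)
  renN-∼ ρ in→         = in→
  renN-∼ ρ in←         = in←
  renN-∼ ρ ou→         = ou→
  renN-∼ ρ ou←         = ou←
  renN-∼ ρ (ex→ {U = U} e f refl) =
    ex→ (renN-∼ (lift ρ) e) (renN-∼ ρ f) (renN-square (λ _ → refl) U)
  renN-∼ ρ (ex← {U′ = U} e f refl) =
    ex← (renN-∼ (lift ρ) e) (renN-∼ ρ f) (renN-square (λ _ → refl) U)
  renN-∼ ρ (β→ {T = T} {A = A} refl e) = β→ (renN-[] ρ T A) (renN-∼ ρ e)
  renN-∼ ρ (β← {U = U} {A = A} refl e) = β← (renN-[] ρ U A) (renN-∼ ρ e)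

  renV-∼ : (ξ : Fin n → Fin m) → T ∼[ b ] U → renV ξ T ∼[ b ] renV ξ U
  renV-∼ ξ var         = var
  renV-∼ ξ (ƛ e)       = ƛ (renV-∼ (ext ξ) e)
  renV-∼ ξ 𝟎           = 𝟎
  renV-∼ ξ (inp e)     = inp (renV-∼ (ext ξ) e)
  renV-∼ ξ (out e f)   = out (renV-∼ ξ e) (renV-∼ ξ f)
  renV-∼ ξ (e ∥ f)     = renV-∼ ξ e ∥ renV-∼ ξ f
  renV-∼ ξ (ν e)       = ν (renV-∼ ξ e)
  renV-∼ ξ (e · f)     = renV-∼ ξ e · renV-∼ ξ f
  renV-∼ ξ (id→ e)     = id→ (renV-∼ ξ e)
  renV-∼ ξ (id← e)     = id← (renV-∼ ξ e)
  renV-∼ ξ (as→ e f g) = as→ (renV-∼ ξ e) (renV-∼ ξ f) (renV-∼ ξ g)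
  renV-∼ ξ (as← e f g) = as← (renV-∼ ξ e) (renV-∼ ξ f) (renV-∼ ξ g)
  renV-∼ ξ (com e f)   = com (renV-∼ ξ e) (renV-∼ ξ f)
  renV-∼ ξ (swp {T′ = T′} e refl) = swp (renV-∼ ξ e) (sym (renN-renV swap ξ T′))
  renV-∼ ξ in→         = in→
  renV-∼ ξ in←         = in←
  renV-∼ ξ ou→         = ou→
  renV-∼ ξ ou←         = ou←
  renV-∼ ξ (ex→ {U = U} e f refl)  = ex→ (renV-∼ ξ e) (renV-∼ ξ f) (sym (renN-renV suc ξ U))
  renV-∼ ξ (ex← {U′ = U} e f refl) = ex← (renV-∼ ξ e) (renV-∼ ξ f) (sym (renN-renV suc ξ U))
  renV-∼ ξ (β→ {T = T} {A = A} refl e) = β→ (renV-[] ξ T A) (renV-∼ ξ e)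
  renV-∼ ξ (β← {U = U} {A = A} refl e) = β← (renV-[] ξ U A) (renV-∼ ξ e)

  exts-∼ : {σ σ′ : Sub n m} → (∀ x → σ x ∼[ b ] σ′ x) → ∀ x → exts σ x ∼[ b ] exts σ′ x
  exts-∼ h zero    = var
  exts-∼ h (suc x) = renV-∼ suc (h x)

  sub-renN-suc : (σ : Sub n m) (T : Term n s) →
                 sub (renN suc ∘ σ) (renN suc T) ≡ renN suc (sub σ T)
  sub-renN-suc σ T = sym (renN-sub suc σ T)

  sub-renN-swap : (σ : Sub n m) (T : Term n s) →
    sub (renN suc ∘ (renN suc ∘ σ)) (renN swap T) ≡
    renN swap (sub (renN suc ∘ (renN suc ∘ σ)) T)
  sub-renN-swap σ T =
    sym (trans (renN-sub swap _ T)
               (sub-cong (λ x → trans (cong (renN swap) (renN-∘ suc suc (σ x)))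
                                      (trans (renN-∘ swap _ (σ x)) (sym (renN-∘ suc suc (σ x)))))
                         (renN swap T)))

  sub-∼ : {σ σ′ : Sub n m} → (∀ x → σ x ∼[ b ] σ′ x) → T ∼[ b ] U → sub σ T ∼[ b ] sub σ′ U
  sub-∼ h (var {x = x}) = h x
  sub-∼ h (ƛ e)       = ƛ (sub-∼ (exts-∼ h) e)
  sub-∼ h 𝟎           = 𝟎
  sub-∼ h (inp e)     = inp (sub-∼ (exts-∼ h) e)
  sub-∼ h (out e f)   = out (sub-∼ h e) (sub-∼ h f)
  sub-∼ h (e ∥ f)     = sub-∼ h e ∥ sub-∼ h f
  sub-∼ h (ν e)       = ν (sub-∼ (renN-∼ suc ∘ h) e)
  sub-∼ h (e · f)     = sub-∼ h e · sub-∼ h f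
  sub-∼ h (id→ e)     = id→ (sub-∼ h e)
  sub-∼ h (id← e)     = id← (sub-∼ h e)
  sub-∼ h (as→ e f g) = as→ (sub-∼ h e) (sub-∼ h f) (sub-∼ h g)
  sub-∼ h (as← e f g) = as← (sub-∼ h e) (sub-∼ h f) (sub-∼ h g)
  sub-∼ h (com e f)   = com (sub-∼ h e) (sub-∼ h f)
  sub-∼ {σ′ = σ′} h (swp {T′ = T′} e refl) =
    swp (sub-∼ (renN-∼ suc ∘ (renN-∼ suc ∘ h)) e) (sub-renN-swap σ′ T′)
  sub-∼ h in→         = in→
  sub-∼ h in←         = in←
  sub-∼ h ou→         = ou→
  sub-∼ h ou←         = ou←
  sub-∼ {σ = σ} h (ex→ {U = U} e f refl) =
    ex→ (sub-∼ (renN-∼ suc ∘ h) e) (sub-∼ h f) (sub-renN-suc σ U)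
  sub-∼ {σ′ = σ′} h (ex← {U′ = U} e f refl) =
    ex← (sub-∼ (renN-∼ suc ∘ h) e) (sub-∼ h f) (sub-renN-suc σ′ U)
  sub-∼ {σ = σ} h (β→ {T = T} {A = A} refl e)   = β→ (sub-[] σ T A) (sub-∼ h e)
  sub-∼ {σ′ = σ′} h (β← {U = U} {A = A} refl e) = β← (sub-[] σ′ U A) (sub-∼ h e)

  []-∼ : {T T′ : Term (suc n) s} → T ∼[ b ] T′ → A ∼[ b ] A′ → T [ A ] ∼[ b ] T′ [ A′ ]
  []-∼ e f = sub-∼ (λ { zero → f ; (suc x) → var }) e

  ∼-sym : T ∼[ b ] U → U ∼[ b ] T
  ∼-sym var         = var
  ∼-sym (ƛ e)       = ƛ (∼-sym e)
  ∼-sym 𝟎           = 𝟎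
  ∼-sym (inp e)     = inp (∼-sym e)
  ∼-sym (out e f)   = out (∼-sym e) (∼-sym f)
  ∼-sym (e ∥ f)     = ∼-sym e ∥ ∼-sym f
  ∼-sym (ν e)       = ν (∼-sym e)
  ∼-sym (e · f)     = ∼-sym e · ∼-sym f
  ∼-sym (id→ e)     = id← (∼-sym e)
  ∼-sym (id← e)     = id→ (∼-sym e)
  ∼-sym (as→ e f g) = as← (∼-sym e) (∼-sym f) (∼-sym g)
  ∼-sym (as← e f g) = as→ (∼-sym e) (∼-sym f) (∼-sym g)
  ∼-sym (com e f)   = com (∼-sym f) (∼-sym e)
  ∼-sym (swp {T = T} e refl) =
    swp (renN-∼ swap (∼-sym e)) (sym (trans (renN-∘ swap swap T) (renN-id swap-involutive T)))
  ∼-sym in→         = in←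
  ∼-sym in←         = in→
  ∼-sym ou→         = ou←
  ∼-sym ou←         = ou→
  ∼-sym (ex→ e f p) = ex← (∼-sym e) (∼-sym f) p
  ∼-sym (ex← e f p) = ex→ (∼-sym e) (∼-sym f) p
  ∼-sym (β→ p e)    = β← p (∼-sym e)
  ∼-sym (β← p e)    = β→ p (∼-sym e)

  ≡⇒≋ : T ≡ U → T ≋ U
  ≡⇒≋ refl = ≋-refl

  ∼⇒≋ : T ∼[ b ] U → T ≋ U
  ∼⇒≋ var         = ≋-refl
  ∼⇒≋ (ƛ e)       = ƛ-cong (∼⇒≋ e)
  ∼⇒≋ 𝟎           = ≋-refl
  ∼⇒≋ (inp e)     = inp-cong (∼⇒≋ e)
  ∼⇒≋ (out e f)   = out-cong (∼⇒≋ e) (∼⇒≋ f)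
  ∼⇒≋ (e ∥ f)     = ∥-cong (∼⇒≋ e) (∼⇒≋ f)
  ∼⇒≋ (ν e)       = ν-cong (∼⇒≋ e)
  ∼⇒≋ (e · f)     = ·-cong (∼⇒≋ e) (∼⇒≋ f)
  ∼⇒≋ (id→ e)     = ≋-trans ∥-identity (∼⇒≋ e)
  ∼⇒≋ (id← e)     = ≋-trans (∼⇒≋ e) (≋-sym ∥-identity)
  ∼⇒≋ (as→ e f g) = ≋-trans ∥-assoc (∥-cong (∼⇒≋ e) (∥-cong (∼⇒≋ f) (∼⇒≋ g)))
  ∼⇒≋ (as← e f g) = ≋-trans (≋-sym ∥-assoc) (∥-cong (∥-cong (∼⇒≋ e) (∼⇒≋ f)) (∼⇒≋ g))
  ∼⇒≋ (com e f)   = ≋-trans ∥-comm (∥-cong (∼⇒≋ f) (∼⇒≋ e))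
  ∼⇒≋ (swp e refl)   = ≋-trans (ν-cong (ν-cong (∼⇒≋ e))) ν-swap
  ∼⇒≋ in→         = ν-inp
  ∼⇒≋ in←         = ≋-sym ν-inp
  ∼⇒≋ ou→         = ν-out
  ∼⇒≋ ou←         = ≋-sym ν-out
  ∼⇒≋ (ex→ e f refl) = ≋-trans ν-extrude (∥-cong (ν-cong (∼⇒≋ e)) (∼⇒≋ f))
  ∼⇒≋ (ex← e f refl) = ≋-trans (∥-cong (ν-cong (∼⇒≋ e)) (∼⇒≋ f)) (≋-sym ν-extrude)
  ∼⇒≋ (β→ refl e) = ≋-trans β (∼⇒≋ e)
  ∼⇒≋ (β← refl e) = ≋-trans (∼⇒≋ e) (≋-sym β)

  ∼* : Bool → Term n s → Term n s → Set
  ∼* b = Star (λ T U → T ∼[ b ] U)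

  reverse* : ∼* b T U → ∼* b U T
  reverse* ε        = ε
  reverse* (e ◅ es) = reverse* es ◅◅ ∼-sym e ◅ ε

  ∼*⇒≋ : ∼* b T U → T ≋ U
  ∼*⇒≋ ε        = ≋-refl
  ∼*⇒≋ (e ◅ es) = ≋-trans (∼⇒≋ e) (∼*⇒≋ es)

  ∥-cong* : ∼* b T T′ → ∼* b U U′ → ∼* b (T ∥ U) (T′ ∥ U′)
  ∥-cong* es fs = gmap (_∥ _) (_∥ ∼-refl _) es ◅◅ gmap (_ ∥_) (∼-refl _ ∥_) fs

  ≋⇒∼* : T ≋ U → ∼* true T U
  ≋⇒∼* ≋-refl        = ε
  ≋⇒∼* (≋-sym e)     = reverse* (≋⇒∼* e)
  ≋⇒∼* (≋-trans e f) = ≋⇒∼* e ◅◅ ≋⇒∼* f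
  ≋⇒∼* (ƛ-cong e)    = gmap ƛ ƛ (≋⇒∼* e)
  ≋⇒∼* (inp-cong e)  = gmap (inp _) inp (≋⇒∼* e)
  ≋⇒∼* (out-cong e f) =
    gmap (λ A → out _ A _) (λ x → out x (∼-refl _)) (≋⇒∼* e) ◅◅
    gmap (out _ _) (out (∼-refl _)) (≋⇒∼* f)
  ≋⇒∼* (∥-cong e f)  = ∥-cong* (≋⇒∼* e) (≋⇒∼* f)
  ≋⇒∼* (ν-cong e)    = gmap ν ν (≋⇒∼* e)
  ≋⇒∼* (·-cong e f)  =
    gmap (_· _) (_· ∼-refl _) (≋⇒∼* e) ◅◅ gmap (_ ·_) (∼-refl _ ·_) (≋⇒∼* f)
  ≋⇒∼* ∥-identity    = id→ (∼-refl _) ◅ ε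
  ≋⇒∼* ∥-assoc       = as→ (∼-refl _) (∼-refl _) (∼-refl _) ◅ ε
  ≋⇒∼* ∥-comm        = com (∼-refl _) (∼-refl _) ◅ ε
  ≋⇒∼* ν-swap        = swp (∼-refl _) refl ◅ ε
  ≋⇒∼* ν-inp         = in→ ◅ ε
  ≋⇒∼* ν-out         = ou→ ◅ ε
  ≋⇒∼* ν-extrude     = ex→ (∼-refl _) (∼-refl _) refl ◅ ε
  ≋⇒∼* β             = β→ refl (∼-refl _) ◅ ε

  renN-≋ : ∀ ρ → T ≋ U → renN ρ T ≋ renN ρ U
  renN-≋ ρ e = ∼*⇒≋ (gmap (renN ρ) (renN-∼ ρ) (≋⇒∼* e))

  renV-≋ : (ξ : Fin n → Fin m) → T ≋ U → renV ξ T ≋ renV ξ U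
  renV-≋ ξ e = ∼*⇒≋ (gmap (renV ξ) (renV-∼ ξ) (≋⇒∼* e))

  sub-≋ : (σ : Sub n m) → T ≋ U → sub σ T ≋ sub σ U
  sub-≋ σ e = ∼*⇒≋ (gmap (sub σ) (sub-∼ (λ x → ∼-refl (σ x))) (≋⇒∼* e))

  []-≋ : {T T′ : Term (suc n) s} → T ≋ T′ → A ≋ A′ → T [ A ] ≋ T′ [ A′ ]
  []-≋ {T′ = T′} e f =
    ≋-trans (sub-≋ _ e) (∼*⇒≋ (gmap (T′ [_]) ([]-∼ (∼-refl T′)) (≋⇒∼* f)))

  ν^-≋ : ∀ k {T U : Term n proc} → T ≋ U → ν^ k T ≋ ν^ k U
  ν^-≋ zero    e = e
  ν^-≋ (suc k) e = ν-cong (ν^-≋ k e)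

  -- Structural congruence without β, which preserves the number of β-steps
  -- needed to perform a transition.
  _≡ₛ_ : Term n s → Term n s → Set
  _≡ₛ_ = ∼* false

  ∼⇒≡ₛ : T ∼[ false ] U → T ≡ₛ U
  ∼⇒≡ₛ e = e ◅ ε

  ≡⇒≡ₛ : T ≡ U → T ≡ₛ U
  ≡⇒≡ₛ refl = ε

  ν-≡ₛ : {T U : Term (n) proc} → T ≡ₛ U → ν T ≡ₛ ν U
  ν-≡ₛ = gmap ν ν

  ν^-≡ₛ : ∀ k {T U : Term n proc} → T ≡ₛ U → ν^ k T ≡ₛ ν^ k U
  ν^-≡ₛ zero    e = e
  ν^-≡ₛ (suc k) e = ν-≡ₛ (ν^-≡ₛ k e)

  ∥-comm-≡ₛ : (T U : Term n proc) → T ∥ U ≡ₛ U ∥ T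
  ∥-comm-≡ₛ T U = ∼⇒≡ₛ (com (∼-refl T) (∼-refl U))

  ∥-assoc-≡ₛ : (T U V : Term n proc) → (T ∥ U) ∥ V ≡ₛ T ∥ (U ∥ V)
  ∥-assoc-≡ₛ T U V = ∼⇒≡ₛ (as→ (∼-refl T) (∼-refl U) (∼-refl V))

  ∥-right-comm-≡ₛ : (T U V : Term n proc) → (T ∥ U) ∥ V ≡ₛ (T ∥ V) ∥ U
  ∥-right-comm-≡ₛ T U V =
    ∥-assoc-≡ₛ T U V ◅◅ ∥-cong* ε (∥-comm-≡ₛ U V) ◅◅ reverse* (∥-assoc-≡ₛ T V U)

  ν^-extrude : ∀ k (T U : Term n proc) → ν^ k (T ∥ renN (k +_) U) ≡ₛ ν^ k T ∥ U
  ν^-extrude zero    T U = ∥-cong* ε (≡⇒≡ₛ (renN-id (λ _ → refl) U))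
  ν^-extrude (suc k) T U =
    ν-≡ₛ (ν^-≡ₛ k (∥-cong* ε (≡⇒≡ₛ (sym (renN-triangle (+-suc-≗ k) U)))) ◅◅
          ν^-extrude k T (renN suc U)) ◅◅
    ∼⇒≡ₛ (ex→ (∼-refl _) (∼-refl U) refl)

  ν^-extrudeˡ : ∀ k (T U : Term n proc) → ν^ k (renN (k +_) U ∥ T) ≡ₛ U ∥ ν^ k T
  ν^-extrudeˡ k T U =
    ν^-≡ₛ k (∥-comm-≡ₛ _ _) ◅◅ ν^-extrude k T U ◅◅ ∥-comm-≡ₛ _ _

  ν-extrudeˡ : (T U : Term n proc) → ν (renN suc U ∥ T) ≡ₛ U ∥ ν T
  ν-extrudeˡ T U =
    ν-≡ₛ (∥-comm-≡ₛ _ _) ◅◅ ∼⇒≡ₛ (ex→ (∼-refl T) (∼-refl U) refl) ◅◅ ∥-comm-≡ₛ _ _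

  -- The outer binder is swapped with its neighbour and carried through the remaining ones by
  -- induction; `rot-swap` states that these swaps compose to `rot`.
  ν-ν^ : ∀ k (T : Term n proc) → ν (ν^ k T) ≡ₛ ν^ k (ν (renN (rot k) T))
  ν-ν^ zero    T = ≡⇒≡ₛ (cong ν (sym (renN-id (λ _ → refl) T)))
  ν-ν^ (suc k) T =
    ∼⇒≡ₛ (swp (∼-refl _) refl) ◅◅
    ν-≡ₛ (≡⇒≡ₛ (cong ν (renN-ν^ k swap T)) ◅◅ ν-ν^ k (renN (lift^ k swap) T) ◅◅
          ν^-≡ₛ k (≡⇒≡ₛ (cong ν (renN-triangle (rot-swap k) T))))
    where
    rot-swap : ∀ k → rot k ∘ lift^ k swap ≗ rot (suc k)
    rot-swap zero    zero          = refl
    rot-swap zero    (suc zero)    = refl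
    rot-swap zero    (suc (suc a)) = refl
    rot-swap (suc k) a             =
      cong swap (trans (lift-∘ (rot k) (lift^ k swap) a) (lift-cong (rot-swap k) a))

  -- `θ` exchanges a block of `k` binders with the block of `e` binders below it. Its values are
  -- never computed: what it is applied to is assembled from terms that know only one block, so
  -- `θ-inner` (for terms ignoring the inner block) and `θ-outer` (for terms ignoring the outer one)
  -- suffice.
  record BlockSwap (k e : ℕ) : Set where
    field
      θ       : ℕ → ℕ
      θ-inner : θ ∘ (e +_) ≗ lift^ k (e +_)
      θ-outer : θ ∘ lift^ e (k +_) ≗ (k +_)
      ν^-ν^   : ∀ {n} (T : Term n proc) → ν^ k (ν^ e T) ≡ₛ ν^ e (ν^ k (renN θ T))

  blockSwap : ∀ k e → BlockSwap k e
  blockSwap zero e = record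
    { θ       = id
    ; θ-inner = λ _ → refl
    ; θ-outer = lift^-id e (λ _ → refl)
    ; ν^-ν^   = λ T → ≡⇒≡ₛ (cong (ν^ e) (sym (renN-id (λ _ → refl) T)))
    }
  blockSwap (suc k) e = record
    { θ       = lift^ k (rot e) ∘ θ
    ; θ-inner = λ a → trans (cong (lift^ k (rot e)) (θ-inner a))
                            (trans (lift^-∘ k (rot e) (e +_) a)
                                   (trans (lift^-cong k (rot-shift e) a) (lift^-lift k (e +_) a)))
    ; θ-outer = λ a → trans (cong (lift^ k (rot e) ∘ θ)
                                  (trans (lift^-cong e (λ x → sym (+-suc k x)) a)
                                         (sym (lift^-∘ e (k +_) suc a))))
                            (trans (cong (lift^ k (rot e)) (θ-outer (lift^ e suc a)))
                                   (trans (lift^-shift k (rot e) (lift^ e suc a))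
                                          (trans (cong (k +_) (rot-lift^ e a)) (+-suc k a))))
    ; ν^-ν^   = λ T → ν-≡ₛ (ν^-ν^ T) ◅◅ ν-ν^ e _ ◅◅
                      ν^-≡ₛ e (≡⇒≡ₛ (cong ν (trans (renN-ν^ k (rot e) (renN θ T))
                                                   (cong (ν^ k) (renN-∘ _ θ T)))))
    }
    where open BlockSwap (blockSwap k e)

-- Late transitions

module _ where

  private variable
    n m i j : ℕ
    s   : Kind
    b   : Bool
    T T′ U U′ V V′ : Term n s
    A A′ B B′ : Term n abs

  data Act : Set where
    τ   : Act
    rcv : ℕ → Act
    snd : ℕ → Act

  -- The concretion (c₁ … c_k)⟨A⟩T.
  record Con (n : ℕ) : Set where
    constructor con
    field
      size : ℕ
      obj  : Term n abs
      cont : Term n proc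

  Res : ℕ → Act → Set
  Res n τ       = Term n proc
  Res n (rcv a) = Term (suc n) proc
  Res n (snd a) = Con n

  -- The same formula is the outcome of a communication with the receiver `F` and, when `F` is a
  -- context, the process that the output clause of context bisimulation compares.
  plug : Con n → Term (suc n) proc → Term n proc
  plug (con k A T) F = ν^ k (renN (k +_) F [ A ] ∥ T)

  renA : (ℕ → ℕ) → Act → Act
  renA ρ τ       = τ
  renA ρ (rcv a) = rcv (ρ a)
  renA ρ (snd a) = snd (ρ a)

  renC : (ℕ → ℕ) → Con n → Con n
  renC ρ (con k A T) = con k (renN (lift^ k ρ) A) (renN (lift^ k ρ) T)

  subC : Sub n m → Con n → Con m
  subC σ (con k A T) = con k (sub (renN (k +_) ∘ σ) A) (sub (renN (k +_) ∘ σ) T)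

  renR : (ρ : ℕ → ℕ) (α : Act) → Res n α → Res n (renA ρ α)
  renR ρ τ       R = renN ρ R
  renR ρ (rcv a) R = renN ρ R
  renR ρ (snd a) R = renC ρ R

  subR : Sub n m → (α : Act) → Res n α → Res m α
  subR σ τ       R = sub σ R
  subR σ (rcv a) R = sub (exts σ) R
  subR σ (snd a) R = subC σ R

  parC : Con n → Term n proc → Con n
  parC (con k A T) U = con k A (T ∥ renN (k +_) U)

  parR : (α : Act) → Res n α → Term n proc → Res n α
  parR τ       R U = R ∥ U
  parR (rcv a) R U = R ∥ wk U
  parR (snd a) R U = parC R U

  νC : Con n → Con n
  νC (con k A T) = con (suc k) A T

  νR : (α : Act) → Res n (renA suc α) → Res n α
  νR τ       R = ν R
  νR (rcv a) R = ν R
  νR (snd a) R = νC R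

  infix 4 _↦⟨_∣_⟩_

  -- Transitions without the rule for structural congruence: inputs are late
  -- (their residual is an abstraction), every restriction above an output is
  -- extruded, and ⟨ i ∣ α ⟩ counts the β-steps i needed to expose α.
  data _↦⟨_∣_⟩_ {n} : Term n proc → ℕ → (α : Act) → Res n α → Set where
    inp  : ∀ {a T} → inp a T ↦⟨ 0 ∣ rcv a ⟩ T
    out  : ∀ {a A T} → out a A T ↦⟨ 0 ∣ snd a ⟩ con 0 A T
    parl : ∀ {T U i α R} → T ↦⟨ i ∣ α ⟩ R → T ∥ U ↦⟨ i ∣ α ⟩ parR α R U
    parr : ∀ {T U i α R} → U ↦⟨ i ∣ α ⟩ R → T ∥ U ↦⟨ i ∣ α ⟩ parR α R T
    coml : ∀ {T U i j a F K} → T ↦⟨ i ∣ rcv a ⟩ F → U ↦⟨ j ∣ snd a ⟩ K →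
           T ∥ U ↦⟨ i + j ∣ τ ⟩ plug K F
    comr : ∀ {T U i j a F K} → T ↦⟨ i ∣ snd a ⟩ K → U ↦⟨ j ∣ rcv a ⟩ F →
           T ∥ U ↦⟨ j + i ∣ τ ⟩ plug K F
    res  : ∀ {T i α R} → T ↦⟨ i ∣ renA suc α ⟩ R → ν T ↦⟨ i ∣ α ⟩ νR α R
    β    : ∀ {T A i α R} → T [ A ] ↦⟨ i ∣ α ⟩ R → ƛ T · A ↦⟨ suc i ∣ α ⟩ R

  cast : ∀ {α} {R S : Res n α} → R ≡ S → T ↦⟨ i ∣ α ⟩ R → T ↦⟨ i ∣ α ⟩ S
  cast refl d = d

  castT : ∀ {α} {R : Res n α} → T ≡ U → T ↦⟨ i ∣ α ⟩ R → U ↦⟨ i ∣ α ⟩ R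
  castT refl d = d

  castRcv : ∀ {a c} {F : Term (suc n) proc} → a ≡ c → T ↦⟨ i ∣ rcv a ⟩ F → T ↦⟨ i ∣ rcv c ⟩ F
  castRcv refl d = d

  castSnd : ∀ {a c} {K : Con n} → a ≡ c → T ↦⟨ i ∣ snd a ⟩ K → T ↦⟨ i ∣ snd c ⟩ K
  castSnd refl d = d

  plug-≋ : (K : Con n) {F G : Term (suc n) proc} → F ≋ G → plug K F ≋ plug K G
  plug-≋ (con k A T) e = ν^-≋ k (∥-cong ([]-≋ (renN-≋ (k +_) e) ≋-refl) ≋-refl)

  plug-renN : ∀ ρ (K : Con n) F → renN ρ (plug K F) ≡ plug (renC ρ K) (renN ρ F)
  plug-renN ρ (con k A T) F = trans (renN-ν^ k ρ _) (cong (λ X → ν^ k (X ∥ _))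
    (trans (renN-[] (lift^ k ρ) (renN (k +_) F) A)
           (cong (_[ _ ]) (renN-square (lift^-shift k ρ) F))))

  sub-exts-shift : ∀ k (σ : Sub n m) (F : Term (suc n) s) →
    sub (exts (renN (k +_) ∘ σ)) (renN (k +_) F) ≡ renN (k +_) (sub (exts σ) F)
  sub-exts-shift k σ F =
    sym (trans (renN-sub (k +_) (exts σ) F) (sub-cong (exts-renN (k +_) σ) (renN (k +_) F)))

  plug-sub : (σ : Sub n m) (K : Con n) (F : Term (suc n) proc) →
             sub σ (plug K F) ≡ plug (subC σ K) (sub (exts σ) F)
  plug-sub σ (con k A T) F = trans (sub-ν^ k σ _) (cong (λ X → ν^ k (X ∥ _))
    (trans (sub-[] (renN (k +_) ∘ σ) (renN (k +_) F) A)
           (cong (_[ _ ]) (sub-exts-shift k σ F))))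

  plug-νC : (K : Con n) (F : Term (suc n) proc) → plug (νC K) F ≡ ν (plug K (renN suc F))
  plug-νC (con k A T) F =
    cong (λ X → ν (ν^ k (X [ A ] ∥ T))) (sym (renN-triangle (+-suc-≗ k) F))

  plug-parC : (K : Con n) (U : Term n proc) (F : Term (suc n) proc) →
              plug (parC K U) F ≡ₛ plug K F ∥ U
  plug-parC (con k A T) U F =
    ν^-≡ₛ k (reverse* (∥-assoc-≡ₛ _ _ _)) ◅◅ ν^-extrude k _ U

  renN-wk-[] : ∀ ρ (U : Term n s) A → renN ρ (wk U) [ A ] ≡ renN ρ U
  renN-wk-[] ρ U A = trans (cong (_[ A ]) (renN-renV ρ suc U)) (wk-[] (renN ρ U) A)

  plug-wk : (K : Con n) (F : Term (suc n) proc) (U : Term n proc) →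
            plug K (F ∥ wk U) ≡ₛ plug K F ∥ U
  plug-wk (con k A T) F U =
    ν^-≡ₛ k (∥-right-comm-≡ₛ _ _ _ ◅◅ ∥-cong* ε (≡⇒≡ₛ (renN-wk-[] (k +_) U A))) ◅◅
    ν^-extrude k _ U

  ν-[] : (F : Term (suc n) proc) (A : Term n abs) → ν F [ A ] ≡ ν (F [ renN suc A ])
  ν-[] F A = cong ν (sub-cong (λ { zero → refl ; (suc x) → refl }) F)

  -- On the left the private name of the receiver lies inside the extruded names, on the right
  -- outside; `ν-ν^` moves it across, while `rot-shift` and `rot-lift^` rename the receiver and the
  -- concretion accordingly.
  plug-ν : (K : Con n) (F : Term (suc n) proc) → plug K (ν F) ≡ₛ ν (plug (renC suc K) F)
  plug-ν (con k A T) F =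
    ν^-≡ₛ k (≡⇒≡ₛ (cong (_∥ T) (ν-[] (renN (lift (k +_)) F) A)) ◅◅
             reverse* (∼⇒≡ₛ (ex→ (∼-refl _) (∼-refl T) refl))) ◅◅
    reverse* (ν-ν^ k _ ◅◅ ν^-≡ₛ k (≡⇒≡ₛ (cong ν (cong₂ _∥_
      (trans (renN-[] (rot k) (renN (k +_) F) _)
             (cong₂ _[_] (renN-triangle (rot-shift k) F)
                         (renN-triangle (rot-lift^ k) A)))
      (renN-triangle (rot-lift^ k) T)))))

  -- Congruent processes may extrude different numbers of names, in a different order, so the
  -- objects and continuations of concretions cannot be compared separately; they are compared
  -- through every receiver.
  Equiv : (α : Act) → Res n α → Res n α → Set
  Equiv τ       R S = R ≋ S
  Equiv (rcv a) R S = R ≋ S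
  Equiv (snd a) K L = ∀ F → plug K F ≋ plug L F

  equiv-refl : (α : Act) (R : Res n α) → Equiv α R R
  equiv-refl τ       R = ≋-refl
  equiv-refl (rcv a) R = ≋-refl
  equiv-refl (snd a) R = λ F → ≋-refl

  equiv-sym : (α : Act) {R S : Res n α} → Equiv α R S → Equiv α S R
  equiv-sym τ       e = ≋-sym e
  equiv-sym (rcv a) e = ≋-sym e
  equiv-sym (snd a) e = λ F → ≋-sym (e F)

  equiv-trans : (α : Act) {R S Q : Res n α} → Equiv α R S → Equiv α S Q → Equiv α R Q
  equiv-trans τ       e f = ≋-trans e f
  equiv-trans (rcv a) e f = ≋-trans e f
  equiv-trans (snd a) e f = λ F → ≋-trans (e F) (f F)

  parR-cong : (α : Act) {R S : Res n α} {U V : Term n proc} →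
              Equiv α R S → U ≋ V → Equiv α (parR α R U) (parR α S V)
  parR-cong τ       e f = ∥-cong e f
  parR-cong (rcv a) e f = ∥-cong e (renV-≋ suc f)
  parR-cong (snd a) {K} {L} {U} {V} e f = λ F →
    ≋-trans (∼*⇒≋ (plug-parC K U F))
            (≋-trans (∥-cong (e F) f) (≋-sym (∼*⇒≋ (plug-parC L V F))))

  parR-identity : (α : Act) (R : Res n α) → Equiv α (parR α R 𝟎) R
  parR-identity τ       R = ∥-identity
  parR-identity (rcv a) R = ∥-identity
  parR-identity (snd a) K = λ F → ≋-trans (∼*⇒≋ (plug-parC K 𝟎 F)) ∥-identity

  parR-assoc : (α : Act) (R : Res n α) (U V : Term n proc) →
               Equiv α (parR α (parR α R U) V) (parR α R (U ∥ V))
  parR-assoc τ       R U V = ∥-assoc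
  parR-assoc (rcv a) R U V = ∥-assoc
  parR-assoc (snd a) (con k A T) U V = λ F → ν^-≋ k (∥-cong ≋-refl ∥-assoc)

  parR-right-comm : (α : Act) (R : Res n α) (U V : Term n proc) →
                    Equiv α (parR α (parR α R U) V) (parR α (parR α R V) U)
  parR-right-comm α R U V =
    equiv-trans α (parR-assoc α R U V)
      (equiv-trans α (parR-cong α (equiv-refl α R) ∥-comm) (equiv-sym α (parR-assoc α R V U)))

  νR-cong : (α : Act) {R S : Res n (renA suc α)} →
            Equiv (renA suc α) R S → Equiv α (νR α R) (νR α S)
  νR-cong τ       e = ν-cong e
  νR-cong (rcv a) e = ν-cong e
  νR-cong (snd a) {K} {L} e = λ F →
    ≋-trans (≡⇒≋ (plug-νC K F))
            (≋-trans (ν-cong (e (renN suc F))) (≡⇒≋ (sym (plug-νC L F))))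

  νR-parR : (α : Act) (R : Res n (renA suc α)) (U : Term n proc) →
            Equiv α (νR α (parR (renA suc α) R (renN suc U))) (parR α (νR α R) U)
  νR-parR τ       R U = ν-extrude
  νR-parR (rcv a) R U =
    ≋-trans (≡⇒≋ (cong (λ X → ν (R ∥ X)) (sym (renN-renV suc suc U)))) ν-extrude
  νR-parR (snd a) K@(con k _ _) U = λ F →
    ≡⇒≋ (cong (λ X → ν (ν^ k (_ ∥ (_ ∥ X)))) (renN-triangle (+-suc-≗ k) U))

  νR-parR-renR : (α : Act) (R : Res n α) (U : Term n proc) →
    Equiv α (νR α (parR (renA suc α) (renR suc α R) U)) (parR α R (ν U))
  νR-parR-renR τ       R U = ∼*⇒≋ (ν-extrudeˡ U R)
  νR-parR-renR (rcv a) R U = ∼*⇒≋ (ν-extrudeˡ (wk U) R)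
  νR-parR-renR (snd a) K U = λ F →
    ≋-trans (≡⇒≋ (plug-νC (parC (renC suc K) U) F))
      (≋-trans (ν-cong (≋-trans (∼*⇒≋ (plug-parC (renC suc K) U (renN suc F)))
                                (∥-cong (≡⇒≋ (sym (plug-renN suc K F))) ≋-refl)))
        (≋-trans (∼*⇒≋ (ν-extrudeˡ U (plug K F))) (≋-sym (∼*⇒≋ (plug-parC K (ν U) F)))))

  parR-renR : ∀ ρ (α : Act) (R : Res n α) (U : Term n proc) →
              parR (renA ρ α) (renR ρ α R) (renN ρ U) ≡ renR ρ α (parR α R U)
  parR-renR ρ τ       R U = refl
  parR-renR ρ (rcv a) R U = cong (_ ∥_) (sym (renN-renV ρ suc U))
  parR-renR ρ (snd a) (con k A T) U =
    cong (λ X → con k _ (_ ∥ X)) (sym (renN-square (lift^-shift k ρ) U))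

  parR-subR : (σ : Sub n m) (α : Act) (R : Res n α) (U : Term n proc) →
              parR α (subR σ α R) (sub σ U) ≡ subR σ α (parR α R U)
  parR-subR σ τ       R U = refl
  parR-subR σ (rcv a) R U = cong (_ ∥_) (sym (sub-exts-wk σ U))
  parR-subR σ (snd a) (con k A T) U = cong (λ X → con k _ (_ ∥ X)) (renN-sub (k +_) σ U)

  νC-renC : ∀ ρ (K : Con n) → νC (renC (lift ρ) K) ≡ renC ρ (νC K)
  νC-renC ρ (con k A T) =
    cong₂ (con (suc k)) (renN-cong (lift^-lift k ρ) A) (renN-cong (lift^-lift k ρ) T)

  νC-subC : (σ : Sub n m) (K : Con n) → νC (subC (renN suc ∘ σ) K) ≡ subC σ (νC K)
  νC-subC σ (con k A T) = cong₂ (con (suc k)) (sub-cong eq A) (sub-cong eq T)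
    where
    eq : renN (k +_) ∘ (renN suc ∘ σ) ≗ renN (suc k +_) ∘ σ
    eq x = renN-triangle (+-suc-≗ k) (σ x)

  ν-exts : (σ : Sub n m) (F : Term (suc n) s) →
           sub (exts (renN suc ∘ σ)) F ≡ sub (renN suc ∘ exts σ) F
  ν-exts σ F = sub-cong (λ x → sym (exts-renN suc σ x)) F

  renN-↦ : ∀ ρ {α} {R : Res n α} → T ↦⟨ i ∣ α ⟩ R →
           renN ρ T ↦⟨ i ∣ renA ρ α ⟩ renR ρ α R
  renN-↦ ρ inp = inp
  renN-↦ ρ out = out
  renN-↦ ρ (parl {U = U} {α = α} {R} d) = cast (parR-renR ρ α R U) (parl (renN-↦ ρ d))
  renN-↦ ρ (parr {T = T} {α = α} {R} d) = cast (parR-renR ρ α R T) (parr (renN-↦ ρ d))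
  renN-↦ ρ (coml {F = F} {K} d e) = cast (sym (plug-renN ρ K F)) (coml (renN-↦ ρ d) (renN-↦ ρ e))
  renN-↦ ρ (comr {F = F} {K} d e) = cast (sym (plug-renN ρ K F)) (comr (renN-↦ ρ d) (renN-↦ ρ e))
  renN-↦ ρ (res {α = τ} d)     = res (renN-↦ (lift ρ) d)
  renN-↦ ρ (res {α = rcv a} d) = res (renN-↦ (lift ρ) d)
  renN-↦ ρ (res {α = snd a} {K} d) = cast (νC-renC ρ K) (res (renN-↦ (lift ρ) d))
  renN-↦ ρ (β {T = T} {A} d)   = β (castT (renN-[] ρ T A) (renN-↦ ρ d))

  sub-↦ : (σ : Sub n m) {α : Act} {R : Res n α} → T ↦⟨ i ∣ α ⟩ R →
          sub σ T ↦⟨ i ∣ α ⟩ subR σ α R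
  sub-↦ σ inp = inp
  sub-↦ σ (out {a} {A} {T}) = cast
    (sym (cong₂ (con 0) (sub-cong (λ x → renN-id (λ _ → refl) (σ x)) A)
                        (sub-cong (λ x → renN-id (λ _ → refl) (σ x)) T))) out
  sub-↦ σ (parl {U = U} {α = α} {R} d) = cast (parR-subR σ α R U) (parl (sub-↦ σ d))
  sub-↦ σ (parr {T = T} {α = α} {R} d) = cast (parR-subR σ α R T) (parr (sub-↦ σ d))
  sub-↦ σ (coml {F = F} {K} d e) = cast (sym (plug-sub σ K F)) (coml (sub-↦ σ d) (sub-↦ σ e))
  sub-↦ σ (comr {F = F} {K} d e) = cast (sym (plug-sub σ K F)) (comr (sub-↦ σ d) (sub-↦ σ e))
  sub-↦ σ (res {α = τ} d)     = res (sub-↦ (renN suc ∘ σ) d)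
  sub-↦ σ (res {α = rcv a} {F} d) = cast (cong ν (ν-exts σ F)) (res (sub-↦ (renN suc ∘ σ) d))
  sub-↦ σ (res {α = snd a} {K} d) = cast (νC-subC σ K) (res (sub-↦ (renN suc ∘ σ) d))
  sub-↦ σ (β {T = T} {A} d)   = β (castT (sub-[] σ T A) (sub-↦ σ d))

  -- Reflection of transitions along injective renamings

  Inj : (ℕ → ℕ) → Set
  Inj = Injective _≡_ _≡_

  lift-injective : ∀ {ρ} → Inj ρ → Inj (lift ρ)
  lift-injective inj {zero}  {zero}  e = refl
  lift-injective inj {suc a} {suc c} e = cong suc (inj (suc-injective e))

  -- A residual paired with its action, so that residuals of actions that are
  -- only propositionally equal can be compared.
  Outcome : ℕ → Set
  Outcome n = Σ Act (Res n)

  Pre : (ℕ → ℕ) → Term n proc → ℕ → Outcome n → Set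
  Pre {n} ρ T i αR =
    ∃₂ λ α (R : Res n α) → T ↦⟨ i ∣ α ⟩ R × αR ≡ (renA ρ α , renR ρ α R)

  rcv-inv : ∀ {ρ a} {F : Term (suc n) proc} → Pre ρ T i (rcv a , F) →
            ∃₂ λ c F₀ → T ↦⟨ i ∣ rcv c ⟩ F₀ × a ≡ ρ c × F ≡ renN ρ F₀
  rcv-inv (rcv c , F , d , refl) = c , F , d , refl , refl

  snd-inv : ∀ {ρ a} {K : Con n} → Pre ρ T i (snd a , K) →
            ∃₂ λ c K₀ → T ↦⟨ i ∣ snd c ⟩ K₀ × a ≡ ρ c × K ≡ renC ρ K₀
  snd-inv (snd c , K , d , refl) = c , K , d , refl , refl

  -- Injectivity is what lets a communication be pulled back: otherwise `ρ` could identify the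
  -- channels of two prefixes. The recursion is on the transition, since in the β case `T [ A ]` is
  -- not a part of the term.
  renN-↦⁻ : ∀ {ρ} → Inj ρ → (T : Term n proc) {α : Act} {R : Res n α} →
    renN ρ T ≡ U → U ↦⟨ i ∣ α ⟩ R → Pre ρ T i (α , R)
  renN-↦⁻ inj (inp a T)   refl inp = rcv a , T , inp , refl
  renN-↦⁻ inj (out a A T) refl out = snd a , con 0 A T , out , refl
  renN-↦⁻ {ρ = ρ} inj (T ∥ U) refl (parl d) with renN-↦⁻ inj T refl d
  ... | α₀ , R₀ , d₀ , refl = α₀ , parR α₀ R₀ U , parl d₀ , cong (_ ,_) (parR-renR ρ α₀ R₀ U)
  renN-↦⁻ {ρ = ρ} inj (T ∥ U) refl (parr d) with renN-↦⁻ inj U refl d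
  ... | α₀ , R₀ , d₀ , refl = α₀ , parR α₀ R₀ T , parr d₀ , cong (_ ,_) (parR-renR ρ α₀ R₀ T)
  renN-↦⁻ {ρ = ρ} inj (T ∥ U) refl (coml d e)
    with rcv-inv (renN-↦⁻ inj T refl d) | snd-inv (renN-↦⁻ inj U refl e)
  ... | _ , F , d₀ , p , refl | _ , K , e₀ , q , refl with refl ← inj (trans (sym p) q) =
    τ , plug K F , coml d₀ e₀ , cong (τ ,_) (sym (plug-renN ρ K F))
  renN-↦⁻ {ρ = ρ} inj (T ∥ U) refl (comr d e)
    with snd-inv (renN-↦⁻ inj T refl d) | rcv-inv (renN-↦⁻ inj U refl e)
  ... | _ , K , d₀ , p , refl | _ , F , e₀ , q , refl with refl ← inj (trans (sym p) q) =
    τ , plug K F , comr d₀ e₀ , cong (τ ,_) (sym (plug-renN ρ K F))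
  renN-↦⁻ {ρ = ρ} inj (ν T) refl (res {α = α} {R} d) =
    under α R (renN-↦⁻ (lift-injective inj) T refl d)
    where
    under : ∀ α (R : Res _ (renA suc α)) → Pre (lift ρ) T _ (renA suc α , R) → Pre ρ (ν T) _ (α , νR α R)
    under τ       R (τ , R₀ , d₀ , refl) = τ , ν R₀ , res d₀ , refl
    under (rcv a) F (rcv zero    , F₀ , d₀ , ())
    under (rcv a) F (rcv (suc c) , F₀ , d₀ , refl) = rcv c , ν F₀ , res d₀ , refl
    under (snd a) K (snd zero    , K₀ , d₀ , ())
    under (snd a) K (snd (suc c) , K₀ , d₀ , refl) =
      snd c , νC K₀ , res d₀ , cong (snd (ρ c) ,_) (νC-renC ρ K₀)
  renN-↦⁻ {ρ = ρ} inj (ƛ T · A) refl (β d) with renN-↦⁻ inj (T [ A ]) (renN-[] ρ T A) d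
  ... | α₀ , R₀ , d₀ , refl = α₀ , R₀ , β d₀ , refl

  renN-suc-↦⁻ : ∀ (T : Term n proc) {α} {R : Res n (renA suc α)} →
    renN suc T ↦⟨ i ∣ renA suc α ⟩ R → ∃[ R₀ ] T ↦⟨ i ∣ α ⟩ R₀ × R ≡ renR suc α R₀
  renN-suc-↦⁻ T {α} {R} d = strip α R (renN-↦⁻ suc-injective T refl d)
    where
    strip : ∀ α (R : Res _ (renA suc α)) → Pre suc T _ (renA suc α , R) →
            ∃[ R₀ ] T ↦⟨ _ ∣ α ⟩ R₀ × R ≡ renR suc α R₀
    strip τ       _ (τ , R , d , refl)     = R , d , refl
    strip (rcv a) _ (rcv .a , R , d , refl) = R , d , refl
    strip (snd a) _ (snd .a , R , d , refl) = R , d , refl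

  -- Structural congruence and late transitions

  Match∼ : Bool → ℕ → (α : Act) → Res n α → Term n proc → Set
  Match∼ {n} b i α R U =
    ∃₂ λ j (S : Res n α) → (b ≡ false → j ≡ i) × U ↦⟨ j ∣ α ⟩ S × Equiv α R S

  extrudeˡ : ∀ α {R : Res n (renA suc α)} → U ∼[ b ] U′ →
    Match∼ b i (renA suc α) R T′ →
    Match∼ b i α (νR α (parR (renA suc α) R (renN suc U))) (ν T′ ∥ U′)
  extrudeˡ α f (j , S , c , d , q) = j , _ , c , parl (res d) ,
    equiv-trans α (νR-cong α (parR-cong (renA suc α) q (renN-≋ suc (∼⇒≋ f)))) (νR-parR α S _)

  extrudeʳ : ∀ α {R : Res n (renA suc α)} → T ∼[ b ] T′ →
    Match∼ b i (renA suc α) R (renN suc U′) →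
    Match∼ b i α (νR α (parR (renA suc α) R T)) (ν T′ ∥ U′)
  extrudeʳ {U′ = U′} α e (j , S , c , d , q) with renN-suc-↦⁻ U′ {α} d
  ... | S₀ , d₀ , refl = j , _ , c , parr d₀ ,
    equiv-trans α (νR-cong α (parR-cong (renA suc α) q (∼⇒≋ e))) (νR-parR-renR α S₀ _)

  renN-swap-suc² : (T : Term n s) → renN swap (renN suc (renN suc T)) ≡ renN suc (renN suc T)
  renN-swap-suc² T = trans (cong (renN swap) (renN-∘ suc suc T))
                           (trans (renN-∘ swap _ T) (sym (renN-∘ suc suc T)))

  exchange : ∀ α {R : Res n (renA suc (renA suc α))} →
    Match∼ b i (renA suc (renA suc α)) R T →
    Match∼ b i α (νR α (νR (renA suc α) R)) (ν (ν (renN swap T)))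
  exchange τ (j , S , c , d , q) =
    j , _ , c , res (res (renN-↦ swap d)) , ≋-trans (ν-cong (ν-cong q)) ν-swap
  exchange (rcv a) (j , S , c , d , q) =
    j , _ , c , res (res (renN-↦ swap d)) , ≋-trans (ν-cong (ν-cong q)) ν-swap
  exchange (snd a) {K} (j , L , c , d , q) =
    j , _ , c , res (res (renN-↦ swap d)) , λ F →
      ≋-trans (≡⇒≋ (νC² K F))
        (≋-trans (ν-cong (ν-cong (q (renN suc (renN suc F)))))
          (≋-trans ν-swap
            (≋-trans (≡⇒≋ (cong (λ X → ν (ν X)) (trans (plug-renN swap L (renN suc (renN suc F)))
                                               (cong (plug (renC swap L)) (renN-swap-suc² F)))))
                     (≡⇒≋ (sym (νC² (renC swap L) F))))))
    where
    νC² : (K : Con _) (F : Term _ proc) →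
          plug (νC (νC K)) F ≡ ν (ν (plug K (renN suc (renN suc F))))
    νC² K F = trans (plug-νC (νC K) F) (cong ν (plug-νC K (renN suc F)))

  -- By induction on the transition, then on the congruence step: a step of ∼
  -- along β shrinks the latter, a reduction of the redex itself the former.
  ∼-↦ : T ∼[ b ] U → ∀ {α} {R : Res n α} → T ↦⟨ i ∣ α ⟩ R → Match∼ b i α R U
  ∼-↦ (inp e) inp = 0 , _ , (λ _ → refl) , inp , ∼⇒≋ e
  ∼-↦ (out e f) out =
    0 , _ , (λ _ → refl) , out , λ F → ∥-cong ([]-≋ (≋-refl {T = renN (0 +_) F}) (∼⇒≋ e)) (∼⇒≋ f)
  ∼-↦ (e ∥ f) (parl {α = α} d) with ∼-↦ e d
  ... | j , S , c , d′ , q = j , _ , c , parl d′ , parR-cong α q (∼⇒≋ f)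
  ∼-↦ (e ∥ f) (parr {α = α} d) with ∼-↦ f d
  ... | j , S , c , d′ , q = j , _ , c , parr d′ , parR-cong α q (∼⇒≋ e)
  ∼-↦ (e ∥ f) (coml {K = K} d₁ d₂) with ∼-↦ e d₁ | ∼-↦ f d₂
  ... | i , F , c₁ , d₁′ , q₁ | j , L , c₂ , d₂′ , q₂ =
    _ , _ , (λ p → cong₂ _+_ (c₁ p) (c₂ p)) , coml d₁′ d₂′ , ≋-trans (plug-≋ K q₁) (q₂ F)
  ∼-↦ (e ∥ f) (comr {K = K} d₁ d₂) with ∼-↦ e d₁ | ∼-↦ f d₂
  ... | i , L , c₁ , d₁′ , q₁ | j , F , c₂ , d₂′ , q₂ =
    _ , _ , (λ p → cong₂ _+_ (c₂ p) (c₁ p)) , comr d₁′ d₂′ , ≋-trans (plug-≋ K q₂) (q₁ F)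
  ∼-↦ (ν e) (res {α = α} d) with ∼-↦ e d
  ... | j , S , c , d′ , q = j , _ , c , res d′ , νR-cong α q
  ∼-↦ (ƛ e · f) (β d) with ∼-↦ ([]-∼ e f) d
  ... | j , S , c , d′ , q = suc j , S , cong suc ∘ c , β d′ , q
  ∼-↦ (id→ e) (parl {α = α} {R} d) with ∼-↦ e d
  ... | j , S , c , d′ , q = j , S , c , d′ , equiv-trans α (parR-identity α R) q
  ∼-↦ (id← e) {α} d with ∼-↦ e d
  ... | j , S , c , d′ , q =
    j , _ , c , parl d′ , equiv-trans α q (equiv-sym α (parR-identity α S))
  ∼-↦ (as→ e f g) (parl (parl {α = α} {R} d)) with ∼-↦ e d
  ... | j , S , c , d′ , q = j , _ , c , parl d′ ,
    equiv-trans α (parR-assoc α R _ _) (parR-cong α q (∥-cong (∼⇒≋ f) (∼⇒≋ g)))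
  ∼-↦ (as→ e f g) (parl (parr {α = α} {R} d)) with ∼-↦ f d
  ... | j , S , c , d′ , q = j , _ , c , parr (parl d′) ,
    equiv-trans α (parR-right-comm α R _ _)
      (parR-cong α (parR-cong α q (∼⇒≋ g)) (∼⇒≋ e))
  ∼-↦ (as→ e f g) (parl (coml {F = F} {K} d₁ d₂)) with ∼-↦ e d₁ | ∼-↦ f d₂
  ... | i , F′ , c₁ , d₁′ , q₁ | j , L , c₂ , d₂′ , q₂ =
    _ , _ , (λ p → cong₂ _+_ (c₁ p) (c₂ p)) , coml d₁′ (parl d₂′) ,
    ≋-trans (∥-cong (≋-trans (plug-≋ K q₁) (q₂ F′)) (∼⇒≋ g)) (≋-sym (∼*⇒≋ (plug-parC L _ F′)))
  ∼-↦ (as→ e f g) (parl (comr {F = F} {K} d₁ d₂)) with ∼-↦ e d₁ | ∼-↦ f d₂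
  ... | i , L , c₁ , d₁′ , q₁ | j , F′ , c₂ , d₂′ , q₂ =
    _ , _ , (λ p → cong₂ _+_ (c₂ p) (c₁ p)) , comr d₁′ (parl d₂′) ,
    ≋-trans (∥-cong (≋-trans (plug-≋ K q₂) (q₁ F′)) (∼⇒≋ g)) (≋-sym (∼*⇒≋ (plug-wk L F′ _)))
  ∼-↦ (as→ e f g) (parr {α = α} {R} d) with ∼-↦ g d
  ... | j , S , c , d′ , q = j , _ , c , parr (parr d′) ,
    equiv-trans α (parR-cong α q (≋-trans (∥-cong (∼⇒≋ e) (∼⇒≋ f)) ∥-comm))
      (equiv-sym α (parR-assoc α S _ _))
  ∼-↦ (as→ e f g) (coml {K = K} (parl {R = F₀} d₁) d₂) with ∼-↦ e d₁ | ∼-↦ g d₂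
  ... | i , F , c₁ , d₁′ , q₁ | j , L , c₂ , d₂′ , q₂ =
    _ , _ , (λ p → cong₂ _+_ (c₁ p) (c₂ p)) , coml d₁′ (parr d₂′) ,
    ≋-trans (∼*⇒≋ (plug-wk K F₀ _))
      (≋-trans (∥-cong (≋-trans (plug-≋ K q₁) (q₂ F)) (∼⇒≋ f)) (≋-sym (∼*⇒≋ (plug-parC L _ F))))
  ∼-↦ (as→ e f g) (coml {K = K} (parr {R = F₀} d₁) d₂) with ∼-↦ f d₁ | ∼-↦ g d₂
  ... | i , F , c₁ , d₁′ , q₁ | j , L , c₂ , d₂′ , q₂ =
    _ , _ , (λ p → cong₂ _+_ (c₁ p) (c₂ p)) , parr (coml d₁′ d₂′) ,
    ≋-trans (∼*⇒≋ (plug-wk K F₀ _)) (∥-cong (≋-trans (plug-≋ K q₁) (q₂ F)) (∼⇒≋ e))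
  ∼-↦ (as→ e f g) (comr {F = F} (parl {R = K} d₁) d₂) with ∼-↦ e d₁ | ∼-↦ g d₂
  ... | i , L , c₁ , d₁′ , q₁ | j , G , c₂ , d₂′ , q₂ =
    _ , _ , (λ p → cong₂ _+_ (c₂ p) (c₁ p)) , comr d₁′ (parr d₂′) ,
    ≋-trans (∼*⇒≋ (plug-parC K _ F))
      (≋-trans (∥-cong (≋-trans (plug-≋ K q₂) (q₁ G)) (∼⇒≋ f)) (≋-sym (∼*⇒≋ (plug-wk L G _))))
  ∼-↦ (as→ e f g) (comr {F = F} (parr {R = K} d₁) d₂) with ∼-↦ f d₁ | ∼-↦ g d₂
  ... | i , L , c₁ , d₁′ , q₁ | j , G , c₂ , d₂′ , q₂ =
    _ , _ , (λ p → cong₂ _+_ (c₂ p) (c₁ p)) , parr (comr d₁′ d₂′) ,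
    ≋-trans (∼*⇒≋ (plug-parC K _ F)) (∥-cong (≋-trans (plug-≋ K q₂) (q₁ G)) (∼⇒≋ e))
  ∼-↦ (as← e f g) (parl {α = α} {R} d) with ∼-↦ e d
  ... | j , S , c , d′ , q = j , _ , c , parl (parl d′) ,
    equiv-trans α (parR-cong α q (∥-cong (∼⇒≋ f) (∼⇒≋ g))) (equiv-sym α (parR-assoc α S _ _))
  ∼-↦ (as← e f g) (parr (parl {α = α} {R} d)) with ∼-↦ f d
  ... | j , S , c , d′ , q = j , _ , c , parl (parr d′) ,
    equiv-trans α (parR-right-comm α R _ _) (parR-cong α (parR-cong α q (∼⇒≋ e)) (∼⇒≋ g))
  ∼-↦ (as← e f g) (parr (parr {α = α} {R} d)) with ∼-↦ g d
  ... | j , S , c , d′ , q = j , _ , c , parr d′ ,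
    equiv-trans α (parR-assoc α R _ _)
      (parR-cong α q (≋-trans ∥-comm (∥-cong (∼⇒≋ e) (∼⇒≋ f))))
  ∼-↦ (as← e f g) (parr (coml {F = F} {K} d₁ d₂)) with ∼-↦ f d₁ | ∼-↦ g d₂
  ... | i , G , c₁ , d₁′ , q₁ | j , L , c₂ , d₂′ , q₂ =
    _ , _ , (λ p → cong₂ _+_ (c₁ p) (c₂ p)) , coml (parr d₁′) d₂′ ,
    ≋-trans (∥-cong (≋-trans (plug-≋ K q₁) (q₂ G)) (∼⇒≋ e)) (≋-sym (∼*⇒≋ (plug-wk L G _)))
  ∼-↦ (as← e f g) (parr (comr {F = F} {K} d₁ d₂)) with ∼-↦ f d₁ | ∼-↦ g d₂
  ... | i , L , c₁ , d₁′ , q₁ | j , G , c₂ , d₂′ , q₂ =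
    _ , _ , (λ p → cong₂ _+_ (c₂ p) (c₁ p)) , comr (parr d₁′) d₂′ ,
    ≋-trans (∥-cong (≋-trans (plug-≋ K q₂) (q₁ G)) (∼⇒≋ e)) (≋-sym (∼*⇒≋ (plug-parC L _ G)))
  ∼-↦ (as← e f g) (coml {F = F} d₁ (parl {R = K} d₂)) with ∼-↦ e d₁ | ∼-↦ f d₂
  ... | i , G , c₁ , d₁′ , q₁ | j , L , c₂ , d₂′ , q₂ =
    _ , _ , (λ p → cong₂ _+_ (c₁ p) (c₂ p)) , parl (coml d₁′ d₂′) ,
    ≋-trans (∼*⇒≋ (plug-parC K _ F)) (∥-cong (≋-trans (plug-≋ K q₁) (q₂ G)) (∼⇒≋ g))
  ∼-↦ (as← e f g) (coml {F = F} d₁ (parr {R = K} d₂)) with ∼-↦ e d₁ | ∼-↦ g d₂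
  ... | i , G , c₁ , d₁′ , q₁ | j , L , c₂ , d₂′ , q₂ =
    _ , _ , (λ p → cong₂ _+_ (c₁ p) (c₂ p)) , coml (parl d₁′) d₂′ ,
    ≋-trans (∼*⇒≋ (plug-parC K _ F))
      (≋-trans (∥-cong (≋-trans (plug-≋ K q₁) (q₂ G)) (∼⇒≋ f)) (≋-sym (∼*⇒≋ (plug-wk L G _))))
  ∼-↦ (as← e f g) (comr {K = K} d₁ (parl {R = F₀} d₂)) with ∼-↦ e d₁ | ∼-↦ f d₂
  ... | i , L , c₁ , d₁′ , q₁ | j , G , c₂ , d₂′ , q₂ =
    _ , _ , (λ p → cong₂ _+_ (c₂ p) (c₁ p)) , parl (comr d₁′ d₂′) ,
    ≋-trans (∼*⇒≋ (plug-wk K F₀ _)) (∥-cong (≋-trans (plug-≋ K q₂) (q₁ G)) (∼⇒≋ g))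
  ∼-↦ (as← e f g) (comr {K = K} d₁ (parr {R = F₀} d₂)) with ∼-↦ e d₁ | ∼-↦ g d₂
  ... | i , L , c₁ , d₁′ , q₁ | j , G , c₂ , d₂′ , q₂ =
    _ , _ , (λ p → cong₂ _+_ (c₂ p) (c₁ p)) , comr (parl d₁′) d₂′ ,
    ≋-trans (∼*⇒≋ (plug-wk K F₀ _))
      (≋-trans (∥-cong (≋-trans (plug-≋ K q₂) (q₁ G)) (∼⇒≋ f)) (≋-sym (∼*⇒≋ (plug-parC L _ G))))
  ∼-↦ (com e f) (parl {α = α} d) with ∼-↦ e d
  ... | j , S , c , d′ , q = j , _ , c , parr d′ , parR-cong α q (∼⇒≋ f)
  ∼-↦ (com e f) (parr {α = α} d) with ∼-↦ f d
  ... | j , S , c , d′ , q = j , _ , c , parl d′ , parR-cong α q (∼⇒≋ e)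
  ∼-↦ (com e f) (coml {K = K} d₁ d₂) with ∼-↦ e d₁ | ∼-↦ f d₂
  ... | i , F , c₁ , d₁′ , q₁ | j , L , c₂ , d₂′ , q₂ =
    _ , _ , (λ p → cong₂ _+_ (c₁ p) (c₂ p)) , comr d₂′ d₁′ , ≋-trans (plug-≋ K q₁) (q₂ F)
  ∼-↦ (com e f) (comr {K = K} d₁ d₂) with ∼-↦ e d₁ | ∼-↦ f d₂
  ... | i , L , c₁ , d₁′ , q₁ | j , F , c₂ , d₂′ , q₂ =
    _ , _ , (λ p → cong₂ _+_ (c₂ p) (c₁ p)) , coml d₂′ d₁′ , ≋-trans (plug-≋ K q₂) (q₁ F)
  ∼-↦ (swp e refl) (res {α = α} (res d)) = exchange α (∼-↦ e d)
  ∼-↦ in→ (res {α = τ} ())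
  ∼-↦ in→ (res {α = rcv a} ())
  ∼-↦ in→ (res {α = snd a} ())
  ∼-↦ ou→ (res {α = τ} ())
  ∼-↦ ou→ (res {α = rcv a} ())
  ∼-↦ ou→ (res {α = snd a} ())
  ∼-↦ (ex→ e f refl) (res {α = τ}     (parl d)) = extrudeˡ τ f (∼-↦ e d)
  ∼-↦ (ex→ e f refl) (res {α = rcv a} (parl d)) = extrudeˡ (rcv a) f (∼-↦ e d)
  ∼-↦ (ex→ e f refl) (res {α = snd a} (parl d)) = extrudeˡ (snd a) f (∼-↦ e d)
  ∼-↦ (ex→ e f refl) (res {α = τ}     (parr d)) = extrudeʳ τ e (∼-↦ (renN-∼ suc f) d)
  ∼-↦ (ex→ e f refl) (res {α = rcv a} (parr d)) = extrudeʳ (rcv a) e (∼-↦ (renN-∼ suc f) d)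
  ∼-↦ (ex→ e f refl) (res {α = snd a} (parr d)) = extrudeʳ (snd a) e (∼-↦ (renN-∼ suc f) d)
  ∼-↦ (ex→ {U′ = U′} e f refl) (res {α = τ} (coml {K = K} d₁ d₂))
    with ∼-↦ e d₁ | ∼-↦ (renN-∼ suc f) d₂
  ... | i , F , c₁ , d₁′ , q₁ | j , L , c₂ , d₂′ , q₂
    with snd-inv (renN-↦⁻ suc-injective U′ refl d₂′)
  ... | a , L₀ , d₀ , refl , refl =
    _ , _ , (λ p → cong₂ _+_ (c₁ p) (c₂ p)) , coml (res d₁′) d₀ ,
    ≋-trans (ν-cong (≋-trans (plug-≋ K q₁) (q₂ F))) (≋-sym (∼*⇒≋ (plug-ν L₀ F)))
  ∼-↦ (ex→ {U′ = U′} e f refl) (res {α = τ} (comr {K = K} d₁ d₂))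
    with ∼-↦ e d₁ | ∼-↦ (renN-∼ suc f) d₂
  ... | i , L , c₁ , d₁′ , q₁ | j , F , c₂ , d₂′ , q₂
    with rcv-inv (renN-↦⁻ suc-injective U′ refl d₂′)
  ... | a , F₀ , d₀ , refl , refl =
    _ , _ , (λ p → cong₂ _+_ (c₂ p) (c₁ p)) , comr (res d₁′) d₀ ,
    ≋-trans (ν-cong (≋-trans (plug-≋ K q₂) (q₁ F))) (≡⇒≋ (sym (plug-νC L F₀)))
  ∼-↦ (ex← e f refl) (parl (res {α = α} d)) with ∼-↦ e d
  ... | j , S , c , d′ , q = j , _ , c , res (parl d′) ,
    equiv-trans α (parR-cong α (νR-cong α q) (∼⇒≋ f)) (equiv-sym α (νR-parR α S _))
  ∼-↦ (ex← e f refl) (parr {α = α} d) with ∼-↦ f d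
  ... | j , S , c , d′ , q = j , _ , c , res (parr (renN-↦ suc d′)) ,
    equiv-trans α (parR-cong α q (ν-cong (∼⇒≋ e))) (equiv-sym α (νR-parR-renR α S _))
  ∼-↦ (ex← e f refl) (coml {K = K} (res d₁) d₂) with ∼-↦ e d₁ | ∼-↦ f d₂
  ... | i , F , c₁ , d₁′ , q₁ | j , L , c₂ , d₂′ , q₂ =
    _ , _ , (λ p → cong₂ _+_ (c₁ p) (c₂ p)) , res (coml d₁′ (renN-↦ suc d₂′)) ,
    ≋-trans (plug-≋ K (ν-cong q₁)) (≋-trans (q₂ (ν F)) (∼*⇒≋ (plug-ν L F)))
  ∼-↦ (ex← e f refl) (comr {F = F} (res {R = K} d₁) d₂) with ∼-↦ e d₁ | ∼-↦ f d₂
  ... | i , L , c₁ , d₁′ , q₁ | j , G , c₂ , d₂′ , q₂ =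
    _ , _ , (λ p → cong₂ _+_ (c₂ p) (c₁ p)) , res (comr d₁′ (renN-↦ suc d₂′)) ,
    ≋-trans (plug-≋ (νC K) q₂) (≋-trans (≡⇒≋ (plug-νC K G)) (ν-cong (q₁ (renN suc G))))
  ∼-↦ (β→ refl e) (β d) with ∼-↦ e d
  ... | j , S , c , d′ , q = j , S , (λ ()) , d′ , q
  ∼-↦ (β← refl e) d with ∼-↦ e d
  ... | j , S , c , d′ , q = suc j , S , (λ ()) , β d′ , q

-- Correspondence with the transitions of the calculus

module _ where

  private variable
    n m i j : ℕ
    s   : Kind
    b   : Bool
    T T′ U U′ V V′ : Term n s
    P P′ Q Q′ : Proc

  ∼*-↦ : ∼* b T U → ∀ {α} {R : Res n α} → T ↦⟨ i ∣ α ⟩ R → Match∼ b i α R U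
  ∼*-↦ ε {α} d = _ , _ , (λ _ → refl) , d , equiv-refl α _
  ∼*-↦ (e ◅ es) {α} d with ∼-↦ e d
  ... | j , S , c , d′ , q with ∼*-↦ es d′
  ... | j′ , S′ , c′ , d″ , q′ =
    j′ , S′ , (λ p → trans (c′ p) (c p)) , d″ , equiv-trans α q q′

  ≋-↦ : T ≋ U → ∀ {α} {R : Res n α} → T ↦⟨ i ∣ α ⟩ R →
        ∃₂ λ j S → U ↦⟨ j ∣ α ⟩ S × Equiv α R S
  ≋-↦ e d with ∼*-↦ (≋⇒∼* e) d
  ... | j , S , _ , d′ , q = j , S , d′ , q

  ≡ₛ-↦ : T ≡ₛ U → ∀ {α} {R : Res n α} → T ↦⟨ i ∣ α ⟩ R →
         ∃[ S ] U ↦⟨ i ∣ α ⟩ S × Equiv α R S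
  ≡ₛ-↦ e d with ∼*-↦ e d
  ... | j , S , c , d′ , q with refl ← c refl = S , d′ , q

  infix 4 _⟶_ _⟹_

  -- A congruence counts as a step, so weak transitions compose without being renormalised; `⟹⇒⇒`
  -- turns them into genuine ones up to a final congruence.
  data _⟶_ : Proc → Proc → Set where
    str : P ≋ Q → P ⟶ Q
    tau : P ↦⟨ i ∣ τ ⟩ Q → P ⟶ Q

  _⟹_ : Proc → Proc → Set
  _⟹_ = Star _⟶_

  ≋⇒⟹ : P ≋ Q → P ⟹ Q
  ≋⇒⟹ e = str e ◅ ε

  tau⇒⟹ : P ↦⟨ i ∣ τ ⟩ Q → P ⟹ Q
  tau⇒⟹ d = tau d ◅ ε

  ∥-⟹ : ∀ U → P ⟹ Q → P ∥ U ⟹ Q ∥ U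
  ∥-⟹ U = gmap (_∥ U) λ { (str e) → str (∥-cong e ≋-refl) ; (tau d) → tau (parl d) }

  ∥-⟹ʳ : ∀ U → P ⟹ Q → U ∥ P ⟹ U ∥ Q
  ∥-⟹ʳ U w = ≋⇒⟹ ∥-comm ◅◅ ∥-⟹ U w ◅◅ ≋⇒⟹ ∥-comm

  ν-⟹ : P ⟹ Q → ν P ⟹ ν Q
  ν-⟹ = gmap ν λ { (str e) → str (ν-cong e) ; (tau d) → tau (res d) }

  ν^-⟹ : ∀ k → P ⟹ Q → ν^ k P ⟹ ν^ k Q
  ν^-⟹ zero    w = w
  ν^-⟹ (suc k) w = ν-⟹ (ν^-⟹ k w)

  renN-⟹ : ∀ ρ → P ⟹ Q → renN ρ P ⟹ renN ρ Q
  renN-⟹ ρ = gmap (renN ρ) λ { (str e) → str (renN-≋ ρ e) ; (tau d) → tau (renN-↦ ρ d) }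

  renN-0+ : (T : Term n s) → renN (0 +_) T ≡ T
  renN-0+ = renN-id (λ _ → refl)

  recv-sound : ∀ {a F} → P ↦⟨ i ∣ rcv a ⟩ F → ∀ A → P —[ recv a A ]→ F [ A ]
  recv-sound inp A = recv A
  recv-sound (parl {U = U} d) A = str ≋-refl (parˡ (recv-sound d A))
    (∥-cong ≋-refl (≡⇒≋ (trans (renN-0+ U) (sym (wk-[] U A)))))
  recv-sound (parr {T = T} d) A = str ≋-refl (parʳ (recv-sound d A))
    (≋-trans (∥-cong (≡⇒≋ (trans (renN-0+ T) (sym (wk-[] T A)))) ≋-refl) ∥-comm)
  recv-sound (res {R = F} d) A = str ≋-refl (res (recv-sound d (renN suc A)))
    (≡⇒≋ (trans (cong ν (renN-0+ _)) (sym (ν-[] F A))))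
  recv-sound (β d) A = str β (recv-sound d A) ≋-refl

  _∈fn?_ : ∀ a (T : Term n s) → Dec (a ∈fn T)
  a ∈fn? var x     = no λ ()
  a ∈fn? ƛ T       = a ∈fn? T
  a ∈fn? 𝟎         = no λ ()
  a ∈fn? inp b T   = (a ≟ b) ⊎-dec (a ∈fn? T)
  a ∈fn? out b A T = (a ≟ b) ⊎-dec (a ∈fn? A) ⊎-dec (a ∈fn? T)
  a ∈fn? (T ∥ U)   = (a ∈fn? T) ⊎-dec (a ∈fn? U)
  a ∈fn? ν T       = suc a ∈fn? T
  a ∈fn? (A · B)   = (a ∈fn? A) ⊎-dec (a ∈fn? B)

  lift^-suc-pred : ∀ k a → k ≢ a → lift^ k suc (lift^ k pred a) ≡ a
  lift^-suc-pred zero    zero    k≢a = ⊥-elim (k≢a refl)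
  lift^-suc-pred zero    (suc a) k≢a = refl
  lift^-suc-pred (suc k) zero    k≢a = refl
  lift^-suc-pred (suc k) (suc a) k≢a = cong suc (lift^-suc-pred k a (k≢a ∘ cong suc))

  -- A term without the name `k` lies in the image of `lift^ k suc`, with `lift^ k pred` as the
  -- inverse. The rule `res` accepts an output label only if its object has this form.
  strengthen : ∀ k (T : Term n s) → k ∉fn T → renN (lift^ k suc) (renN (lift^ k pred) T) ≡ T
  strengthen k (var x)     f = refl
  strengthen k (ƛ T)       f = cong ƛ (strengthen k T f)
  strengthen k 𝟎           f = refl
  strengthen k (inp a T)   f = cong₂ inp (lift^-suc-pred k a (f ∘ inj₁)) (strengthen k T (f ∘ inj₂))
  strengthen k (out a A T) f rewrite lift^-suc-pred k a (f ∘ inj₁) =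
    cong₂ (out a) (strengthen k A (f ∘ inj₂ ∘ inj₁)) (strengthen k T (f ∘ inj₂ ∘ inj₂))
  strengthen k (T ∥ U)     f = cong₂ _∥_ (strengthen k T (f ∘ inj₁)) (strengthen k U (f ∘ inj₂))
  strengthen k (ν T)       f = cong ν (strengthen (suc k) T f)
  strengthen k (A · B)     f = cong₂ _·_ (strengthen k A (f ∘ inj₁)) (strengthen k B (f ∘ inj₂))

  rot-shift-suc : ∀ k (U : Term n s) →
    renN (rot k) (renN (k +_) (renN suc U)) ≡ renN suc (renN (k +_) U)
  rot-shift-suc k U = trans (renN-triangle (rot-shift k) _) (renN-square (λ _ → refl) U)

  rot-[] : ∀ k (E : Term (suc n) proc) (A : Term n abs) →
    renN (rot k) (renN (k +_) (renN suc E) [ renN (lift^ k suc) A ]) ≡ renN suc (renN (k +_) E [ A ])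
  rot-[] k E A = trans (renN-[] (rot k) (renN (k +_) (renN suc E)) _)
    (trans (cong₂ _[_] (rot-shift-suc k E) (renN-triangle (rot-lift^ k) A))
           (sym (renN-[] suc (renN (k +_) E) A)))

  -- The transition rules extrude only the names that occur in the transmitted
  -- object; H restores the other ones around the continuation.
  record Send (P : Proc) (a : ℕ) (K : Con 0) : Set where
    open Con K
    field
      k      : ℕ
      B      : Abs
      H      : Proc → Proc
      H-⟹   : ∀ {X Y} → X ⟹ Y → H X ⟹ H Y
      H-∥    : ∀ X U → H (X ∥ renN (size +_) U) ≋ H X ∥ renN (k +_) U
      H-plug : ∀ X E → ν^ k (renN (k +_) E [ B ] ∥ H X) ≋ plug (con size obj X) E
      step   : P —[ send k a B ]→ H cont

  send-sound : ∀ {a K} → P ↦⟨ i ∣ snd a ⟩ K → Send P a K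
  send-sound (out {A = A}) = record
    { k = 0 ; B = A ; H = id ; H-⟹ = id
    ; H-∥ = λ _ _ → ≋-refl ; H-plug = λ _ _ → ≋-refl ; step = send }
  send-sound (parl {U = U} d) = record
    { k = k ; B = B ; H = H ; H-⟹ = H-⟹ ; H-∥ = H-∥ ; H-plug = H-plug
    ; step = str ≋-refl (parˡ step) (≋-sym (H-∥ _ U)) }
    where open Send (send-sound d)
  send-sound (parr {T = T} d) = record
    { k = k ; B = B ; H = H ; H-⟹ = H-⟹ ; H-∥ = H-∥ ; H-plug = H-plug
    ; step = str ≋-refl (parʳ step) (≋-trans ∥-comm (≋-sym (H-∥ _ T))) }
    where open Send (send-sound d)
  send-sound (β d) = record
    { k = k ; B = B ; H = H ; H-⟹ = H-⟹ ; H-∥ = H-∥ ; H-plug = H-plug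
    ; step = str β step ≋-refl }
    where open Send (send-sound d)
  send-sound (res {α = snd a} {R = con l A T} d) = under (k ∈fn? B)
    where
    open Send (send-sound d)
    under : Dec (k ∈fn B) → Send (ν _) a (con (suc l) A T)
    under (yes k∈B) = record
      { k = suc k ; B = B ; H = H ; H-⟹ = H-⟹
      ; H-∥ = λ X U → subst₂ (λ U₁ U₂ → H (X ∥ U₁) ≋ H X ∥ U₂)
          (renN-triangle (+-suc-≗ l) U) (renN-triangle (+-suc-≗ k) U) (H-∥ X (renN suc U))
      ; H-plug = λ X E → ≋-trans
          (≡⇒≋ (cong (λ F → ν (ν^ k (F [ B ] ∥ H X))) (sym (renN-triangle (+-suc-≗ k) E))))
          (≋-trans (ν-cong (H-plug X (renN suc E))) (≡⇒≋ (sym (plug-νC (con l A X) E))))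
      ; step = open′ step k∈B }
    under (no k∉B) = record
      { k = k ; B = B′ ; H = λ X → ν (renN (rot k) (H X))
      ; H-⟹ = ν-⟹ ∘ renN-⟹ (rot k) ∘ H-⟹
      ; H-∥ = λ X U → ≋-trans
          (ν-cong (renN-≋ (rot k) (subst (λ U₁ → H (X ∥ U₁) ≋ H X ∥ renN (k +_) (renN suc U))
                                         (renN-triangle (+-suc-≗ l) U) (H-∥ X (renN suc U)))))
          (≋-trans (≡⇒≋ (cong (λ Y → ν (_ ∥ Y)) (rot-shift-suc k U))) ν-extrude)
      ; H-plug = λ X E → ≋-trans (≋-sym (∼*⇒≋ (ν^-extrudeʳ X E)))
          (≋-trans (ν-cong (H-plug X (renN suc E))) (≡⇒≋ (sym (plug-νC (con l A X) E))))
      ; step = res (subst (λ C → _ —[ send k (suc a) C ]→ H T) (sym (strengthen k B k∉B)) step) }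
      where
      B′ = renN (lift^ k pred) B
      ν^-extrudeʳ : ∀ X E → ν (ν^ k (renN (k +_) (renN suc E) [ B ] ∥ H X)) ≡ₛ
                            ν^ k (renN (k +_) E [ B′ ] ∥ ν (renN (rot k) (H X)))
      ν^-extrudeʳ X E = ν-ν^ k _ ◅◅ ν^-≡ₛ k
        (≡⇒≡ₛ (cong (λ Y → ν (Y ∥ renN (rot k) (H X)))
          (trans (cong (λ C → renN (rot k) (renN (k +_) (renN suc E) [ C ]))
                       (sym (strengthen k B k∉B)))
                 (rot-[] k E B′))) ◅◅
         ν-extrudeˡ _ _)

  τ-sound : P ↦⟨ i ∣ τ ⟩ Q → P —[ τ ]→ Q
  τ-sound (parl {U = U} d) = str ≋-refl (parˡ (τ-sound d)) (∥-cong ≋-refl (≡⇒≋ (renN-0+ U)))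
  τ-sound (parr {T = T} d) =
    str ≋-refl (parʳ (τ-sound d)) (≋-trans (∥-cong (≡⇒≋ (renN-0+ T)) ≋-refl) ∥-comm)
  τ-sound (coml {F = F} {con l A T} d e) =
    str ≋-refl (comˡ (recv-sound (renN-↦ (k +_) d) B) step) (H-plug T F)
    where open Send (send-sound e)
  τ-sound (comr {F = F} {con l A T} d e) =
    str ≋-refl (comʳ step (recv-sound (renN-↦ (k +_) e) B)) (≋-trans (ν^-≋ k ∥-comm) (H-plug T F))
    where open Send (send-sound d)
  τ-sound (res {α = τ} d) = str ≋-refl (res (τ-sound d)) (ν-cong (≡⇒≋ (renN-0+ _)))
  τ-sound (β d) = str β (τ-sound d) ≋-refl

  -- An output is compared through contexts, since the concretion extrudes every restriction above
  -- the prefix while the label extrudes only those whose names occur in the object.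
  Complete : Label → Proc → Proc → Set
  Complete τ            P P′ = ∃₂ λ i Q → P ↦⟨ i ∣ τ ⟩ Q × Q ≋ P′
  Complete (recv a A)   P P′ = ∃₂ λ i F → P ↦⟨ i ∣ rcv a ⟩ F × F [ A ] ≋ P′
  Complete (send k a A) P P′ =
    ∃₂ λ i K → P ↦⟨ i ∣ snd a ⟩ K × (∀ E → plug K E ≋ ν^ k (renN (k +_) E [ A ] ∥ P′))

  -- Induction on the transition. The congruence rule is eliminated in the `str` cases, by `≋-↦`; a
  -- communication uses that the shift by `k` is injective to pull the receiver's transition back.
  complete : ∀ {l} → P —[ l ]→ P′ → Complete l P P′
  complete (recv A) = _ , _ , inp , ≋-refl
  complete send     = _ , _ , out , λ E → ≋-refl
  complete (res {λ′ = τ} d) with complete d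
  ... | i , Q , d₀ , e = i , _ , res d₀ , ν-cong (≋-trans e (≡⇒≋ (sym (renN-0+ _))))
  complete (res {λ′ = recv a A} d) with complete d
  ... | i , F , d₀ , e = i , _ , res d₀ ,
    ≋-trans (≡⇒≋ (ν-[] F A)) (ν-cong (≋-trans e (≡⇒≋ (sym (renN-0+ _)))))
  complete (res {λ′ = send k a A} {T′ = T′} d) with complete d
  ... | i , K , d₀ , e = i , _ , res d₀ , λ E →
    ≋-trans (≡⇒≋ (plug-νC K E)) (≋-trans (ν-cong (e (renN suc E))) (∼*⇒≋
      (ν-ν^ k _ ◅◅ ν^-≡ₛ k (≡⇒≡ₛ (cong (λ X → ν (X ∥ renN (rot k) T′)) (rot-[] k E A)) ◅◅
        ν-extrudeˡ _ _))))
  complete (open′ {k} {A = A} {T′ = T′} d _) with complete d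
  ... | i , K , d₀ , e = i , _ , res d₀ , λ E →
    ≋-trans (≡⇒≋ (plug-νC K E)) (≋-trans (ν-cong (e (renN suc E)))
      (≡⇒≋ (cong (λ X → ν (ν^ k (X [ A ] ∥ T′))) (renN-triangle (+-suc-≗ k) E))))
  complete (parˡ {λ′ = τ} d) with complete d
  ... | i , Q , d₀ , e = i , _ , parl d₀ , ∥-cong e (≡⇒≋ (sym (renN-0+ _)))
  complete (parˡ {λ′ = recv a A} d) with complete d
  ... | i , F , d₀ , e = i , _ , parl d₀ ,
    ∥-cong e (≡⇒≋ (trans (wk-[] _ A) (sym (renN-0+ _))))
  complete (parˡ {λ′ = send k a A} {U = U} d) with complete d
  ... | i , K , d₀ , e = i , _ , parl d₀ , λ E →
    ≋-trans (∼*⇒≋ (plug-parC K U E)) (≋-trans (∥-cong (e E) ≋-refl)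
      (∼*⇒≋ (reverse* (ν^-≡ₛ k (reverse* (∥-assoc-≡ₛ _ _ _)) ◅◅ ν^-extrude k _ U))))
  complete (parʳ {λ′ = τ} d) with complete d
  ... | i , Q , d₀ , e = i , _ , parr d₀ , ≋-trans ∥-comm (∥-cong (≡⇒≋ (sym (renN-0+ _))) e)
  complete (parʳ {λ′ = recv a A} d) with complete d
  ... | i , F , d₀ , e = i , _ , parr d₀ ,
    ≋-trans ∥-comm (∥-cong (≡⇒≋ (trans (wk-[] _ A) (sym (renN-0+ _)))) e)
  complete (parʳ {λ′ = send k a A} {U = U} d) with complete d
  ... | i , K , d₀ , e = i , _ , parr d₀ , λ E →
    ≋-trans (∼*⇒≋ (plug-parC K U E)) (≋-trans (∥-cong (e E) ≋-refl)
      (∼*⇒≋ (reverse* (ν^-≡ₛ k (∥-cong* ε (∥-comm-≡ₛ _ _) ◅◅ reverse* (∥-assoc-≡ₛ _ _ _)) ◅◅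
                       ν^-extrude k _ U))))
  complete (comˡ {k = k} {T = T} d e) with complete d | complete e
  ... | i , F , d₀ , p | j , K , e₀ , q with rcv-inv (renN-↦⁻ (+-cancelˡ-≡ k _ _) T refl d₀)
  ... | a , F₀ , d₁ , r , refl with refl ← +-cancelˡ-≡ k _ _ r =
    _ , _ , coml d₁ e₀ , ≋-trans (q F₀) (ν^-≋ k (∥-cong p ≋-refl))
  complete (comʳ {k = k} {T = T} e d) with complete d | complete e
  ... | i , F , d₀ , p | j , K , e₀ , q with rcv-inv (renN-↦⁻ (+-cancelˡ-≡ k _ _) T refl d₀)
  ... | a , F₀ , d₁ , r , refl with refl ← +-cancelˡ-≡ k _ _ r =
    _ , _ , comr e₀ d₁ , ≋-trans (q F₀) (ν^-≋ k (≋-trans ∥-comm (∥-cong ≋-refl p)))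
  complete (str {λ′ = τ} e d f) with complete d
  ... | i , Q , d₀ , p with ≋-↦ (≋-sym e) d₀
  ... | j , Q′ , d₁ , q = j , Q′ , d₁ , ≋-trans (≋-sym q) (≋-trans p f)
  complete (str {λ′ = recv a A} e d f) with complete d
  ... | i , F , d₀ , p with ≋-↦ (≋-sym e) d₀
  ... | j , G , d₁ , q = j , G , d₁ , ≋-trans ([]-≋ (≋-sym q) ≋-refl) (≋-trans p f)
  complete (str {λ′ = send k a A} e d f) with complete d
  ... | i , K , d₀ , p with ≋-↦ (≋-sym e) d₀
  ... | j , L , d₁ , q = j , L , d₁ , λ E →
    ≋-trans (≋-sym (q E)) (≋-trans (p E) (ν^-≋ k (∥-cong ≋-refl f)))

  ≋-⇒ : P ≋ P′ → P′ ⇒ Q → ∃[ Q₀ ] P ⇒ Q₀ × Q₀ ≋ Q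
  ≋-⇒ e ε        = _ , ε , e
  ≋-⇒ e (d ◅ ds) = _ , str e d ≋-refl ◅ ds , ≋-refl

  ⟹⇒⇒ : P ⟹ Q → ∃[ Q₀ ] P ⇒ Q₀ × Q₀ ≋ Q
  ⟹⇒⇒ ε = _ , ε , ≋-refl
  ⟹⇒⇒ (str e ◅ w) with ⟹⇒⇒ w
  ... | _ , ds , f with ≋-⇒ e ds
  ... | _ , ds′ , f′ = _ , ds′ , ≋-trans f′ f
  ⟹⇒⇒ (tau d ◅ w) with ⟹⇒⇒ w
  ... | _ , ds , f = _ , τ-sound d ◅ ds , f

  ⇒⇒⟹ : P ⇒ Q → P ⟹ Q
  ⇒⇒⟹ ε = ε
  ⇒⇒⟹ (d ◅ ds) with complete d
  ... | _ , _ , d₀ , e = tau d₀ ◅ str e ◅ ⇒⇒⟹ ds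

-- Servers; context bisimilarity implies normal bisimilarity

module _ where

  private variable
    n m i : ℕ
    s   : Kind
    P P′ Q Q′ : Proc

  copier-sub : ∀ a (σ : Sub n m) (T : Term (suc n) proc) →
               sub (renN suc ∘ σ) (copier a T) ≡ copier a (sub (exts σ) T)
  copier-sub a σ T = cong (λ X → inp 0 (inp (suc a) (force (var (suc zero)) ∥ X) ∥ out 0 (var zero) 𝟎))
    (begin
      sub (exts (exts (renN suc ∘ σ))) (renV (ext suc) (renN suc T))
        ≡⟨ sub-renV _ (ext suc) (renN suc T) ⟩
      sub (exts (exts (renN suc ∘ σ)) ∘ ext suc) (renN suc T)
        ≡⟨ sub-cong (λ x → trans (exts-ext (exts (renN suc ∘ σ)) suc x) (sym (exts-renV suc _ x))) (renN suc T) ⟩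
      sub (renV (ext suc) ∘ exts (renN suc ∘ σ)) (renN suc T)
        ≡⟨ renV-sub (ext suc) (exts (renN suc ∘ σ)) (renN suc T) ⟨
      renV (ext suc) (sub (exts (renN suc ∘ σ)) (renN suc T))
        ≡⟨ cong (renV (ext suc)) (trans (ν-exts σ (renN suc T)) (sub-renN-suc (exts σ) T)) ⟩
      renV (ext suc) (renN suc (sub (exts σ) T)) ∎)
    where open ≡-Reasoning

  copier-renN : ∀ a ρ (T : Term (suc n) proc) →
                renN (lift ρ) (copier a T) ≡ copier (ρ a) (renN ρ T)
  copier-renN a ρ T = cong (λ X → inp 0 (inp (suc (ρ a)) (force (var (suc zero)) ∥ X) ∥ out 0 (var zero) 𝟎))
    (trans (renN-renV (lift ρ) (ext suc) (renN suc T))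
           (cong (renV (ext suc)) (renN-square (λ _ → refl) T)))

  !inp-sub : ∀ a (σ : Sub n m) (T : Term (suc n) proc) →
             sub σ (!inp a T) ≡ !inp a (sub (exts σ) T)
  !inp-sub a σ T = cong ν (cong₂ (λ X Y → X ∥ out 0 (ƛ Y) 𝟎) (copier-sub a σ T)
    (trans (sub-exts-wk (renN suc ∘ σ) (copier a T)) (cong wk (copier-sub a σ T))))

  !inp-renN : ∀ a ρ (T : Term (suc n) proc) → renN ρ (!inp a T) ≡ !inp (ρ a) (renN ρ T)
  !inp-renN a ρ T = cong ν (cong₂ (λ X Y → X ∥ out 0 (ƛ Y) 𝟎) (copier-renN a ρ T)
    (trans (renN-renV (lift ρ) suc (copier a T)) (cong wk (copier-renN a ρ T))))

  server-sub : ∀ a (σ : Sub n m) (A : Term n abs) → sub σ (server a A) ≡ server a (sub σ A)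
  server-sub a σ A =
    trans (!inp-sub a σ (wk A · var zero)) (cong (λ X → !inp a (X · var zero)) (sub-exts-wk σ A))

  server-renN : ∀ a ρ (A : Term n abs) → renN ρ (server a A) ≡ server (ρ a) (renN ρ A)
  server-renN a ρ A =
    trans (!inp-renN a ρ (wk A · var zero)) (cong (λ X → !inp (ρ a) (X · var zero)) (renN-renV ρ suc A))

  server-context : ∀ k a (A : Abs) → renN (k +_) (server a (var zero)) [ A ] ≡ server (k + a) A
  server-context k a A =
    trans (cong (_[ A ]) (server-renN a (k +_) (var zero))) (server-sub (k + a) (single A) (var zero))

  code : ℕ → Abs → Proc
  code a A = copier a (wk A · var zero)

  -- The server after it has received its own code along its private name: only
  -- then does it accept a request on a.
  armed : ℕ → Abs → Proc
  armed a A =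
    ν (inp (suc a) (force (wk (thunk (code a A))) ∥ (wk (renN suc A) · var zero))
       ∥ out 0 (thunk (code a A)) 𝟎)

  opaque
    cell : Bool → ℕ → Abs → Proc
    cell false = server
    cell true  = armed

    -- Up to structural congruence, `plug K (ask m)` is what normal bisimulation compares after the
    -- output `K`.
    ask : ℕ → Term 1 proc
    ask a = server a (var zero)

    ask-context : ∀ k a (A : Abs) → renN (k +_) (ask a) [ A ] ≡ cell false (k + a) A
    ask-context = server-context

    ask-server : ∀ k a (A : Abs) → renN (k +_) (ask a) [ A ] ≡ server (k + a) A
    ask-server = server-context

    cell-renN : ∀ b a ρ A → renN ρ (cell b a A) ≡ cell b (ρ a) (renN ρ A)
    cell-renN false a ρ A = server-renN a ρ A
    cell-renN true  a ρ A = cong ν (cong₂ (λ X Y → inp (suc (ρ a)) X ∥ out 0 Y 𝟎)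
      (cong₂ (λ X Y → force X ∥ (Y · var zero))
        (trans (renN-renV (lift ρ) suc (thunk (code a A))) (cong wk thunk-code))
        (trans (renN-renV (lift ρ) suc (renN suc A)) (cong wk (renN-square (λ _ → refl) A))))
      thunk-code)
      where
      code-renN : renN (lift ρ) (code a A) ≡ code (ρ a) (renN ρ A)
      code-renN = trans (copier-renN a ρ _)
                        (cong (λ X → copier (ρ a) (X · var zero)) (renN-renV ρ suc A))
      thunk-code : renN (lift ρ) (thunk (code a A)) ≡ thunk (code (ρ a) (renN ρ A))
      thunk-code = cong ƛ (trans (renN-renV (lift ρ) suc (code a A)) (cong wk code-renN))

  -- An idle server can only arm itself; an armed one can only accept a request and become idle
  -- again, leaving `A` applied to the argument of the request. In particular servers never send,
  -- which rules out communication among them.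
  data CellStep (a : ℕ) (A : Abs) : Bool → Bool → (α : Act) → Res 0 α → Set where
    arm  : ∀ {R} → R ≋ cell true a A → CellStep a A false true τ R
    fire : ∀ {F} → F ≋ wk (cell false a A) ∥ (wk A · var zero) → CellStep a A true false (rcv a) F

  arm-≡ : ∀ a A → ν (plug (con 0 (thunk (code a A)) 𝟎)
      (inp (suc a) (force (var (suc zero)) ∥ renV (ext suc) (renN suc (wk A · var zero)))
        ∥ out 0 (var zero) 𝟎)) ≡ ν ((inp (suc a)
          (force (wk (thunk (code a A))) ∥ (wk (renN suc A) · var zero))
            ∥ out 0 (thunk (code a A)) 𝟎) ∥ 𝟎)
  arm-≡ a A = cong (λ X → ν^ 1 (X ∥ 𝟎))
    (trans (cong (_[ thunk (code a A) ]) (renN-0+ F))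
      (cong (λ X → inp (suc a) (force (wk (thunk (code a A))) ∥ (X · var zero))
                     ∥ out 0 (thunk (code a A)) 𝟎)
        (trans (sub-renV (exts (single (thunk (code a A)))) (ext suc) (renN suc (wk A)))
          (trans (sub-var (λ { zero → refl ; (suc x) → refl }) (renN suc (wk A)))
                 (renN-renV suc suc A)))))
    where
    F : Term 1 proc
    F = inp (suc a) (force (var (suc zero)) ∥ renV (ext suc) (renN suc (wk A · var zero)))
          ∥ out 0 (var zero) 𝟎

  force-thunk : (T : Term n proc) → force (thunk T) ≋ T
  force-thunk T = ≋-trans β (≡⇒≋ (wk-[] T _))

  fire-≋ : ∀ a A → ν ((force (wk (thunk (code a A))) ∥ (wk (renN suc A) · var zero))
                      ∥ wk (out 0 (thunk (code a A)) 𝟎))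
                   ≋ wk (server a A) ∥ (wk A · var zero)
  fire-≋ a A = ≋-trans
    (ν-cong (≋-trans (∼*⇒≋ (∥-right-comm-≡ₛ _ _ _))
      (∥-cong (∥-cong (≋-trans (≡⇒≋ (cong force (thunk-wk (code a A)))) (force-thunk _)) ≋-refl)
              (≡⇒≋ (cong (_· var zero) (sym (renN-renV suc suc A)))))))
    ν-extrude
    where
    thunk-wk : (T : Proc) → wk (thunk T) ≡ thunk (wk T)
    thunk-wk T = cong ƛ (trans (renV-∘ (ext suc) suc T) (sym (renV-∘ suc suc T)))

  opaque
    unfolding cell

    cell-inv : ∀ b {a A α R} → cell b a A ↦⟨ i ∣ α ⟩ R → ∃[ b′ ] CellStep a A b b′ α R
    cell-inv false (res {α = τ} (parl ()))
    cell-inv false (res {α = rcv a} (parl ()))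
    cell-inv false (res {α = snd a} (parl ()))
    cell-inv false (res {α = τ} (parr ()))
    cell-inv false (res {α = rcv a} (parr ()))
    cell-inv false (res {α = snd a} (parr ()))
    cell-inv false {a} {A} (res {α = τ} (coml inp out)) =
      true , arm (≋-trans (≡⇒≋ (arm-≡ a A)) (ν-cong ∥-identity))
    cell-inv false (res {α = τ} (comr () e))
    cell-inv true (res {α = τ} (parl ()))
    cell-inv true {a} {A} (res {α = rcv _} (parl inp)) = false , fire (fire-≋ a A)
    cell-inv true (res {α = snd a} (parl ()))
    cell-inv true (res {α = τ} (parr ()))
    cell-inv true (res {α = rcv a} (parr ()))
    cell-inv true (res {α = snd a} (parr ()))
    cell-inv true (res {α = τ} (coml inp ()))
    cell-inv true (res {α = τ} (comr () e))

    cell-arm : ∀ a A → ∃[ R ] cell false a A ↦⟨ 0 ∣ τ ⟩ R × R ≋ cell true a A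
    cell-arm a A = _ , res (coml inp out) , ≋-trans (≡⇒≋ (arm-≡ a A)) (ν-cong ∥-identity)

    cell-fire : ∀ a A → ∃[ F ] cell true a A ↦⟨ 0 ∣ rcv a ⟩ F ×
                               F ≋ wk (cell false a A) ∥ (wk A · var zero)
    cell-fire a A = _ , res (parl inp) , fire-≋ a A

  cells : ∀ {p} → (Fin p → Bool) → (Fin p → ℕ) → (Fin p → Abs) → Proc
  cells {zero}  st μ A = 𝟎
  cells {suc p} st μ A = cell (st zero) (μ zero) (A zero) ∥ cells (st ∘ suc) (μ ∘ suc) (A ∘ suc)

  cells-cong : ∀ {p} (st : Fin p → Bool) {μ μ′ A A′} → μ ≗ μ′ → A ≗ A′ →
               cells st μ A ≡ cells st μ′ A′
  cells-cong {zero}  st e f = refl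
  cells-cong {suc p} st e f =
    cong₂ _∥_ (cong₂ (cell (st zero)) (e zero) (f zero)) (cells-cong (st ∘ suc) (e ∘ suc) (f ∘ suc))

  cells-renN : ∀ {p} ρ (st : Fin p → Bool) μ A →
               renN ρ (cells st μ A) ≡ cells st (ρ ∘ μ) (renN ρ ∘ A)
  cells-renN {zero}  ρ st μ A = refl
  cells-renN {suc p} ρ st μ A =
    cong₂ _∥_ (cell-renN (st zero) (μ zero) ρ (A zero))
              (cells-renN ρ (st ∘ suc) (μ ∘ suc) (A ∘ suc))

  data CellsStep {p} (μ : Fin p → ℕ) (A : Fin p → Abs) : (α : Act) → Res 0 α → Set where
    arm  : ∀ st {R} → R ≋ cells st μ A → CellsStep μ A τ R
    fire : ∀ st i {F} → F ≋ wk (cells st μ A) ∥ (wk (A i) · var zero) →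
           CellsStep μ A (rcv (μ i)) F

  cells-inv : ∀ {p} (st : Fin p → Bool) {μ A α R} → cells st μ A ↦⟨ i ∣ α ⟩ R → CellsStep μ A α R
  cells-inv {p = suc p} st {μ} {A} (parl d) = here (proj₂ (cell-inv (st zero) d))
    where
    here : ∀ {b b′ α R} → CellStep (μ zero) (A zero) b b′ α R →
           CellsStep μ A α (parR α R (cells (st ∘ suc) (μ ∘ suc) (A ∘ suc)))
    here {b′ = b} (arm e)  = arm (b ◂ st ∘ suc) (∥-cong e ≋-refl)
    here {b′ = b} (fire e) = fire (b ◂ st ∘ suc) zero
      (≋-trans (∥-cong e ≋-refl) (∼*⇒≋ (∥-right-comm-≡ₛ _ _ _)))
  cells-inv {p = suc p} st (parr d) with cells-inv (st ∘ suc) d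
  ... | arm st′ e    = arm (st zero ◂ st′) (≋-trans ∥-comm (∥-cong ≋-refl e))
  ... | fire st′ i e = fire (st zero ◂ st′) (suc i)
    (≋-trans (∥-cong e ≋-refl)
      (≋-trans (∼*⇒≋ (∥-right-comm-≡ₛ _ _ _)) (∥-cong ∥-comm ≋-refl)))
  cells-inv {p = suc p} st (coml d e) with cells-inv (st ∘ suc) e
  ... | ()
  cells-inv {p = suc p} st (comr d e) = ⊥-elim (no-output (proj₂ (cell-inv (st zero) d)))
    where
    no-output : ∀ {a A b b′ c K} → ¬ CellStep a A b b′ (snd c) K
    no-output ()

  record CellsFire {p} (st : Fin p → Bool) (μ : Fin p → ℕ) (A : Fin p → Abs) (i : Fin p) : Set where
    field
      st₁ st₂ : Fin p → Bool
      F       : Term 1 proc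
      ready   : cells st μ A ⟹ cells st₁ μ A
      step    : cells st₁ μ A ↦⟨ 0 ∣ rcv (μ i) ⟩ F
      result  : F ≋ wk (cells st₂ μ A) ∥ (wk (A i) · var zero)

  cells-fire : ∀ {p} (st : Fin p → Bool) μ A (i : Fin p) → CellsFire st μ A i
  cells-fire {suc p} st μ A zero = record
    { st₁ = true ◂ st ∘ suc ; st₂ = false ◂ st ∘ suc
    ; ready = ∥-⟹ _ (ready (st zero))
    ; step = parl (proj₁ (proj₂ (cell-fire (μ zero) (A zero))))
    ; result = ≋-trans (∥-cong (proj₂ (proj₂ (cell-fire (μ zero) (A zero)))) ≋-refl)
                       (∼*⇒≋ (∥-right-comm-≡ₛ _ _ _)) }
    where
    ready : ∀ b → cell b (μ zero) (A zero) ⟹ cell true (μ zero) (A zero)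
    ready true  = ε
    ready false with cell-arm (μ zero) (A zero)
    ... | R , d , e = tau d ◅ str e ◅ ε
  cells-fire {suc p} st μ A (suc i) = record
    { st₁ = st zero ◂ st₁ ; st₂ = st zero ◂ st₂
    ; ready = ∥-⟹ʳ _ ready
    ; step = parr step
    ; result = ≋-trans (∥-cong result ≋-refl)
        (≋-trans (∼*⇒≋ (∥-right-comm-≡ₛ _ _ _)) (∥-cong ∥-comm ≋-refl)) }
    where open CellsFire (cells-fire (st ∘ suc) (μ ∘ suc) (A ∘ suc) i)

  -- Normal bisimulation places the server to the right of the continuation, context bisimulation
  -- places the context to the left, and `R` itself need not be closed under congruence.
  ≋-closed : Rel Proc 0ℓ → Rel Proc 0ℓ
  ≋-closed R P Q = ∃₂ λ P₁ Q₁ → P ≋ P₁ × R P₁ Q₁ × Q₁ ≋ Q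

  ≋-⇒[] : ∀ {l} → P ≋ P′ → P′ ⇒[ l ] Q → P ⇒[ l ] Q
  ≋-⇒[] e (_ , _ , ds , d , ds′) with ≋-⇒ e ds
  ... | _ , ds₁ , f = _ , _ , ds₁ , str f d ≋-refl , ds′

  ≈⇒≅ : P ≈ Q → P ≅ Q
  ≈⇒≅ {P} {Q} (R , isCB , r) = ≋-closed R , isNB , P , Q , ≋-refl , r , ≋-refl
    where
    open IsContextBisimulation isCB
    isNB : IsNormalBisimulation (≋-closed R)
    isNB = record
      { symmetric = λ { (_ , _ , e , r , f) → _ , _ , ≋-sym f , symmetric r , ≋-sym e }
      ; silent = λ { (_ , _ , e , r , f) d → silent′ e r f (nonOutput r τ (str (≋-sym e) d ≋-refl)) }
      ; input = λ { {a = a} {m} (_ , _ , e , r , f) _ _ d →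
          input′ f (nonOutput r (recv a (Tr m)) (str (≋-sym e) d ≋-refl)) }
      ; output = λ { {P} (_ , _ , e , r , f) d → output′ {P} f (output r (str (≋-sym e) d ≋-refl)) }
      }
      where
      silent′ : ∀ {P P₁ Q₁ Q P′} → P ≋ P₁ → R P₁ Q₁ → Q₁ ≋ Q →
        ∃[ Q′ ] (Q₁ ⇒ Q′ × R P′ Q′) → ∃[ Q′ ] (Q ⇒ Q′ × ≋-closed R P′ Q′)
      silent′ e r f (Q′ , ds , r′) with ≋-⇒ (≋-sym f) ds
      ... | Q″ , ds′ , g = Q″ , ds′ , _ , _ , ≋-refl , r′ , ≋-sym g
      input′ : ∀ {Q₁ Q P′ a A} → Q₁ ≋ Q →
        ∃[ Q′ ] (Q₁ ⇒[ recv a A ] Q′ × R P′ Q′) →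
        ∃[ Q′ ] (Q ⇒[ recv a A ] Q′ × ≋-closed R P′ Q′)
      input′ f (Q′ , ds , r′) = Q′ , ≋-⇒[] (≋-sym f) ds , _ , _ , ≋-refl , r′ , ≋-refl
      output′ : ∀ {P Q₁ Q P′ k a A} → Q₁ ≋ Q →
        ∃[ l ] ∃[ B ] ∃[ Q′ ] (Q₁ ⇒[ send l a B ] Q′ × ((E : Term 1 proc) →
          R (ν^ k (renN (k +_) E [ A ] ∥ P′)) (ν^ l (renN (l +_) E [ B ] ∥ Q′)))) →
        ∃[ l ] ∃[ B ] ∃[ Q′ ] (Q ⇒[ send l a B ] Q′ ×
          (∀ m → m ∉fn P → m ∉fn Q → k + m ∉fn A → k + m ∉fn P′ → l + m ∉fn B → l + m ∉fn Q′ →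
            ≋-closed R (ν^ k (P′ ∥ server (k + m) A)) (ν^ l (Q′ ∥ server (l + m) B))))
      output′ {k = k} {A = A} f (l , B , Q′ , ds , r′) =
        l , B , Q′ , ≋-⇒[] (≋-sym f) ds , λ m _ _ _ _ _ _ →
          _ , _ ,
          ν^-≋ k (≋-trans ∥-comm (∥-cong (≡⇒≋ (sym (server-context k m A))) ≋-refl)) ,
          r′ (server m (var zero)) ,
          ν^-≋ l (≋-trans (∥-cong (≡⇒≋ (server-context l m B)) ≋-refl) ∥-comm)

  -- Fresh names, and normal bisimulation in terms of late transitions

  bound : (T : Term n s) → ∃[ N ] ∀ a → N ≤ a → a ∉fn T
  bound (var x) = 0 , λ _ _ ()
  bound (ƛ T)   = bound T
  bound 𝟎       = 0 , λ _ _ ()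
  bound (inp b T) with bound T
  ... | N , f = suc b ⊔ N , λ
    { a N≤a (inj₁ refl) → 1+n≰n (≤-trans (m≤m⊔n (suc b) N) N≤a)
    ; a N≤a (inj₂ a∈T)  → f a (≤-trans (m≤n⊔m (suc b) N) N≤a) a∈T }
  bound (out b A T) with bound A | bound T
  ... | M , g | N , f = suc b ⊔ (M ⊔ N) , λ
    { a N≤a (inj₁ refl)       → 1+n≰n (≤-trans (m≤m⊔n (suc b) (M ⊔ N)) N≤a)
    ; a N≤a (inj₂ (inj₁ a∈A)) →
        g a (≤-trans (≤-trans (m≤m⊔n M N) (m≤n⊔m (suc b) (M ⊔ N))) N≤a) a∈A
    ; a N≤a (inj₂ (inj₂ a∈T)) →
        f a (≤-trans (≤-trans (m≤n⊔m M N) (m≤n⊔m (suc b) (M ⊔ N))) N≤a) a∈T }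
  bound (T ∥ U) with bound T | bound U
  ... | M , g | N , f = M ⊔ N , λ
    { a N≤a (inj₁ a∈T) → g a (≤-trans (m≤m⊔n M N) N≤a) a∈T
    ; a N≤a (inj₂ a∈U) → f a (≤-trans (m≤n⊔m M N) N≤a) a∈U }
  bound (ν T) with bound T
  ... | N , f = N , λ a N≤a → f (suc a) (m≤n⇒m≤1+n N≤a)
  bound (A · B) with bound A | bound B
  ... | M , g | N , f = M ⊔ N , λ
    { a N≤a (inj₁ a∈A) → g a (≤-trans (m≤m⊔n M N) N≤a) a∈A
    ; a N≤a (inj₂ a∈B) → f a (≤-trans (m≤n⊔m M N) N≤a) a∈B }

  module UpTo≋ {R : Rel Proc 0ℓ} (isNB : IsNormalBisimulation R) where
    open IsNormalBisimulation isNB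

    infix 4 _≅′_

    record _≅′_ (P Q : Proc) : Set where
      constructor via
      field
        {P₁ Q₁} : Proc
        left    : P ≋ P₁
        related : R P₁ Q₁
        right   : Q₁ ≋ Q

    ≅′-sym : P ≅′ Q → Q ≅′ P
    ≅′-sym (via e r f) = via (≋-sym f) (symmetric r) (≋-sym e)

    ≅′-respects : P′ ≋ P → P ≅′ Q → Q ≋ Q′ → P′ ≅′ Q′
    ≅′-respects e (via e′ r f′) f = via (≋-trans e e′) r (≋-trans f′ f)

    ≅′-τ : P ≅′ Q → P ↦⟨ i ∣ τ ⟩ P′ → ∃[ Q′ ] Q ⟹ Q′ × P′ ≅′ Q′
    ≅′-τ (via e r f) d with ≋-↦ e d
    ... | _ , P₁′ , d₁ , q with silent r (τ-sound d₁)
    ... | Q′ , ds , r′ = Q′ , str (≋-sym f) ◅ ⇒⇒⟹ ds , via q r′ ≋-refl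

    ≅′-⟹ : P ≅′ Q → P ⟹ P′ → ∃[ Q′ ] Q ⟹ Q′ × P′ ≅′ Q′
    ≅′-⟹ r ε = _ , ε , r
    ≅′-⟹ r (str e ◅ w) = ≅′-⟹ (≅′-respects (≋-sym e) r ≋-refl) w
    ≅′-⟹ r (tau d ◅ w) with ≅′-τ r d
    ... | _ , v , r′ with ≅′-⟹ r′ w
    ... | Q′ , v′ , r″ = Q′ , v ◅◅ v′ , r″

    record InputMatch (a m : ℕ) (F : Term 1 proc) (Q : Proc) : Set where
      field
        {j}   : ℕ
        {Q₁}  : Proc
        {G}   : Term 1 proc
        {V}   : Proc
        reach : Q ⟹ Q₁
        step  : Q₁ ↦⟨ j ∣ rcv a ⟩ G
        after : G [ Tr m ] ⟹ V
        rel   : F [ Tr m ] ≅′ V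

    -- Normal bisimulation answers each trigger separately, so the answer may depend on `m`; it is
    -- therefore placed after the quantifier over `m`.
    ≅′-input : ∀ {a F} → P ≅′ Q → P ↦⟨ i ∣ rcv a ⟩ F →
               ∃[ N ] ∀ m → N ≤ m → InputMatch a m F Q
    ≅′-input {a = a} (via {P₁} {Q₁} e r f) d
      with ≋-↦ e d | bound (P₁ ∥ Q₁)
    ... | _ , F₁ , d₁ , q | N , fresh = N , λ m N≤m → match m
      (input r (fresh m N≤m ∘ inj₁) (fresh m N≤m ∘ inj₂) (recv-sound d₁ (Tr m)))
      where
      match : ∀ m → ∃[ Q′ ] (Q₁ ⇒[ recv a (Tr m) ] Q′ × R (F₁ [ Tr m ]) Q′) → InputMatch a m _ _
      match m (Q′ , (_ , _ , ds , s , ds′) , r′) with complete s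
      ... | _ , G , s₀ , p = record
        { reach = str (≋-sym f) ◅ ⇒⇒⟹ ds ; step = s₀ ; after = str p ◅ ⇒⇒⟹ ds′
        ; rel = via ([]-≋ q ≋-refl) r′ ≋-refl }

    -- Here the answer is fixed before the name `m` of the server is chosen, and the bound `N` on
    -- `m` depends on that answer.
    ≅′-output : ∀ {a K} → P ≅′ Q → P ↦⟨ i ∣ snd a ⟩ K →
      ∃[ Q₁ ] ∃[ j ] ∃[ L ] (Q ⟹ Q₁ × Q₁ ↦⟨ j ∣ snd a ⟩ L × (∃[ N ] ∀ m → N ≤ m →
        ∃[ V ] (plug L (ask m) ⟹ V × plug K (ask m) ≅′ V)))
    ≅′-output {a = a} {K} (via {P₁} {Q₁} e r f) d with ≋-↦ e d
    ... | _ , K₁@(con _ _ T) , d₁ , q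
      with o ← send-sound d₁
      with output r (Send.step o)
    ... | l , B , Q′ , (Qa , Qb , ds , s , ds′) , rel with complete s
    ... | j , L , s₀ , p =
      Qa , j , L , str (≋-sym f) ◅ ⇒⇒⟹ ds , s₀ , N , λ m N≤m →
        ν^ l (server (l + m) B ∥ Q′) ,
        (str (≋-trans (p (ask m))
                (ν^-≋ l (∥-cong (≡⇒≋ (ask-server l m B)) ≋-refl))) ◅
           ν^-⟹ l (∥-⟹ʳ _ (⇒⇒⟹ ds′))) ,
        via (≋-trans (q (ask m)) (≋-trans (≋-sym (H-plug T (ask m)))
               (ν^-≋ k (≋-trans ∥-comm (∥-cong ≋-refl (≡⇒≋ (ask-server k m A)))))))
            (rel m
              (fresh 0 N≤m ∘ inj₁)
              (fresh 0 N≤m ∘ inj₂ ∘ inj₁)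
              (fresh k N≤m ∘ inj₂ ∘ inj₂ ∘ inj₂ ∘ inj₂ ∘ inj₁)
              (fresh k N≤m ∘ inj₂ ∘ inj₂ ∘ inj₁)
              (fresh l N≤m ∘ inj₂ ∘ inj₂ ∘ inj₂ ∘ inj₂ ∘ inj₂)
              (fresh l N≤m ∘ inj₂ ∘ inj₂ ∘ inj₂ ∘ inj₁))
            (ν^-≋ l ∥-comm)
      where
      open Send o using (k; H; H-plug) renaming (B to A)
      -- One term containing everything in which the name of the server has to be fresh. Under
      -- extruded names `m` becomes `k + m` or `l + m`, which respects the same bound.
      all = P₁ ∥ Q₁ ∥ H T ∥ Q′ ∥ A · B
      N   = proj₁ (bound all)
      fresh : ∀ k {m} → N ≤ m → k + m ∉fn all
      fresh k {m} N≤m = proj₂ (bound all) (k + m) (≤-trans N≤m (m≤n+m m k))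

-- Calls of variables, and triggers

module _ where

  private variable
    n m i j : ℕ
    s   : Kind
    T U V : Term n s

  ν^-τ : ∀ k {R} → T ↦⟨ i ∣ τ ⟩ R → ν^ k T ↦⟨ i ∣ τ ⟩ ν^ k R
  ν^-τ zero    d = d
  ν^-τ (suc k) d = res (ν^-τ k d)

  ν^-rcv : ∀ k {a F} → T ↦⟨ i ∣ rcv (k + a) ⟩ F → ν^ k T ↦⟨ i ∣ rcv a ⟩ ν^ k F
  ν^-rcv zero    d = d
  ν^-rcv (suc k) {a} d = res (ν^-rcv k (castRcv (sym (+-suc k a)) d))

  ν^-snd : ∀ k {a e A X} → T ↦⟨ i ∣ snd (k + a) ⟩ con e A X →
           ν^ k T ↦⟨ i ∣ snd a ⟩ con (k + e) A X
  ν^-snd zero    d = d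
  ν^-snd (suc k) {a} d = res (ν^-snd k (castSnd (sym (+-suc k a)) d))

  ν^-τ⁻ : ∀ k {R} → ν^ k T ↦⟨ i ∣ τ ⟩ R → ∃[ R₀ ] T ↦⟨ i ∣ τ ⟩ R₀ × R ≡ ν^ k R₀
  ν^-τ⁻ zero    d = _ , d , refl
  ν^-τ⁻ (suc k) (res {α = τ} d) with ν^-τ⁻ k d
  ... | R₀ , d₀ , refl = R₀ , d₀ , refl

  ν^-rcv⁻ : ∀ k {a F} → ν^ k T ↦⟨ i ∣ rcv a ⟩ F → ∃[ F₀ ] T ↦⟨ i ∣ rcv (k + a) ⟩ F₀ × F ≡ ν^ k F₀
  ν^-rcv⁻ zero    d = _ , d , refl
  ν^-rcv⁻ (suc k) {a} (res {α = rcv _} d) with ν^-rcv⁻ k d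
  ... | F₀ , d₀ , refl = F₀ , castRcv (+-suc k a) d₀ , refl

  ν^-snd⁻ : ∀ k {a K} → ν^ k T ↦⟨ i ∣ snd a ⟩ K →
            ∃[ e ] ∃[ A ] ∃[ X ] (T ↦⟨ i ∣ snd (k + a) ⟩ con e A X × K ≡ con (k + e) A X)
  ν^-snd⁻ zero    {K = con e A X} d = _ , _ , _ , d , refl
  ν^-snd⁻ (suc k) {a} (res {α = snd _} d) with ν^-snd⁻ k d
  ... | e , A , X , d₀ , refl = e , A , X , castSnd (+-suc k a) d₀ , refl

  infix 4 _⇝_

  data _⇝_ {n} : Term n proc → Term n proc → Set where
    β    : ∀ {T A} → ƛ T · A ⇝ T [ A ]
    parl : ∀ {T T′ U} → T ⇝ T′ → T ∥ U ⇝ T′ ∥ U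
    parr : ∀ {T U U′} → U ⇝ U′ → T ∥ U ⇝ T ∥ U′
    res  : ∀ {T T′} → T ⇝ T′ → ν T ⇝ ν T′

  ⇝⇒≋ : T ⇝ U → T ≋ U
  ⇝⇒≋ β        = β
  ⇝⇒≋ (parl d) = ∥-cong (⇝⇒≋ d) ≋-refl
  ⇝⇒≋ (parr d) = ∥-cong ≋-refl (⇝⇒≋ d)
  ⇝⇒≋ (res d)  = ν-cong (⇝⇒≋ d)

  ν^-⇝⁻ : ∀ k → ν^ k T ⇝ U → ∃[ T′ ] T ⇝ T′ × U ≡ ν^ k T′
  ν^-⇝⁻ zero    d = _ , d , refl
  ν^-⇝⁻ (suc k) (res d) with ν^-⇝⁻ k d
  ... | T′ , d₀ , refl = T′ , d₀ , refl

  -- The β-steps counted by a derivation all contract active redexes, so one of them can be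
  -- performed in advance. In `simulated` this lowers the cost by one.
  contract : ∀ {α} {R : Res n α} → j ≡ suc i → T ↦⟨ j ∣ α ⟩ R → ∃[ T′ ] T ⇝ T′ × T′ ↦⟨ i ∣ α ⟩ R
  contract () inp
  contract () out
  contract p (parl d) with contract p d
  ... | _ , s , d′ = _ , parl s , parl d′
  contract p (parr d) with contract p d
  ... | _ , s , d′ = _ , parr s , parr d′
  contract p (coml {i = suc i} d e) with refl ← p with contract refl d
  ... | _ , s , d′ = _ , parl s , coml d′ e
  contract p (coml {i = zero} d e) with contract p e
  ... | _ , s , e′ = _ , parr s , coml d e′
  contract p (comr {j = suc j} d e) with refl ← p with contract refl e
  ... | _ , s , e′ = _ , parr s , comr d e′
  contract p (comr {j = zero} d e) with contract p d
  ... | _ , s , d′ = _ , parl s , comr d′ e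
  contract p (res d) with contract p d
  ... | _ , s , d′ = _ , res s , res d′
  contract p (β d) with refl ← p = _ , β , d

  -- Calls T e x D T′: T offers, below e restrictions and next to T′, an
  -- application of the variable x to D.
  data Calls {n} : Term n proc → ℕ → Fin n → Term n abs → Term n proc → Set where
    here : ∀ {x D} → Calls (var x · D) 0 x D 𝟎
    parl : ∀ {T U e x D T′} → Calls T e x D T′ → Calls (T ∥ U) e x D (T′ ∥ renN (e +_) U)
    parr : ∀ {T U e x D U′} → Calls U e x D U′ → Calls (T ∥ U) e x D (U′ ∥ renN (e +_) T)
    res  : ∀ {T e x D T′} → Calls T e x D T′ → Calls (ν T) (suc e) x D T′

  calls-≡ₛ : ∀ {e x D T′} → Calls {n} T e x D T′ → T ≡ₛ ν^ e (var x · D ∥ T′)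
  calls-≡ₛ here = ∼⇒≡ₛ (id← (∼-refl _))
  calls-≡ₛ (parl {U = U} {e} c) =
    ∥-cong* (calls-≡ₛ c) ε ◅◅ reverse* (ν^-≡ₛ e (reverse* (∥-assoc-≡ₛ _ _ _)) ◅◅ ν^-extrude e _ U)
  calls-≡ₛ (parr {T = T} {e = e} c) =
    ∥-cong* ε (calls-≡ₛ c) ◅◅ ∥-comm-≡ₛ _ _ ◅◅
    reverse* (ν^-≡ₛ e (reverse* (∥-assoc-≡ₛ _ _ _)) ◅◅ ν^-extrude e _ T)
  calls-≡ₛ (res c) = ν-≡ₛ (calls-≡ₛ c)

  renN-⇝⁻ : ∀ ρ (T : Term n proc) → renN ρ T ⇝ V → ∃[ T′ ] T ⇝ T′ × V ≡ renN ρ T′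
  renN-⇝⁻ ρ (T ∥ U) (parl d) with renN-⇝⁻ ρ T d
  ... | T′ , d′ , refl = _ , parl d′ , refl
  renN-⇝⁻ ρ (T ∥ U) (parr d) with renN-⇝⁻ ρ U d
  ... | U′ , d′ , refl = _ , parr d′ , refl
  renN-⇝⁻ ρ (ν T) (res d) with renN-⇝⁻ (lift ρ) T d
  ... | T′ , d′ , refl = _ , res d′ , refl
  renN-⇝⁻ ρ (ƛ T · A) β = _ , β , sym (renN-[] ρ T A)

  renN-calls⁻ : ∀ ρ (T : Term n proc) {e x D T′} → Calls (renN ρ T) e x D T′ →
    ∃₂ λ D₀ T₀ → Calls T e x D₀ T₀ × D ≡ renN (lift^ e ρ) D₀ × T′ ≡ renN (lift^ e ρ) T₀
  renN-calls⁻ ρ (T ∥ U) {e} (parl c) with renN-calls⁻ ρ T c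
  ... | D₀ , T₀ , c₀ , refl , refl =
    _ , _ , parl c₀ , refl , cong (_ ∥_) (sym (renN-square (lift^-shift e ρ) U))
  renN-calls⁻ ρ (T ∥ U) {e} (parr c) with renN-calls⁻ ρ U c
  ... | D₀ , T₀ , c₀ , refl , refl =
    _ , _ , parr c₀ , refl , cong (_ ∥_) (sym (renN-square (lift^-shift e ρ) T))
  renN-calls⁻ ρ (ν T) {suc e} (res c) with renN-calls⁻ (lift ρ) T c
  ... | D₀ , T₀ , c₀ , refl , refl =
    _ , _ , res c₀ , renN-cong (lift^-lift e ρ) D₀ , renN-cong (lift^-lift e ρ) T₀
  renN-calls⁻ ρ (var x · D) here = _ , _ , here , refl , refl

  apply : Term n abs → Term n abs → Term n proc
  apply (var x) A = var x · A
  apply (ƛ T)   A = T [ A ]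

  renN-apply : ∀ ρ (A B : Term n abs) → renN ρ (apply A B) ≡ apply (renN ρ A) (renN ρ B)
  renN-apply ρ (var x) B = refl
  renN-apply ρ (ƛ T)   B = renN-[] ρ T B

  ⇝-apply : (A B : Term n abs) → A · B ⇝ V → V ≡ apply A B
  ⇝-apply (ƛ T) B β = refl

  record CallStep (σ : Sub n m) (T : Term n proc) (V : Term m proc) : Set where
    field
      e    : ℕ
      x    : Fin n
      D    : Term n abs
      T′   : Term n proc
      calls : Calls T e x D T′
      step : V ≡ₛ ν^ e (apply (renN (e +_) (σ x)) (sub (renN (e +_) ∘ σ) D) ∥ sub (renN (e +_) ∘ σ) T′)

  -- A redex of `sub σ T` that does not come from `T` arises where `σ` replaces the head of an
  -- application `var x · D`; in a configuration this is a call, at which code crosses between the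
  -- two parts.
  sub-⇝⁻ : (σ : Sub n m) (T : Term n proc) → sub σ T ⇝ V →
           (∃[ T′ ] T ⇝ T′ × V ≡ sub σ T′) ⊎ CallStep σ T V
  sub-⇝⁻ σ (T ∥ U) (parl d) with sub-⇝⁻ σ T d
  ... | inj₁ (T′ , d′ , refl) = inj₁ (_ , parl d′ , refl)
  ... | inj₂ c = inj₂ record
    { calls = parl calls
    ; step = ∥-cong* step (≡⇒≡ₛ refl) ◅◅ reverse* (ν^-≡ₛ e
        (∥-cong* ε (∥-cong* ε (≡⇒≡ₛ (sym (renN-sub (e +_) σ U)))) ◅◅ reverse* (∥-assoc-≡ₛ _ _ _)) ◅◅
        ν^-extrude e _ (sub σ U)) }
    where open CallStep c
  sub-⇝⁻ σ (T ∥ U) (parr d) with sub-⇝⁻ σ U d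
  ... | inj₁ (U′ , d′ , refl) = inj₁ (_ , parr d′ , refl)
  ... | inj₂ c = inj₂ record
    { calls = parr calls
    ; step = ∥-comm-≡ₛ _ _ ◅◅ ∥-cong* step (≡⇒≡ₛ refl) ◅◅ reverse* (ν^-≡ₛ e
        (∥-cong* ε (∥-cong* ε (≡⇒≡ₛ (sym (renN-sub (e +_) σ T)))) ◅◅ reverse* (∥-assoc-≡ₛ _ _ _)) ◅◅
        ν^-extrude e _ (sub σ T)) }
    where open CallStep c
  sub-⇝⁻ σ (ν T) (res d) with sub-⇝⁻ (renN suc ∘ σ) T d
  ... | inj₁ (T′ , d′ , refl) = inj₁ (_ , res d′ , refl)
  ... | inj₂ c = inj₂ record
    { calls = res calls
    ; step = ν-≡ₛ step ◅◅ ≡⇒≡ₛ (cong (ν^ (suc e)) (cong₂ _∥_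
        (cong₂ apply (eq x) (sub-cong eq D)) (sub-cong eq T′))) }
    where
    open CallStep c
    eq : ∀ x → renN (e +_) (renN suc (σ x)) ≡ renN (suc e +_) (σ x)
    eq x = renN-triangle (+-suc-≗ e) (σ x)
  sub-⇝⁻ σ (ƛ T · A) β = inj₁ (_ , β , sym (sub-[] σ T A))
  sub-⇝⁻ {V = V} σ (var x · D) d = inj₂ record
    { calls = here
    ; step = ≡⇒≡ₛ (trans (⇝-apply (σ x) (sub σ D) d)
               (cong₂ apply (sym (renN-0+ (σ x))) (sub-cong (sym ∘ renN-0+ ∘ σ) D))) ◅◅
             ∼⇒≡ₛ (id← (∼-refl _)) }

  ·-↦ : ∀ {A B : Term n abs} {α R} → A · B ↦⟨ i ∣ α ⟩ R → i ≢ 0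
  ·-↦ (β d) ()

  -- At cost 0 no application is contracted. The substituted abstractions could act only as heads of
  -- applications, so they contribute no prefix.
  sub-↦⁻ : (σ : Sub n m) (T : Term n proc) {α : Act} {R : Res m α} → i ≡ 0 → sub σ T ≡ U →
           U ↦⟨ i ∣ α ⟩ R → ∃[ R₀ ] T ↦⟨ i ∣ α ⟩ R₀ × R ≡ subR σ α R₀
  sub-↦⁻ σ (inp a T)   p refl inp = T , inp , refl
  sub-↦⁻ σ (out a A T) p refl out = con 0 A T , out ,
    cong₂ (con 0) (sub-cong (sym ∘ renN-0+ ∘ σ) A) (sub-cong (sym ∘ renN-0+ ∘ σ) T)
  sub-↦⁻ σ (T ∥ U) p refl (parl {α = α} d) with sub-↦⁻ σ T p refl d
  ... | R₀ , d₀ , refl = _ , parl d₀ , parR-subR σ α R₀ U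
  sub-↦⁻ σ (T ∥ U) p refl (parr {α = α} d) with sub-↦⁻ σ U p refl d
  ... | R₀ , d₀ , refl = _ , parr d₀ , parR-subR σ α R₀ T
  sub-↦⁻ σ (T ∥ U) p refl (coml {i = i} d e)
    with sub-↦⁻ σ T (m+n≡0⇒m≡0 i p) refl d | sub-↦⁻ σ U (m+n≡0⇒n≡0 i p) refl e
  ... | F , d₀ , refl | K , e₀ , refl = _ , coml d₀ e₀ , sym (plug-sub σ K F)
  sub-↦⁻ σ (T ∥ U) p refl (comr {j = j} d e)
    with sub-↦⁻ σ T (m+n≡0⇒n≡0 j p) refl d | sub-↦⁻ σ U (m+n≡0⇒m≡0 j p) refl e
  ... | K , d₀ , refl | F , e₀ , refl = _ , comr d₀ e₀ , sym (plug-sub σ K F)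
  sub-↦⁻ σ (ν T) p refl (res {α = τ} d) with sub-↦⁻ (renN suc ∘ σ) T p refl d
  ... | R₀ , d₀ , refl = _ , res d₀ , refl
  sub-↦⁻ σ (ν T) p refl (res {α = rcv a} d) with sub-↦⁻ (renN suc ∘ σ) T p refl d
  ... | F , d₀ , refl = _ , res d₀ , cong ν (ν-exts σ F)
  sub-↦⁻ σ (ν T) p refl (res {α = snd a} d) with sub-↦⁻ (renN suc ∘ σ) T p refl d
  ... | K , d₀ , refl = _ , res d₀ , νC-subC σ K
  sub-↦⁻ σ (A · B) p refl d = ⊥-elim (·-↦ d p)

  -- Processes with triggers in place of variables

  triggers : (Fin n → ℕ) → Sub n 0
  triggers c j = Tr (c j)

  trig : (ℕ → ℕ) → (Fin n → ℕ) → Term n s → Term 0 s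
  trig ρ c T = sub (triggers c) (renN ρ T)

  trig-cong : ∀ {ρ ρ′} {c c′ : Fin n → ℕ} → ρ ≗ ρ′ → c ≗ c′ → (T : Term n s) →
              trig ρ c T ≡ trig ρ′ c′ T
  trig-cong e f T = trans (sub-cong (cong Tr ∘ f) (renN _ T)) (cong (sub (triggers _)) (renN-cong e T))

  trig-shift : ∀ e ρ (c : Fin n → ℕ) (T : Term n s) →
               trig (lift^ e ρ) ((e +_) ∘ c) (renN (e +_) T) ≡ renN (e +_) (trig ρ c T)
  trig-shift e ρ c T =
    trans (cong (sub _) (renN-square (lift^-shift e ρ) T)) (sym (renN-sub (e +_) (triggers c) (renN ρ T)))

  trigR : (ρ : ℕ → ℕ) (c : Fin n → ℕ) (α : Act) → Res n α → Res 0 (renA ρ α)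
  trigR ρ c α R = subR (triggers c) (renA ρ α) (renR ρ α R)

  trig-↦ : ∀ ρ (c : Fin n → ℕ) {α : Act} {R : Res n α} → T ↦⟨ i ∣ α ⟩ R →
           trig ρ c T ↦⟨ i ∣ renA ρ α ⟩ trigR ρ c α R
  trig-↦ ρ c d = sub-↦ (triggers c) (renN-↦ ρ d)

  parR-trigR : ∀ ρ (c : Fin n → ℕ) (α : Act) (R : Res n α) (U : Term n proc) →
    parR (renA ρ α) (trigR ρ c α R) (trig ρ c U) ≡ trigR ρ c α (parR α R U)
  parR-trigR ρ c α R U =
    trans (parR-subR (triggers c) (renA ρ α) (renR ρ α R) (renN ρ U))
          (cong (subR (triggers c) (renA ρ α)) (parR-renR ρ α R U))

  plug-trig : ∀ ρ (c : Fin n → ℕ) (K : Con n) (F : Term (suc n) proc) →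
    plug (subC (triggers c) (renC ρ K)) (sub (exts (triggers c)) (renN ρ F)) ≡ trig ρ c (plug K F)
  plug-trig ρ c K F =
    trans (sym (plug-sub (triggers c) (renC ρ K) (renN ρ F)))
          (cong (sub (triggers c)) (sym (plug-renN ρ K F)))

  data OwnStep (ρ : ℕ → ℕ) (c : Fin n → ℕ) (T : Term n proc) : (α : Act) → Res 0 α → Set where
    own : ∀ α {R : Res n α} → T ↦⟨ i ∣ α ⟩ R → ∀ {β S} → _≡_ {A = Outcome 0} (β , S) (renA ρ α , trigR ρ c α R) →
          OwnStep ρ c T β S

  -- Once `var j` is replaced by a trigger, the call `var j · G` contracts to an output of `G` on
  -- `c j`: this is how a silent call becomes visible to normal bisimulation.
  data TrigCall (ρ : ℕ → ℕ) (c : Fin n → ℕ) (T : Term n proc) : (α : Act) → Res 0 α → Set where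
    call : ∀ j e G T′ {K} → T ≋ ν^ e (var j · G ∥ T′) →
           (∀ E → plug K E ≋ plug (con e (trig (lift^ e ρ) ((e +_) ∘ c) G)
                                         (trig (lift^ e ρ) ((e +_) ∘ c) T′)) E) →
           TrigCall ρ c T (snd (c j)) K

  own-rcv : ∀ {ρ} {c : Fin n → ℕ} {a F} → OwnStep ρ c T (rcv a) F →
            ∃[ a₀ ] ∃[ F₀ ] ∃[ i ] (T ↦⟨ i ∣ rcv a₀ ⟩ F₀ × a ≡ ρ a₀ ×
              F ≡ sub (exts (triggers c)) (renN ρ F₀))
  own-rcv (own (rcv a₀) d refl) = a₀ , _ , _ , d , refl , refl

  own-snd : ∀ {ρ} {c : Fin n → ℕ} {a K} → OwnStep ρ c T (snd a) K →
            ∃[ a₀ ] ∃[ K₀ ] ∃[ i ] (T ↦⟨ i ∣ snd a₀ ⟩ K₀ × a ≡ ρ a₀ ×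
              K ≡ subC (triggers c) (renC ρ K₀))
  own-snd (own (snd a₀) d refl) = a₀ , _ , _ , d , refl , refl

  own-τ : ∀ {ρ} {c : Fin n → ℕ} {R} → OwnStep ρ c T τ R →
          ∃[ R₀ ] ∃[ i ] (T ↦⟨ i ∣ τ ⟩ R₀ × R ≡ trig ρ c R₀)
  own-τ (own τ d refl) = _ , _ , d , refl

  own-par : ∀ {ρ} {c : Fin n → ℕ} {α R} {T : Term n proc} (U : Term n proc) → OwnStep ρ c T α R →
            (∀ {i β} {S : Res n β} → T ↦⟨ i ∣ β ⟩ S → V ↦⟨ i ∣ β ⟩ parR β S U) →
            OwnStep ρ c V α (parR α R (trig ρ c U))
  own-par {ρ = ρ} {c} U (own γ {S} d refl) f = own γ (f d) (cong (_ ,_) (parR-trigR ρ c γ S U))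

  call-par : ∀ {ρ} {c : Fin n → ℕ} {α R} {T : Term n proc} (U : Term n proc) → TrigCall ρ c T α R →
             V ≋ T ∥ U → TrigCall ρ c V α (parR α R (trig ρ c U))
  call-par {ρ = ρ} {c} U (call j e G T′ {K} p q) r = call j e G (T′ ∥ renN (e +_) U)
    (≋-trans r (≋-trans (∥-cong p ≋-refl) (∼*⇒≋
      (reverse* (ν^-≡ₛ e (reverse* (∥-assoc-≡ₛ _ _ _)) ◅◅ ν^-extrude e _ U)))))
    λ E → ≋-trans (∼*⇒≋ (plug-parC K (trig ρ c U) E)) (≋-trans (∥-cong (q E) ≋-refl)
      (≋-trans (≋-sym (∼*⇒≋ (plug-parC (con e _ _) (trig ρ c U) E)))
        (≡⇒≋ (cong (λ X → plug (con e _ (_ ∥ X)) E) (sym (trig-shift e ρ c U))))))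

  own-ν : ∀ {ρ} {c : Fin n → ℕ} α {R} → OwnStep (lift ρ) (suc ∘ c) T (renA suc α) R →
          OwnStep ρ c (ν T) α (νR α R)
  own-ν τ       (own τ d refl) = own τ (res d) refl
  own-ν {c = c} (rcv a) (own (rcv (suc b)) {F} d refl) =
    own (rcv b) (res d) (cong (λ X → rcv _ , ν X) (ν-exts (triggers c) (renN (lift _) F)))
  own-ν {ρ = ρ} {c} (snd a) (own (snd (suc b)) {K} d refl) =
    own (snd b) (res d) (cong (snd (ρ b) ,_)
      (trans (νC-subC (triggers c) (renC (lift ρ) K)) (cong (subC (triggers c)) (νC-renC ρ K))))
  own-ν (rcv a) (own (rcv zero) d ())
  own-ν (snd a) (own (snd zero) d ())

  TrigStep : (ρ : ℕ → ℕ) (c : Fin n → ℕ) (T : Term n proc) (α : Act) → Res 0 α → Set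
  TrigStep ρ c T α R = OwnStep ρ c T α R ⊎ TrigCall ρ c T α R

  call-ν : ∀ {ρ} {c : Fin n → ℕ} a {K} → TrigCall (lift ρ) (suc ∘ c) T (snd (suc a)) K →
           TrigCall ρ c (ν T) (snd a) (νC K)
  call-ν {ρ = ρ} {c} _ (call j e G T′ {K} p q) = call j (suc e) G T′ (ν-cong p) λ E →
    ≋-trans (≡⇒≋ (plug-νC K E)) (≋-trans (ν-cong (q (renN suc E)))
      (≋-trans (≡⇒≋ (sym (plug-νC _ E)))
        (≡⇒≋ (cong₂ (λ X Y → plug (con (suc e) X Y) E) (eq G) (eq T′)))))
    where
    eq : (X : Term _ s) → trig (lift^ e (lift ρ)) ((e +_) ∘ (suc ∘ c)) X ≡
                          trig (lift^ (suc e) ρ) ((suc e +_) ∘ c) X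
    eq = trig-cong (lift^-lift e ρ) (λ j → +-suc e (c j))

  -- The names of the triggers avoid the image of `ρ`, so no prefix of `T` can receive from a
  -- trigger; and as `ρ` is injective, it creates no communication between prefixes of `T` either.
  trig-↦⁻ : ∀ {ρ} {c : Fin n → ℕ} → Inj ρ → (∀ a j → ρ a ≢ c j) →
    (T : Term n proc) {α : Act} {R : Res 0 α} → trig ρ c T ≡ U → U ↦⟨ i ∣ α ⟩ R → TrigStep ρ c T α R
  trig-↦⁻ inj ρ≢c (inp a T)   refl inp = inj₁ (own (rcv a) inp refl)
  trig-↦⁻ inj ρ≢c (out a A T) refl out = inj₁ (own (snd a) out
    (cong₂ (λ X Y → snd _ , con 0 X Y)
      (sub-cong {σ′ = renN (0 +_) ∘ triggers _} (λ _ → refl) (renN _ A))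
      (sub-cong {σ′ = renN (0 +_) ∘ triggers _} (λ _ → refl) (renN _ T))))
  trig-↦⁻ inj ρ≢c (T ∥ U) refl (parl d) with trig-↦⁻ inj ρ≢c T refl d
  ... | inj₁ o = inj₁ (own-par U o parl)
  ... | inj₂ c = inj₂ (call-par U c ≋-refl)
  trig-↦⁻ inj ρ≢c (T ∥ U) refl (parr d) with trig-↦⁻ inj ρ≢c U refl d
  ... | inj₁ o = inj₁ (own-par T o parr)
  ... | inj₂ c = inj₂ (call-par T c ∥-comm)
  trig-↦⁻ {ρ = ρ} {c} inj ρ≢c (T ∥ U) refl (coml d e)
    with trig-↦⁻ inj ρ≢c T refl d | trig-↦⁻ inj ρ≢c U refl e
  ... | inj₁ o | inj₁ o′ with own-rcv o | own-snd o′
  ...   | _ , F , _ , d₀ , p , refl | _ , K , _ , e₀ , q , refl with refl ← inj (trans (sym p) q) =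
    inj₁ (own τ (coml d₀ e₀) (cong (τ ,_) (plug-trig ρ c K F)))
  trig-↦⁻ inj ρ≢c (T ∥ U) refl (coml d e) | inj₁ o | inj₂ (call j _ _ _ _ _) with own-rcv o
  ... | _ , _ , _ , _ , p , _ = ⊥-elim (ρ≢c _ j (sym p))
  trig-↦⁻ {ρ = ρ} {c} inj ρ≢c (T ∥ U) refl (comr d e)
    with trig-↦⁻ inj ρ≢c T refl d | trig-↦⁻ inj ρ≢c U refl e
  ... | inj₁ o | inj₁ o′ with own-snd o | own-rcv o′
  ...   | _ , K , _ , d₀ , p , refl | _ , F , _ , e₀ , q , refl with refl ← inj (trans (sym p) q) =
    inj₁ (own τ (comr d₀ e₀) (cong (τ ,_) (plug-trig ρ c K F)))
  trig-↦⁻ inj ρ≢c (T ∥ U) refl (comr d e) | inj₂ (call j _ _ _ _ _) | inj₁ o with own-rcv o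
  ... | _ , _ , _ , _ , p , _ = ⊥-elim (ρ≢c _ j (sym p))
  trig-↦⁻ {ρ = ρ} {c} inj ρ≢c (ν T) refl (res {α = α} d) = under α
    (trig-↦⁻ (lift-injective inj) (λ { zero j () ; (suc a) j p → ρ≢c a j (suc-injective p) }) T refl d)
    where
    under : ∀ α {R} → TrigStep (lift ρ) (suc ∘ c) T (renA suc α) R → TrigStep ρ c (ν T) α (νR α R)
    under α       (inj₁ o) = inj₁ (own-ν α o)
    under τ       (inj₂ ())
    under (rcv a) (inj₂ ())
    under (snd a) (inj₂ k) = inj₂ (call-ν a k)
  trig-↦⁻ {ρ = ρ} {c} inj ρ≢c (ƛ T · A) refl (β d)
    with trig-↦⁻ inj ρ≢c (T [ A ])
           (trans (cong (sub (triggers c)) (renN-[] ρ T A)) (sub-[] (triggers c) (renN ρ T) (renN ρ A))) d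
  ... | inj₁ (own α d₀ p)        = inj₁ (own α (β d₀) p)
  ... | inj₂ (call j e G T′ p q) = inj₂ (call j e G T′ (≋-trans β p) q)
  trig-↦⁻ {ρ = ρ} {c} inj ρ≢c (var j · A) refl (β out) =
    inj₂ (call j 0 A 𝟎 (≋-sym ∥-identity) λ E → ≋-refl)

-- Configurations: names and frames

module _ where

  private variable
    n m i p q : ℕ
    s   : Kind
    I I′ : Set

  -- Names of the process tested by normal bisimilarity: those it shares with
  -- its environment, the name of the server of each object it has sent, and
  -- the name of the trigger passed in place of each object it has received.

  data Index (p q : ℕ) : Set where
    pub : ℕ → Index p q
    srv : Fin p → Index p q
    trg : Fin q → Index p q

  -- The public indices already are all natural numbers; `supply` ensures that, however many objects
  -- have been exchanged, `name` leaves room for another trigger or server.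
  record Names (I : Set) : Set where
    field
      name   : I → ℕ
      inj    : Injective _≡_ _≡_ name
      supply : ∀ N → ∃[ m ] N ≤ m × (∀ x → name x ≢ m)

  open Names

  Fresh : Names I → ℕ → Set
  Fresh nm m = ∀ x → name nm x ≢ m

  -- `h` and `g` exhibit `I′` as `I` with at most one more index, which receives the name `m`; the
  -- retraction is what carries injectivity over.
  extend : (nm : Names I) (h : I′ → Maybe I) (g : Maybe I → I′) → (∀ x → g (h x) ≡ x) →
           ∀ m → Fresh nm m → Names I′
  extend {I = I} nm h g gh m fr = record
    { name   = maybe (name nm) m ∘ h
    ; inj    = λ {x} {y} e → trans (sym (gh x)) (trans (cong g (inj′ (h x) (h y) e)) (gh y))
    ; supply = λ N → let (m′ , le , fr′) = supply nm (N ⊔ suc m) in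
        m′ , ≤-trans (m≤m⊔n N (suc m)) le ,
        λ x → fresh′ (h x) fr′ (≤-trans (m≤n⊔m N (suc m)) le)
    }
    where
    inj′ : (x y : Maybe I) → maybe (name nm) m x ≡ maybe (name nm) m y → x ≡ y
    inj′ (just x) (just y) e = cong just (inj nm e)
    inj′ (just x) nothing  e = ⊥-elim (fr x e)
    inj′ nothing  (just y) e = ⊥-elim (fr y (sym e))
    inj′ nothing  nothing  e = refl
    fresh′ : ∀ x {m′} → Fresh nm m′ → suc m ≤ m′ → maybe (name nm) m x ≢ m′
    fresh′ (just x) fr′ le = fr′ x
    fresh′ nothing  fr′ le refl = 1+n≰n le

  addSrv : (nm : Names (Index p q)) → ∀ m → Fresh nm m → Names (Index (suc p) q)
  addSrv {p} {q} nm = extend nm h g gh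
    where
    h : Index (suc p) q → Maybe (Index p q)
    h (pub a)       = just (pub a)
    h (srv zero)    = nothing
    h (srv (suc i)) = just (srv i)
    h (trg j)       = just (trg j)
    g : Maybe (Index p q) → Index (suc p) q
    g nothing        = srv zero
    g (just (pub a)) = pub a
    g (just (srv i)) = srv (suc i)
    g (just (trg j)) = trg j
    gh : ∀ x → g (h x) ≡ x
    gh (pub a)       = refl
    gh (srv zero)    = refl
    gh (srv (suc i)) = refl
    gh (trg j)       = refl

  addTrg : (nm : Names (Index p q)) → ∀ m → Fresh nm m → Names (Index p (suc q))
  addTrg {p} {q} nm = extend nm h g gh
    where
    h : Index p (suc q) → Maybe (Index p q)
    h (pub a)       = just (pub a)
    h (srv i)       = just (srv i)
    h (trg zero)    = nothing
    h (trg (suc j)) = just (trg j)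
    g : Maybe (Index p q) → Index p (suc q)
    g nothing        = trg zero
    g (just (pub a)) = pub a
    g (just (srv i)) = srv i
    g (just (trg j)) = trg (suc j)
    gh : ∀ x → g (h x) ≡ x
    gh (pub a)       = refl
    gh (srv i)       = refl
    gh (trg zero)    = refl
    gh (trg (suc j)) = refl

  addPub : (nm : Names (Index p q)) → ∀ m → Fresh nm m → Names (Index p q)
  addPub {p} {q} nm = extend nm h g gh
    where
    h : Index p q → Maybe (Index p q)
    h (pub zero)    = nothing
    h (pub (suc a)) = just (pub a)
    h (srv i)       = just (srv i)
    h (trg j)       = just (trg j)
    g : Maybe (Index p q) → Index p q
    g nothing        = pub zero
    g (just (pub a)) = pub (suc a)
    g (just (srv i)) = srv i
    g (just (trg j)) = trg j
    gh : ∀ x → g (h x) ≡ x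
    gh (pub zero)    = refl
    gh (pub (suc a)) = refl
    gh (srv i)       = refl
    gh (trg j)       = refl

  -- One side of a configuration.  The process under test has k private
  -- names; its objects A are known to the common code as the variables X, and
  -- the objects D of the common code are known to it as the variables Y.  The
  -- closed objects that these variables stand for are σ and δ.

  record Frame {p q : ℕ} (D : Fin q → Term p abs) : Set where
    field
      k   : ℕ
      A   : Fin p → Term q abs
      σ   : Sub p 0
      δ   : Sub q 0
      σ-≡ : ∀ i → σ i ≡ sub δ (A i)
      δ-≡ : ∀ j → δ j ≡ sub σ (renN (k +_) (D j))

  module _ {p q : ℕ} {D : Fin q → Term p abs} (fr : Frame D) where
    open Frame fr

    common : Term p s → Term 0 s
    common C = sub σ (renN (k +_) C)

    real : Term q proc → Term p proc → Proc
    real P C = ν^ k (common C ∥ sub δ P)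

    enc : Names (Index p q) → Term q s → Term 0 s
    enc nm = trig (lift^ k (name nm ∘ pub)) (λ j → k + name nm (trg j))

    servers : Names (Index p q) → (Fin p → Bool) → Proc
    servers nm st = cells st (λ i → k + name nm (srv i)) (λ i → enc nm (A i))

    normal : Names (Index p q) → (Fin p → Bool) → Term q proc → Proc
    normal nm st P = ν^ k (enc nm P ∥ servers nm st)

  +-assoc-≗ : ∀ k e → (e +_) ∘ (k +_) ≗ ((k + e) +_)
  +-assoc-≗ k e a = trans (sym (+-assoc e k a)) (cong (_+ a) (+-comm e k))

  lift^-comm : ∀ k e ρ → lift^ e (lift^ k ρ) ≗ lift^ (k + e) ρ
  lift^-comm k e ρ a = trans (lift^-+ e k ρ a) (cong (λ l → lift^ l ρ a) (+-comm e k))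

  module _ {p q : ℕ} {D : Fin q → Term p abs} (fr : Frame D) (e : ℕ) where
    open Frame fr

    -- Used when `e` restrictions at the top of the tested process, or names it has extruded, join
    -- the private names of the frame.
    shift : Frame D
    shift = record
      { k   = k + e
      ; A   = renN (e +_) ∘ A
      ; σ   = renN (e +_) ∘ σ
      ; δ   = renN (e +_) ∘ δ
      ; σ-≡ = λ i → trans (cong (renN (e +_)) (σ-≡ i)) (renN-sub (e +_) δ (A i))
      ; δ-≡ = λ j → trans (cong (renN (e +_)) (δ-≡ j))
          (trans (renN-sub (e +_) σ (renN (k +_) (D j)))
                 (cong (sub _) (renN-triangle (+-assoc-≗ k e) (D j))))
      }

    common-shift : (C : Term p s) → common shift C ≡ renN (e +_) (common fr C)
    common-shift C = sym (trans (renN-sub (e +_) σ (renN (k +_) C))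
                                (cong (sub _) (renN-triangle (+-assoc-≗ k e) C)))

    ν^-shift : ∀ C Z → ν^ k (common fr C ∥ ν^ e Z) ≡ₛ ν^ (k + e) (common shift C ∥ Z)
    ν^-shift C Z =
      ν^-≡ₛ k (reverse* (ν^-extrudeˡ e Z (common fr C)) ◅◅
               ν^-≡ₛ e (∥-cong* (≡⇒≡ₛ (sym (common-shift C))) ε)) ◅◅
      ≡⇒≡ₛ (sym (ν^-+ k e _))

    real-shift : ∀ P C → real fr (ν^ e P) C ≡ₛ real shift P C
    real-shift P C = ν^-≡ₛ k (∥-cong* ε (≡⇒≡ₛ (sub-ν^ e δ P))) ◅◅ ν^-shift C _

    enc-level : ∀ nm (T : Term q s) →
      trig (lift^ e (lift^ k (name nm ∘ pub))) (λ j → e + (k + name nm (trg j))) T ≡ enc shift nm T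
    enc-level nm T = trig-cong (lift^-comm k e _) (λ j → +-assoc-≗ k e _) T

    enc-shift : ∀ nm (T : Term q s) → enc shift nm (renN (e +_) T) ≡ renN (e +_) (enc fr nm T)
    enc-shift nm T = trans (sym (enc-level nm (renN (e +_) T))) (trig-shift e _ _ T)

    servers-shift : ∀ nm st → servers shift nm st ≡ renN (e +_) (servers fr nm st)
    servers-shift nm st = sym (trans (cells-renN (e +_) st _ _)
      (cells-cong st (λ i → +-assoc-≗ k e _) (λ i → sym (enc-shift nm (A i)))))

    normal-shift : ∀ nm st P → normal fr nm st (ν^ e P) ≡ₛ normal shift nm st P
    normal-shift nm st P =
      ν^-≡ₛ k (∥-cong* (≡⇒≡ₛ (trans (cong (sub (triggers _)) (renN-ν^ e _ P))
                              (trans (sub-ν^ e (triggers _) _) (cong (ν^ e) (enc-level nm P))))) ε ◅◅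
               reverse* (ν^-extrude e _ _) ◅◅
               ν^-≡ₛ e (∥-cong* ε (≡⇒≡ₛ (sym (servers-shift nm st))))) ◅◅
      ≡⇒≡ₛ (sym (ν^-+ k e _))

  module _ {p q : ℕ} {D : Fin q → Term p abs} (fr : Frame D) where
    open Frame fr

    addX : (F : Term q abs) → Frame (wk ∘ D)
    addX F = record
      { k   = k
      ; A   = F ◂ A
      ; σ   = sub δ F ◂ σ
      ; δ   = δ
      ; σ-≡ = λ { zero → refl ; (suc i) → σ-≡ i }
      ; δ-≡ = λ j → trans (δ-≡ j) (sym (trans (cong (sub _) (renN-renV (k +_) suc (D j)))
                                              (sub-◂-wk _ σ (renN (k +_) (D j)))))
      }

    addY : (d : Term p abs) → Frame (d ◂ D)
    addY d = record
      { k   = k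
      ; A   = wk ∘ A
      ; σ   = σ
      ; δ   = common fr d ◂ δ
      ; σ-≡ = λ i → trans (σ-≡ i) (sym (sub-◂-wk _ δ (A i)))
      ; δ-≡ = λ { zero → refl ; (suc j) → δ-≡ j }
      }

    -- The counterpart of `shift` for the common code: its `e` restrictions become public names
    -- outside the `k` private ones, and the terms of the frame are renamed past them.
    up : (e : ℕ) → Frame (renN (e +_) ∘ D)
    up e = record
      { k   = k
      ; A   = renN (lift^ k (e +_)) ∘ A
      ; σ   = renN (lift^ k (e +_)) ∘ σ
      ; δ   = renN (lift^ k (e +_)) ∘ δ
      ; σ-≡ = λ i → trans (cong (renN _) (σ-≡ i)) (renN-sub _ δ (A i))
      ; δ-≡ = λ j → trans (cong (renN _) (δ-≡ j))
          (trans (renN-sub _ σ (renN (k +_) (D j)))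
                 (cong (sub _) (renN-square (lift^-shift k (e +_)) (D j))))
      }

    common-addX : ∀ F (C : Term p s) → common (addX F) (wk C) ≡ common fr C
    common-addX F C = trans (cong (sub _) (renN-renV (k +_) suc C)) (sub-◂-wk _ σ (renN (k +_) C))

    enc-addTrg : ∀ d {nm m fs} (T : Term q s) →
                 enc (addY d) (addTrg nm m fs) (wk T) ≡ enc fr nm T
    enc-addTrg d {nm} {m} T =
      trans (cong (sub _) (renN-renV (lift^ k (name nm ∘ pub)) suc T))
            (sub-renV (triggers _) suc (renN (lift^ k (name nm ∘ pub)) T))

  record UpNames (nm : Names (Index p q)) (e : ℕ) : Set where
    field
      nm′    : Names (Index p q)
      on-pub : ∀ a → name nm′ (pub (e + a)) ≡ name nm (pub a)
      on-srv : ∀ i → name nm′ (srv i) ≡ name nm (srv i)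
      on-trg : ∀ j → name nm′ (trg j) ≡ name nm (trg j)

  upNames : (nm : Names (Index p q)) (e : ℕ) → UpNames nm e
  upNames nm zero = record
    { nm′ = nm ; on-pub = λ _ → refl ; on-srv = λ _ → refl ; on-trg = λ _ → refl }
  upNames nm (suc e) with supply (UpNames.nm′ (upNames nm e)) 0
  ... | m , _ , fs = record
    { nm′ = addPub nm′ m fs ; on-pub = on-pub ; on-srv = on-srv ; on-trg = on-trg }
    where open UpNames (upNames nm e)

  module _ {p q : ℕ} {D : Fin q → Term p abs} (fr : Frame D) (e : ℕ) where
    open Frame fr
    open BlockSwap (blockSwap k e)

    θ-common : (C : Term p s) →
      renN θ (sub (renN (e +_) ∘ σ) (renN (lift^ e (k +_)) C)) ≡ common (up fr e) C
    θ-common C = trans (renN-sub θ _ (renN (lift^ e (k +_)) C))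
      (trans (sub-cong (λ i → renN-triangle {ρ₁ = θ} {e +_} θ-inner (σ i)) (renN θ (renN (lift^ e (k +_)) C)))
             (cong (sub _) (renN-triangle θ-outer C)))

    θ-σ : ∀ i → renN θ (renN (e +_) (σ i)) ≡ Frame.σ (up fr e) i
    θ-σ i = renN-triangle θ-inner (σ i)

    θ-shift : (T : Term n s) → renN θ (renN (e +_) T) ≡ renN (lift^ k (e +_)) T
    θ-shift T = renN-triangle θ-inner T

    up-sub : (P : Term q s) →
      renN (lift^ k (e +_)) (sub δ P) ≡ sub (Frame.δ (up fr e)) (renN (lift^ k (e +_)) P)
    up-sub P = renN-sub _ δ P

    ν^-up : ∀ Z P → ν^ k (ν^ e Z ∥ sub δ P) ≡ₛ
                    ν^ e (ν^ k (renN θ Z ∥ sub (Frame.δ (up fr e)) (renN (lift^ k (e +_)) P)))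
    ν^-up Z P = ν^-≡ₛ k (reverse* (ν^-extrude e Z (sub δ P))) ◅◅ ν^-ν^ _ ◅◅
      ν^-≡ₛ e (ν^-≡ₛ k (∥-cong* ε (≡⇒≡ₛ (trans (θ-shift (sub δ P)) (up-sub P)))))

    common-ν^ : ∀ C → common fr (ν^ e C) ≡ ν^ e (sub (renN (e +_) ∘ σ) (renN (lift^ e (k +_)) C))
    common-ν^ C = trans (cong (sub σ) (renN-ν^ e (k +_) C)) (sub-ν^ e σ _)

    real-up : ∀ P C → real fr P (ν^ e C) ≡ₛ ν^ e (real (up fr e) (renN (lift^ k (e +_)) P) C)
    real-up P C =
      ν^-≡ₛ k (≡⇒≡ₛ (cong (_∥ sub δ P) (common-ν^ C))) ◅◅ ν^-up _ P ◅◅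
      ν^-≡ₛ e (ν^-≡ₛ k (≡⇒≡ₛ (cong (_∥ _) (θ-common C))))

    module _ {nm : Names (Index p q)} (u : UpNames nm e) where
      open UpNames u

      enc-up : (T : Term q s) → enc (up fr e) nm′ (renN (lift^ k (e +_)) T) ≡ enc fr nm T
      enc-up T = trans (cong (sub (triggers _)) (renN-triangle
          (λ a → trans (lift^-∘ k _ _ a) (lift^-cong k on-pub a)) T))
        (sub-cong (λ j → cong (Tr ∘ (k +_)) (on-trg j)) (renN (lift^ k (name nm ∘ pub)) T))

      -- The tested process cannot mention names just opened in the common code, so opening them
      -- does not change the test at all.
      normal-up : ∀ st P → normal (up fr e) nm′ st (renN (lift^ k (e +_)) P) ≡ normal fr nm st P
      normal-up st P = cong (ν^ k) (cong₂ _∥_ (enc-up P)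
        (cells-cong st (cong (k +_) ∘ on-srv) (λ i → enc-up (A i))))

  lift^-shift⁻ : ∀ k {ρ} x {b} → lift^ k ρ x ≡ k + b → ∃[ y ] x ≡ k + y × ρ y ≡ b
  lift^-shift⁻ zero    x       e = x , refl , e
  lift^-shift⁻ (suc k) (suc x) e with lift^-shift⁻ k x (suc-injective e)
  ... | y , p , q = y , cong suc p , q

  lift^-injective : ∀ k {ρ} → Inj ρ → Inj (lift^ k ρ)
  lift^-injective zero    inj = inj
  lift^-injective (suc k) inj = lift-injective (lift^-injective k inj)

  ν^-[] : ∀ k (T : Term (suc n) proc) A → ν^ k T [ A ] ≡ ν^ k (T [ renN (k +_) A ])
  ν^-[] k T A = trans (sub-ν^ k (single A) T)
    (cong (ν^ k) (sub-cong (λ { zero → refl ; (suc x) → refl }) T))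

  cells-rcv : ∀ {μ : Fin p → ℕ} {A a F} → CellsStep μ A (rcv a) F →
              ∃₂ λ i st → a ≡ μ i × F ≋ wk (cells st μ A) ∥ (wk (A i) · var zero)
  cells-rcv (fire st i e) = i , st , refl , e

  call-snd : ∀ {ρ} {c : Fin n → ℕ} {T a K} → TrigCall ρ c T (snd a) K →
    ∃[ j ] ∃[ e ] ∃[ G ] ∃[ T′ ] (a ≡ c j × T ≋ ν^ e (var j · G ∥ T′) ×
      (∀ E → plug K E ≋ plug (con e (trig (lift^ e ρ) ((e +_) ∘ c) G)
                                    (trig (lift^ e ρ) ((e +_) ∘ c) T′)) E))
  call-snd (call j e G T′ p q) = j , e , G , T′ , refl , p , q

  module _ {p q : ℕ} {D : Fin q → Term p abs} (fr : Frame D) (nm : Names (Index p q)) where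
    open Frame fr

    -- The object `d` really received is arbitrary: the test receives a trigger instead, and `d` is
    -- only recorded in the frame.
    AfterInput : Term 1 proc → (Fin p → Bool) → Term (suc q) proc → Set
    AfterInput F st P = ∀ n (fs : Fresh nm n) d → F [ Tr n ] ≋ normal (addY fr d) (addTrg nm n fs) st P

    AfterOutput : Con 0 → ℕ → Term q abs → (Fin p → Bool) → Term q proc → Set
    AfterOutput K e G st P = ∀ m (fs : Fresh nm m) →
      plug K (ask m) ≋ normal (addX (shift fr e) G) (addSrv nm m fs) (false ◂ st) P

    servers-[] : ∀ st n (fs : Fresh nm n) d A₀ →
      wk (servers fr nm st) [ A₀ ] ≡ servers (addY fr d) (addTrg nm n fs) st
    servers-[] st n fs d A₀ = trans (wk-[] _ A₀)
      (cells-cong st (λ _ → refl) (λ i → sym (enc-addTrg fr d {nm} {n} {fs} (A i))))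

    after-input : ∀ st (F : Term (suc q) proc) →
      AfterInput (ν^ k (sub (exts (triggers λ j → k + name nm (trg j))) (renN (lift^ k (name nm ∘ pub)) F)
                        ∥ wk (servers fr nm st))) st F
    after-input st F n fs d = ≡⇒≋ (trans (ν^-[] k _ (Tr n)) (cong (ν^ k) (cong₂ _∥_
      (trans (exts-[] (triggers λ j → k + name nm (trg j)) (renN (lift^ k (name nm ∘ pub)) F) (Tr (k + n)))
             (sub-cong (λ { zero → refl ; (suc j) → refl }) (renN (lift^ k (name nm ∘ pub)) F)))
      (servers-[] st n fs d _))))

    -- The request fires server `i`; the application of its object to the new variable is from then
    -- on part of the tested process.
    after-fire : ∀ st i P {F} → F ≋ wk (servers fr nm st) ∥ (wk (enc fr nm (A i)) · var zero) →
      AfterInput (ν^ k (F ∥ wk (enc fr nm P))) st (wk P ∥ (wk (A i) · var zero))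
    after-fire st i P {F} e n fs d =
      ≋-trans (≡⇒≋ (ν^-[] k _ (Tr n))) (ν^-≋ k
        (≋-trans (∥-cong (≋-trans ([]-≋ e ≋-refl)
            (∥-cong (≡⇒≋ (servers-[] st n fs d (Tr (k + n))))
                    (≡⇒≋ (cong (_· Tr (k + n)) (wk-enc (A i))))))
          (≡⇒≋ (wk-enc P)))
        (≋-trans ∥-comm (≋-trans (∥-cong ≋-refl ∥-comm) (≋-sym ∥-assoc)))))
      where
      wk-enc : (T : Term q s) → wk (enc fr nm T) [ Tr (k + n) ] ≡ enc (addY fr d) (addTrg nm n fs) (wk T)
      wk-enc T = trans (wk-[] _ _) (sym (enc-addTrg fr d {nm} {n} {fs} T))

    normal-input : ∀ st {P a F} → P ↦⟨ i ∣ rcv (k + a) ⟩ F →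
      ∃[ F′ ] normal fr nm st P ↦⟨ i ∣ rcv (name nm (pub a)) ⟩ F′ × AfterInput F′ st F
    normal-input st {a = a} {F} d = _ ,
      ν^-rcv k (castRcv (lift^-shift k _ a) (parl (trig-↦ _ _ d))) , after-input st F

    normal-fire : ∀ st P i → ∃[ st₁ ] ∃[ F ] ∃[ st₂ ]
      (normal fr nm st P ⟹ normal fr nm st₁ P ×
       normal fr nm st₁ P ↦⟨ 0 ∣ rcv (name nm (srv i)) ⟩ F ×
       AfterInput F st₂ (wk P ∥ (wk (A i) · var zero)))
    normal-fire st P i = st₁ , _ , st₂ , ν^-⟹ k (∥-⟹ʳ _ ready) ,
      ν^-rcv k (parr step) , after-fire st₂ i P result
      where open CellsFire (cells-fire st (λ i → k + name nm (srv i)) (λ i → enc fr nm (A i)) i)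

    pub≢ : ∀ x → (∀ a → pub a ≢ x) → ∀ a → lift^ k (name nm ∘ pub) a ≢ k + name nm x
    pub≢ x pub≢x a e with lift^-shift⁻ k a e
    ... | b , _ , e′ = pub≢x b (inj nm e′)

    enc-↦⁻ : ∀ P {α R} → enc fr nm P ↦⟨ i ∣ α ⟩ R →
      TrigStep (lift^ k (name nm ∘ pub)) (λ j → k + name nm (trg j)) P α R
    enc-↦⁻ P = trig-↦⁻ (lift^-injective k λ e → pub-injective (inj nm e))
                        (λ a j → pub≢ (trg j) (λ _ ()) a) P refl
      where
      pub-injective : ∀ {a b} → _≡_ {A = Index p q} (pub a) (pub b) → a ≡ b
      pub-injective refl = refl

    normal-input⁻ : ∀ st P {b F} → normal fr nm st P ↦⟨ i ∣ rcv b ⟩ F →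
      (∃[ a ] ∃[ F₀ ] ∃[ j ] (b ≡ name nm (pub a) × P ↦⟨ j ∣ rcv (k + a) ⟩ F₀ × AfterInput F st F₀)) ⊎
      (∃[ x ] ∃[ st′ ] (b ≡ name nm (srv x) × AfterInput F st′ (wk P ∥ (wk (A x) · var zero))))
    normal-input⁻ st P d with ν^-rcv⁻ k d
    normal-input⁻ st P d | _ , parl d₀ , refl with enc-↦⁻ P d₀
    ... | inj₁ o with own-rcv o
    ...   | a₀ , F₀ , j , d₁ , e , refl with lift^-shift⁻ k a₀ (sym e)
    ...     | a , refl , refl = inj₁ (a , F₀ , j , refl , d₁ , after-input st F₀)
    normal-input⁻ st P d | _ , parr d₀ , refl with cells-rcv (cells-inv st d₀)
    ... | x , st′ , e , f with refl ← +-cancelˡ-≡ k _ _ e = inj₂ (x , st′ , refl , after-fire st′ x P f)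

    plug-server : ∀ {p′ q′} {D′ : Fin q′ → Term p′ abs} (fr′ : Frame D′) m Ĝ X →
      plug (con (Frame.k fr′) Ĝ X) (ask m) ≋
      ν^ (Frame.k fr′) (X ∥ cell false (Frame.k fr′ + m) Ĝ)
    plug-server fr′ m Ĝ X = ν^-≋ (Frame.k fr′)
      (≋-trans (∥-cong (≡⇒≋ (ask-context (Frame.k fr′) m Ĝ)) ≋-refl) ∥-comm)

    after-output : ∀ e st G P →
      AfterOutput (con (k + e) (enc (shift fr e) nm G) (enc (shift fr e) nm P ∥ renN (e +_) (servers fr nm st)))
                  e G st P
    after-output e st G P m fs = ≋-trans (plug-server (shift fr e) m _ _) (ν^-≋ (k + e)
      (≋-trans ∥-assoc (∥-cong ≋-refl (≋-trans ∥-comm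
        (∥-cong ≋-refl (≡⇒≋ (sym (servers-shift fr e nm st))))))))

    con-≡ : ∀ {l A B X Y} → A ≡ B → X ≡ Y → _≡_ {A = Con 0} (con l A X) (con l B Y)
    con-≡ refl refl = refl

    private
      ρ : ℕ → ℕ
      ρ = lift^ k (name nm ∘ pub)
      c : Fin q → ℕ
      c j = k + name nm (trg j)

    after-own : ∀ e G P′ st →
      AfterOutput (con (k + e) (trig (lift^ e ρ) ((e +_) ∘ c) G)
                               (trig (lift^ e ρ) ((e +_) ∘ c) P′ ∥ renN (e +_) (servers fr nm st))) e G st P′
    after-own e G P′ st m fs = ≋-trans
      (≡⇒≋ (cong (λ K → plug K (ask m))
        (con-≡ (enc-level fr e nm G) (cong (_∥ _) (enc-level fr e nm P′)))))
      (after-output e st G P′ m fs)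

    plug-ν^ : ∀ e A X (E : Term 1 proc) → plug (con (k + e) A X) E ≡ ν^ k (plug (con e A X) (renN (k +_) E))
    plug-ν^ e A X E = trans (ν^-+ k e _)
      (cong (λ F → ν^ k (ν^ e (F [ A ] ∥ X))) (sym (renN-triangle (+-assoc-≗ k e) E)))

    par-ν^ : ∀ K L → (∀ E → plug K E ≋ plug L E) → ∀ U E →
      plug (con (k + Con.size K) (Con.obj K) (Con.cont K ∥ renN (Con.size K +_) U)) E ≋
      plug (con (k + Con.size L) (Con.obj L) (Con.cont L ∥ renN (Con.size L +_) U)) E
    par-ν^ K L r U E = ≋-trans (≡⇒≋ (plug-ν^ _ _ _ E))
      (≋-trans (ν^-≋ k (parR-cong (snd 0) {K} {L} r (≋-refl {T = U}) (renN (k +_) E)))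
               (≡⇒≋ (sym (plug-ν^ _ _ _ E))))

    normal-output : ∀ st {P a e G P′} → P ↦⟨ i ∣ snd (k + a) ⟩ con e G P′ →
      ∃[ K ] normal fr nm st P ↦⟨ i ∣ snd (name nm (pub a)) ⟩ K × AfterOutput K e G st P′
    normal-output st {a = a} {e} {G} {P′} d = _ ,
      ν^-snd k (castSnd (lift^-shift k _ a) (parl (trig-↦ ρ c d))) , after-own e G P′ st

    normal-call : ∀ st j F P → ∃[ K ]
      normal fr nm st (var j · F ∥ P) ↦⟨ 1 ∣ snd (name nm (trg j)) ⟩ K ×
      (∀ m (fs : Fresh nm m) →
        plug K (ask m) ≋ normal (addX fr F) (addSrv nm m fs) (false ◂ st) P)
    normal-call st j F P = _ , ν^-snd k (parl (parl (β out))) , λ m fs → ≋-trans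
      (≡⇒≋ (cong (λ l → plug (con l (enc fr nm F) ((𝟎 ∥ renN (0 +_) (enc fr nm P)) ∥ renN (0 +_) (servers fr nm st)))
                              (ask m)) (+-identityʳ k)))
      (≋-trans (plug-server fr m _ _) (ν^-≋ k
        (≋-trans (∥-cong (∥-cong (≋-trans ∥-comm (≋-trans ∥-identity (≡⇒≋ (renN-0+ _))))
                                 (≡⇒≋ (renN-0+ _))) ≋-refl)
          (≋-trans ∥-assoc (∥-cong ≋-refl ∥-comm)))))

    normal-output⁻ : ∀ st P {b K} → normal fr nm st P ↦⟨ i ∣ snd b ⟩ K →
      (∃[ a ] ∃[ e ] ∃[ G ] ∃[ P′ ] ∃[ j ] (b ≡ name nm (pub a) ×
        P ↦⟨ j ∣ snd (k + a) ⟩ con e G P′ × AfterOutput K e G st P′)) ⊎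
      (∃[ j ] ∃[ e ] ∃[ G ] ∃[ P′ ] (b ≡ name nm (trg j) ×
        P ≋ ν^ e (var j · G ∥ P′) × AfterOutput K e G st P′))
    normal-output⁻ st P d with ν^-snd⁻ k d
    normal-output⁻ st P d | _ , _ , _ , parl {R = K₁} d₀ , refl with enc-↦⁻ P d₀
    ... | inj₁ o with own-snd o
    ...   | a₀ , con e G P′ , j , d₁ , p , refl with lift^-shift⁻ k a₀ (sym p)
    ...     | a , refl , refl = inj₁ (a , e , G , P′ , j , refl , d₁ , after-own e G P′ st)
    normal-output⁻ st P d | _ , _ , _ , parl {R = K₁} d₀ , refl | inj₂ h with call-snd h
    ... | j , e , G , P′ , p , q , r with refl ← +-cancelˡ-≡ k _ _ p =
      inj₂ (j , e , G , P′ , refl , q , λ m fs → ≋-trans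
        (par-ν^ K₁ (con e _ _) r (servers fr nm st) (ask m))
        (after-own e G P′ st m fs))
    normal-output⁻ st P d | _ , _ , _ , parr d₀ , refl with cells-inv st d₀
    ... | ()

    -- Servers do not send, and their names are neither public nor names of triggers, so the tested
    -- process and its servers cannot communicate. A silent step is one of `P`, which the real
    -- process repeats, or the arming of a server, which it ignores.
    normal-τ⁻ : ∀ st P {R} → normal fr nm st P ↦⟨ i ∣ τ ⟩ R →
      ∃₂ λ st′ P′ → R ≋ normal fr nm st′ P′ × sub δ P ⟹ sub δ P′
    normal-τ⁻ st P d with ν^-τ⁻ k d
    normal-τ⁻ st P d | _ , parl d₀ , refl with enc-↦⁻ P d₀
    ... | inj₁ o with own-τ o
    ...   | P′ , _ , d₁ , refl = st , P′ , ≋-refl , tau⇒⟹ (sub-↦ δ d₁)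
    normal-τ⁻ st P d | _ , parr d₀ , refl with cells-inv st d₀
    ... | arm st′ e = st′ , P , ν^-≋ k (≋-trans ∥-comm (∥-cong ≋-refl e)) , ε
    normal-τ⁻ st P d | _ , coml d₀ e₀ , refl with cells-inv st e₀
    ... | ()
    normal-τ⁻ st P d | _ , comr d₀ e₀ , refl with enc-↦⁻ P d₀ | cells-rcv (cells-inv st e₀)
    ... | inj₁ o | x , _ , e , _ with own-snd o
    ...   | a , _ , _ , _ , e′ , _ = ⊥-elim (pub≢ (srv x) (λ _ ()) a (trans (sym e′) e))
    normal-τ⁻ st P d | _ , comr d₀ e₀ , refl | inj₂ h | x , _ , e , _ with call-snd h
    ... | j , _ , _ , _ , e′ , _ = ⊥-elim (trg≢srv (inj nm (+-cancelˡ-≡ k _ _ (trans (sym e′) e))))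
      where
      trg≢srv : ∀ {j : Fin q} {x : Fin p} → trg j ≢ srv x
      trg≢srv ()

-- Configurations: residuals

module _ where

  private variable
    n i p q : ℕ
    s   : Kind

  open Names using (name; inj; supply)

  weaken : Term 0 s → Term p s
  weaken = renV (λ ())

  weaken₁ : Term 1 s → Term (suc p) s
  weaken₁ = renV (ext λ ())

  -- Recovers the sender from its transition, with the extruded names at the front.
  -- `match-com-input` uses this to make them public before the tested process receives the object.
  snd-shape : ∀ {T : Term n proc} {a e A X} → T ↦⟨ i ∣ snd a ⟩ con e A X →
    ∃₂ λ Y Z → T ≋ ν^ e (out (e + a) A Y ∥ Z) × Y ∥ Z ≋ X
  snd-shape (out {T = T}) = T , 𝟎 , ≋-sym ∥-identity , ∥-identity
  snd-shape (parl {U = U} {R = con e A X} d) with snd-shape d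
  ... | Y , Z , f , g = Y , Z ∥ renN (e +_) U ,
    ≋-trans (∥-cong f ≋-refl) (∼*⇒≋ (reverse* (ν^-≡ₛ e (reverse* (∥-assoc-≡ₛ _ _ _)) ◅◅ ν^-extrude e _ U))) ,
    ≋-trans (≋-sym ∥-assoc) (∥-cong g ≋-refl)
  snd-shape (parr {T = T} {R = con e A X} d) with snd-shape d
  ... | Y , Z , f , g = Y , Z ∥ renN (e +_) T ,
    ≋-trans ∥-comm (≋-trans (∥-cong f ≋-refl)
      (∼*⇒≋ (reverse* (ν^-≡ₛ e (reverse* (∥-assoc-≡ₛ _ _ _)) ◅◅ ν^-extrude e _ T)))) ,
    ≋-trans (≋-sym ∥-assoc) (∥-cong g ≋-refl)
  snd-shape (res {α = snd a} {R = con e A X} d) with snd-shape d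
  ... | Y , Z , f , g = Y , Z ,
    ν-cong (≋-trans f (≡⇒≋ (cong (λ b → ν^ e (out b A Y ∥ Z)) (+-suc e a)))) , g
  snd-shape (β d) with snd-shape d
  ... | Y , Z , f , g = Y , Z , ≋-trans β f , g

  closed-ƛ : (A : Abs) → ∃[ T ] A ≡ ƛ T
  closed-ƛ (ƛ T) = T , refl

  module _ {p q : ℕ} {D : Fin q → Term p abs} (fr : Frame D) where
    open Frame fr

    common-weaken : (A : Term 0 s) → common fr (weaken A) ≡ renN (k +_) A
    common-weaken A = trans (cong (sub σ) (renN-renV (k +_) (λ ()) A))
      (trans (sub-renV σ (λ ()) (renN (k +_) A)) (sub-var (λ ()) (renN (k +_) A)))

    common-[] : ∀ (F : Term (suc p) s) A →
                common fr (F [ A ]) ≡ sub (exts σ) (renN (k +_) F) [ common fr A ]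
    common-[] F A = trans (cong (sub σ) (renN-[] (k +_) F A)) (sub-[] σ (renN (k +_) F) (renN (k +_) A))

    real-≋ : ∀ {P P′ C C′} → P ≋ P′ → C ≋ C′ → real fr P C ≋ real fr P′ C′
    real-≋ e f = ν^-≋ k (∥-cong (sub-≋ σ (renN-≋ (k +_) f)) (sub-≋ δ e))

    real-⟹ : ∀ {P P′} C → sub δ P ⟹ sub δ P′ → real fr P C ⟹ real fr P′ C
    real-⟹ C w = ν^-⟹ k (∥-⟹ʳ _ w)

    normal-≋ : ∀ nm st {P P′} → P ≋ P′ → normal fr nm st P ≋ normal fr nm st P′
    normal-≋ nm st e = ν^-≋ k (∥-cong (sub-≋ _ (renN-≋ _ e)) ≋-refl)

    real-common-input : ∀ P (F : Term (suc p) proc) A →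
      ν^ k (sub (exts σ) (renN (k +_) F) ∥ wk (sub δ P)) [ A ] ≡ real fr P (F [ weaken A ])
    real-common-input P F A = trans (ν^-[] k _ A) (cong (ν^ k) (cong₂ _∥_
      (trans (cong (sub (exts σ) (renN (k +_) F) [_]) (sym (common-weaken A))) (sym (common-[] F (weaken A))))
      (wk-[] _ _)))

    real-input : ∀ C (F : Term (suc q) proc) A →
      ν^ k (sub (exts δ) F ∥ wk (common fr C)) [ A ] ≋ real (addY fr (weaken A)) F C
    real-input C F A = ≋-trans (≡⇒≋ (ν^-[] k _ A)) (ν^-≋ k (≋-trans ∥-comm (∥-cong
      (≡⇒≋ (wk-[] _ _))
      (≡⇒≋ (trans (exts-[] δ F _) (cong (λ B → sub (B ◂ δ) F) (sym (common-weaken A))))))))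

    real-common-output : ∀ P e (G : Term p abs) C E →
      plug (con (k + e) (sub (renN (e +_) ∘ σ) (renN (lift^ e (k +_)) G))
                        (sub (renN (e +_) ∘ σ) (renN (lift^ e (k +_)) C) ∥ renN (e +_) (sub δ P))) E ≋
      real fr P (ν^ e (renN (e +_) (weaken₁ E) [ G ] ∥ C))
    real-common-output P e G C E = ≋-sym (≋-trans
      (≡⇒≋ (cong (λ X → ν^ k (X ∥ sub δ P)) (common-ν^ fr e _)))
      (≋-trans (ν^-≋ k (≋-sym (∼*⇒≋ (ν^-extrude e _ (sub δ P)))))
        (≋-trans (ν^-≋ k (ν^-≋ e ∥-assoc))
          (≡⇒≋ (trans (sym (ν^-+ k e _)) (cong (λ X → ν^ (k + e) (X ∥ _)) eq))))))
      where
      σ′ = renN (e +_) ∘ σ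
      eq : sub σ′ (renN (lift^ e (k +_)) (renN (e +_) (weaken₁ E) [ G ])) ≡
           renN ((k + e) +_) E [ sub σ′ (renN (lift^ e (k +_)) G) ]
      eq = trans (cong (sub σ′) (renN-[] (lift^ e (k +_)) (renN (e +_) (weaken₁ E)) G))
        (trans (sub-[] σ′ (renN (lift^ e (k +_)) (renN (e +_) (weaken₁ E))) _)
          (cong (_[ sub σ′ (renN (lift^ e (k +_)) G) ]) (trans (cong (sub (exts σ′))
            (trans (renN-triangle (λ a → trans (lift^-shift e (k +_) a) (+-assoc-≗ k e a)) (weaken₁ E))
                   (renN-renV ((k + e) +_) (ext λ ()) E)))
            (trans (sub-renV (exts σ′) (ext λ ()) (renN ((k + e) +_) E))
                   (sub-var (λ { zero → refl }) (renN ((k + e) +_) E))))))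

    common-weaken₁ : ∀ F (E : Term 1 proc) → common (addX fr F) (weaken₁ E) ≡ renN (k +_) E [ sub δ F ]
    common-weaken₁ F E = trans (cong (sub _) (renN-renV (k +_) (ext λ ()) E))
      (trans (sub-renV _ (ext λ ()) (renN (k +_) E)) (sub-cong (λ { zero → refl }) (renN (k +_) E)))

  module _ {p q : ℕ} {D : Fin q → Term p abs} (fr : Frame D) where
    open Frame fr

    real-output : ∀ C e G P E →
      plug (con (k + e) (sub (renN (e +_) ∘ δ) G) (sub (renN (e +_) ∘ δ) P ∥ renN (e +_) (common fr C))) E ≋
      real (addX (shift fr e) G) P (weaken₁ E ∥ wk C)
    real-output C e G P E = ν^-≋ (k + e) (≋-trans
      (∥-cong (≡⇒≋ (sym (common-weaken₁ (shift fr e) G E)))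
              (≋-trans ∥-comm (∥-cong (≡⇒≋ (sym (trans (common-addX (shift fr e) G C) (common-shift fr e C)))) ≋-refl)))
      (≋-sym ∥-assoc))

    real-com-output : ∀ e G P (E : Term (suc p) proc) →
      ν^ k (plug (subC δ (con e G P)) (sub (exts σ) (renN (k +_) E))) ≡ real (addX (shift fr e) G) P E
    real-com-output e G P E = trans (sym (ν^-+ k e _)) (cong (λ X → ν^ (k + e) (X ∥ _)) (trans
      (cong (_[ _ ]) (sym (sub-exts-shift e σ (renN (k +_) E))))
      (trans (exts-[] (renN (e +_) ∘ σ) (renN (e +_) (renN (k +_) E)) _)
             (cong (sub _) (renN-triangle (+-assoc-≗ k e) E)))))

    -- The names extruded by the common code lie inside the private names of the frame on the left
    -- and outside them on the right, where they are public; the block swap exchanges the two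
    -- groups.
    real-com-input : ∀ e (G : Term p abs) C (F : Term (suc q) proc) →
      ν^ k (plug (subC σ (renC (k +_) (con e G C))) (sub (exts δ) F)) ≋
      ν^ e (real (addY (up fr e) G) (renN (lift^ k (e +_)) F) C)
    real-com-input e G C F = ≋-trans (∼*⇒≋ (ν^-ν^ _)) (ν^-≋ e (ν^-≋ k (≋-trans
      (∥-cong (≡⇒≋ (trans (renN-[] θ (renN (e +_) (sub (exts δ) F)) _)
          (trans (cong₂ _[_]
              (trans (θ-shift fr e (sub (exts δ) F))
                (trans (renN-sub (lift^ k (e +_)) (exts δ) F)
                       (sub-cong (exts-renN (lift^ k (e +_)) δ) (renN (lift^ k (e +_)) F))))
              (θ-common fr e G))
            (exts-[] _ (renN (lift^ k (e +_)) F) _))))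
        (≡⇒≋ (θ-common fr e C)))
      ∥-comm)))
      where open BlockSwap (blockSwap k e)

    common-τ⁻ : ∀ C {R} → i ≡ 0 → common fr C ↦⟨ i ∣ τ ⟩ R →
      ∃[ C′ ] C ↦⟨ i ∣ τ ⟩ C′ × R ≡ common fr C′
    common-τ⁻ C z d with sub-↦⁻ σ (renN (k +_) C) z refl d
    ... | R₀ , d₀ , refl = τ-inv (renN-↦⁻ (+-cancelˡ-≡ k _ _) C refl d₀)
      where
      τ-inv : ∀ {R} → Pre (k +_) C _ (τ , R) → ∃[ C′ ] C ↦⟨ _ ∣ τ ⟩ C′ × sub σ R ≡ common fr C′
      τ-inv (τ , C′ , d , refl) = C′ , d , refl

    common-rcv⁻ : ∀ C {b F} → i ≡ 0 → common fr C ↦⟨ i ∣ rcv b ⟩ F →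
      ∃₂ λ a F₀ → C ↦⟨ i ∣ rcv a ⟩ F₀ × b ≡ k + a × F ≡ sub (exts σ) (renN (k +_) F₀)
    common-rcv⁻ C z d with sub-↦⁻ σ (renN (k +_) C) z refl d
    ... | F₁ , d₀ , refl with rcv-inv (renN-↦⁻ (+-cancelˡ-≡ k _ _) C refl d₀)
    ... | a , F₀ , d₁ , e , refl = a , F₀ , d₁ , e , refl

    common-snd⁻ : ∀ C {b K} → i ≡ 0 → common fr C ↦⟨ i ∣ snd b ⟩ K →
      ∃₂ λ a K₀ → C ↦⟨ i ∣ snd a ⟩ K₀ × b ≡ k + a × K ≡ subC σ (renC (k +_) K₀)
    common-snd⁻ C z d with sub-↦⁻ σ (renN (k +_) C) z refl d
    ... | K₁ , d₀ , refl with snd-inv (renN-↦⁻ (+-cancelˡ-≡ k _ _) C refl d₀)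
    ... | a , K₀ , d₁ , e , refl = a , K₀ , d₁ , e , refl

    common-↦ : ∀ {C α} {R : Res p α} → C ↦⟨ i ∣ α ⟩ R →
               common fr C ↦⟨ i ∣ renA (k +_) α ⟩ subR σ (renA (k +_) α) (renR (k +_) α R)
    common-↦ d = sub-↦ σ (renN-↦ (k +_) d)

  -- Normal bisimilarity promises only some silent moves of the answering test. Iterating
  -- `normal-τ⁻` shows that they lead to another test over the same frame, and that the real process
  -- can follow.
  reach : ∀ {D : Fin q → Term p abs} (fr : Frame D) nm st P {W₀ W} →
    W₀ ≋ normal fr nm st P → W₀ ⟹ W →
    ∃₂ λ st′ P′ → W ≋ normal fr nm st′ P′ × sub (Frame.δ fr) P ⟹ sub (Frame.δ fr) P′
  reach fr nm st P e ε = st , P , e , ε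
  reach fr nm st P e (str f ◅ w) = reach fr nm st P (≋-trans (≋-sym f) e) w
  reach fr nm st P e (tau d ◅ w) with ≋-↦ e d
  ... | _ , W₁ , d₁ , f with normal-τ⁻ fr nm st P d₁
  ... | st₁ , P₁ , g , v with reach fr nm st₁ P₁ (≋-trans f g) w
  ... | st₂ , P₂ , h , v′ = st₂ , P₂ , h , v ◅◅ v′

  -- The objects that are themselves variables refer to older variables; this
  -- bounds the number of hops needed to find the code of a called variable.
  record Ranks {p q : ℕ} (D : Fin q → Term p abs) (A B : Fin p → Term q abs) : Set where
    field
      rX  : Fin p → ℕ
      rY  : Fin q → ℕ
      now : ℕ
      rX< : ∀ i → rX i < now
      rY< : ∀ j → rY j < now
      D<  : ∀ j {i} → D j ≡ var i → rX i < rY j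
      A<  : ∀ i {j} → A i ≡ var j → rY j < rX i
      B<  : ∀ i {j} → B i ≡ var j → rY j < rX i

  renN-var : ∀ {ρ} {A : Term n abs} {x} → renN ρ A ≡ var x → A ≡ var x
  renN-var {A = var x} refl = refl

  wk-var : ∀ {A : Term n abs} {x} → wk A ≡ var x → ∃[ y ] x ≡ suc y × A ≡ var y
  wk-var {A = var y} refl = y , refl , refl

  module _ {p q : ℕ} {D : Fin q → Term p abs} {A B : Fin p → Term q abs} (r : Ranks D A B) where
    open Ranks r

    ranks-renN : ∀ ρ ρ₁ ρ₂ → Ranks (renN ρ ∘ D) (renN ρ₁ ∘ A) (renN ρ₂ ∘ B)
    ranks-renN _ _ _ = record
      { rX = rX ; rY = rY ; now = now ; rX< = rX< ; rY< = rY<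
      ; D< = λ j → D< j ∘ renN-var ; A< = λ i → A< i ∘ renN-var ; B< = λ i → B< i ∘ renN-var }

    ranks-shift : ∀ ρ₁ ρ₂ → Ranks D (renN ρ₁ ∘ A) (renN ρ₂ ∘ B)
    ranks-shift _ _ = record
      { rX = rX ; rY = rY ; now = now ; rX< = rX< ; rY< = rY<
      ; D< = D< ; A< = λ i → A< i ∘ renN-var ; B< = λ i → B< i ∘ renN-var }

    -- The new object gets the rank `now`, which exceeds the rank of every variable it can be.
    ranks-addX : ∀ F G → Ranks (wk ∘ D) (F ◂ A) (G ◂ B)
    ranks-addX F G = record
      { rX = now ◂ rX ; rY = rY ; now = suc now
      ; rX< = λ { zero → n<1+n now ; (suc i) → m≤n⇒m≤1+n (rX< i) }
      ; rY< = λ j → m≤n⇒m≤1+n (rY< j)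
      ; D<  = λ j e → older j (wk-var {A = D j} e)
      ; A<  = λ { zero {j} e → rY< j ; (suc i) → A< i }
      ; B<  = λ { zero {j} e → rY< j ; (suc i) → B< i } }
      where
      older : ∀ j {x} → ∃[ y ] x ≡ suc y × D j ≡ var y → (now ◂ rX) x < rY j
      older j (y , refl , e) = D< j e

    ranks-addY : ∀ d → Ranks (d ◂ D) (wk ∘ A) (wk ∘ B)
    ranks-addY d = record
      { rX = rX ; rY = now ◂ rY ; now = suc now
      ; rX< = λ i → m≤n⇒m≤1+n (rX< i)
      ; rY< = λ { zero → n<1+n now ; (suc j) → m≤n⇒m≤1+n (rY< j) }
      ; D<  = λ { zero {i} e → rX< i ; (suc j) → D< j }
      ; A<  = λ i e → older (A< i) (wk-var {A = A i} e)
      ; B<  = λ i e → older (B< i) (wk-var {A = B i} e) }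
      where
      older : ∀ {C : Term q abs} {N x} → (∀ {j} → C ≡ var j → rY j < N) →
              ∃[ y ] x ≡ suc y × C ≡ var y → (now ◂ rY) x < N
      older f (y , refl , e) = f e

    ranks-sym : Ranks D B A
    ranks-sym = record { rX = rX ; rY = rY ; now = now ; rX< = rX< ; rY< = rY< ; D< = D< ; A< = B< ; B< = A< }

-- Configurations: answers and calls

module _ where

  private variable
    n i p q : ℕ

  open Names using (name; inj; supply)

  module Soundness {R : Rel Proc 0ℓ} (isNB : IsNormalBisimulation R) where
    open UpTo≋ isNB

    -- Two frames over the same common code whose processes under test, with
    -- triggers for the objects they receive and servers of those they send, are
    -- normally bisimilar; realˡ and realʳ insert the actual objects instead.
    record Config (p q : ℕ) : Set where
      field
        D     : Fin q → Term p abs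
        nm    : Names (Index p q)
        L M   : Frame D
        s t   : Fin p → Bool
        P Q   : Term q proc
        rel   : normal L nm s P ≅′ normal M nm t Q
        ranks : Ranks D (Frame.A L) (Frame.A M)

      module L = Frame L
      module M = Frame M

      realˡ : Term p proc → Proc
      realˡ = real L P

      realʳ : Term p proc → Proc
      realʳ = real M Q

    module _ (c : Config p q) where
      open Config c

      flip : Config p q
      flip = record
        { D = D ; nm = nm ; L = M ; M = L ; s = t ; t = s ; P = Q ; Q = P
        ; rel = ≅′-sym rel ; ranks = ranks-sym ranks }

      replace : ∀ P′ → P ≋ P′ → Config p q
      replace P′ e = record
        { D = D ; nm = nm ; L = L ; M = M ; s = s ; t = t ; P = P′ ; Q = Q
        ; rel = ≅′-respects (normal-≋ L nm s (≋-sym e)) rel ≋-refl ; ranks = ranks }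

      -- The left frame alone changes: the two sides need not have the same number of private names.
      private-names : ∀ e P′ → P ≋ ν^ e P′ → Config p q
      private-names e P′ f = record
        { D = D ; nm = nm ; L = shift L e ; M = M ; s = s ; t = t ; P = P′ ; Q = Q
        ; rel = ≅′-respects (≋-sym (≋-trans (normal-≋ L nm s f) (∼*⇒≋ (normal-shift L e nm s P′)))) rel ≋-refl
        ; ranks = record { Ranks ranks ; A< = λ i → Ranks.A< ranks i ∘ renN-var } }

      -- The common code is shared, so its opened names are added to both frames at once, under a
      -- single extension of the names of the test.
      common-names : ∀ e → Config p q
      common-names e = record
        { D = renN (e +_) ∘ D ; nm = UpNames.nm′ u ; L = up L e ; M = up M e ; s = s ; t = t
        ; P = renN (lift^ L.k (e +_)) P ; Q = renN (lift^ M.k (e +_)) Q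
        ; rel = ≅′-respects (≡⇒≋ (normal-up L e u s P)) rel (≡⇒≋ (sym (normal-up M e u t Q)))
        ; ranks = ranks-renN ranks _ _ _ }
        where u = upNames nm e

      module _ (d : Term p abs) {m : ℕ} (fs : Fresh nm m) (s′ t′ : Fin p → Bool) (P′ Q′ : Term (suc q) proc)
               (r : normal (addY L d) (addTrg nm m fs) s′ P′ ≅′ normal (addY M d) (addTrg nm m fs) t′ Q′) where
        received : Config p (suc q)
        received = record
          { D = d ◂ D ; nm = addTrg nm m fs ; L = addY L d ; M = addY M d ; s = s′ ; t = t′
          ; P = P′ ; Q = Q′ ; rel = r ; ranks = ranks-addY ranks d }

      module _ (L′ M′ : Frame D) (ranks′ : Ranks D (Frame.A L′) (Frame.A M′))
               (F G : Term q abs) {m : ℕ} (fs : Fresh nm m) (s′ t′ : Fin (suc p) → Bool) (P′ Q′ : Term q proc)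
               (r : normal (addX L′ F) (addSrv nm m fs) s′ P′ ≅′ normal (addX M′ G) (addSrv nm m fs) t′ Q′) where
        sent : Config (suc p) q
        sent = record
          { D = wk ∘ D ; nm = addSrv nm m fs ; L = addX L′ F ; M = addX M′ G ; s = s′ ; t = t′
          ; P = P′ ; Q = Q′ ; rel = r ; ranks = ranks-addX ranks′ F G }

      answer-τ : ∀ {P′} → P ↦⟨ i ∣ τ ⟩ P′ → ∃₂ λ t′ Q′ →
        normal L nm s P′ ≅′ normal M nm t′ Q′ × sub M.δ Q ⟹ sub M.δ Q′
      answer-τ d with ≅′-τ rel (ν^-τ L.k (parl (trig-↦ _ _ d)))
      ... | V , w , r with reach M nm t Q ≋-refl w
      ... | t′ , Q′ , e , v = t′ , Q′ , ≅′-respects ≋-refl r e , v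

      record Input (b : ℕ) (F : Term 1 proc) : Set where
        field
          {m j} : ℕ
          {t₁}  : Fin p → Bool
          {Q₁}  : Term q proc
          {G}   : Term 1 proc
          {V}   : Proc
          fs    : Fresh nm m
          ready : sub M.δ Q ⟹ sub M.δ Q₁
          step  : normal M nm t₁ Q₁ ↦⟨ j ∣ rcv b ⟩ G
          after : G [ Tr m ] ⟹ V
          rel′  : F [ Tr m ] ≅′ V

      input-answer : ∀ {Pʷ b F} → Pʷ ≅′ normal M nm t Q → Pʷ ↦⟨ i ∣ rcv b ⟩ F → Input b F
      input-answer r d with ≅′-input r d
      ... | N , match with supply nm N
      ... | m , N≤m , fs with match m N≤m
      ... | im with reach M nm t Q ≋-refl (InputMatch.reach im)
      ... | t₁ , Q₁ , e , v with ≋-↦ e (InputMatch.step im)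
      ... | _ , G , d₁ , f = record
        { m = m ; t₁ = t₁ ; Q₁ = Q₁ ; G = G ; fs = fs ; ready = v ; step = d₁
        ; after = str ([]-≋ (≋-sym f) ≋-refl) ◅ InputMatch.after im ; rel′ = InputMatch.rel im }

      record Output (b : ℕ) (K : Con 0) : Set where
        field
          {m cost} : ℕ
          {t₁}  : Fin p → Bool
          {Q₁}  : Term q proc
          {K′}  : Con 0
          {V}   : Proc
          fs    : Fresh nm m
          ready : sub M.δ Q ⟹ sub M.δ Q₁
          step  : normal M nm t₁ Q₁ ↦⟨ cost ∣ snd b ⟩ K′
          after : plug K′ (ask m) ⟹ V
          rel′  : plug K (ask m) ≅′ V

      output-answer : ∀ {Pʷ b K} → Pʷ ≅′ normal M nm t Q → Pʷ ↦⟨ i ∣ snd b ⟩ K → Output b K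
      output-answer r d with ≅′-output r d
      ... | _ , _ , _ , w , d₀ , N , match with supply nm N
      ... | m , N≤m , fs with match m N≤m | reach M nm t Q ≋-refl w
      ... | V , v , r′ | t₁ , Q₁ , e , v₁ with ≋-↦ e d₀
      ... | _ , K′ , d₁ , f = record
        { m = m ; t₁ = t₁ ; Q₁ = Q₁ ; K′ = K′ ; fs = fs ; ready = v₁ ; step = d₁
        ; after = str (≋-sym (f (ask m))) ◅ v ; rel′ = r′ }

      record Receive (a : ℕ) (F : Term (suc q) proc) (d : Term p abs) : Set where
        field
          {m j} : ℕ
          {t₂}  : Fin p → Bool
          {Q₁}  : Term q proc
          {G Q₂} : Term (suc q) proc
          fs    : Fresh nm m
          ready : sub M.δ Q ⟹ sub M.δ Q₁
          step  : Q₁ ↦⟨ j ∣ rcv (M.k + a) ⟩ G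
          after : sub (Frame.δ (addY M d)) G ⟹ sub (Frame.δ (addY M d)) Q₂
          rel′  : normal (addY L d) (addTrg nm m fs) s F ≅′ normal (addY M d) (addTrg nm m fs) t₂ Q₂

        next : Config p (suc q)
        next = received d fs s t₂ F Q₂ rel′

      receive : ∀ {a F} → P ↦⟨ i ∣ rcv (L.k + a) ⟩ F → ∀ d → Receive a F d
      receive {a = a} x d with normal-input L nm s x
      ... | F′ , x′ , f with input-answer rel x′
      ... | record { m = m ; t₁ = t₁ ; Q₁ = Q₁ ; fs = fs ; ready = w ; step = y ; after = v ; rel′ = r }
        with normal-input⁻ M nm t₁ Q₁ y
      ... | inj₁ (a′ , G , _ , e , y₀ , g) with refl ← inj nm e
        with reach (addY M d) (addTrg nm m fs) t₁ G (g m fs d) v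
      ... | t₂ , Q₂ , h , v₂ = record
        { m = m ; t₂ = t₂ ; Q₁ = Q₁ ; G = G ; Q₂ = Q₂ ; fs = fs ; ready = w ; step = y₀ ; after = v₂
        ; rel′ = ≅′-respects (≋-sym (f m fs d)) r h }
      -- The answer cannot be a request to a server: it occurs on a public name, and `name` is
      -- injective.
      receive {a = a} x d | F′ , x′ , f | record {} | inj₂ (z , _ , e , _) with inj nm e
      ... | ()

      record Call (x : Fin p) (d : Term p abs) : Set where
        field
          {m}   : ℕ
          {s₂ t₂} : Fin p → Bool
          {Q₁}  : Term q proc
          {Q₂}  : Term (suc q) proc
          fs    : Fresh nm m
          ready : sub M.δ Q ⟹ sub M.δ Q₁
          after : sub (Frame.δ (addY M d)) (wk Q₁ ∥ (wk (M.A x) · var zero)) ⟹ sub (Frame.δ (addY M d)) Q₂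
          rel′  : normal (addY L d) (addTrg nm m fs) s₂ (wk P ∥ (wk (L.A x) · var zero)) ≅′
                  normal (addY M d) (addTrg nm m fs) t₂ Q₂

        next : Config p (suc q)
        next = received d fs s₂ t₂ (wk P ∥ (wk (L.A x) · var zero)) Q₂ rel′

    call-X : (c : Config p q) → let open Config c in ∀ x d → Call c x d
    -- The left server may have to arm itself before it can be asked; this is a silent move, which
    -- the right test answers before the request is made.
    call-X c x d with normal-fire (Config.L c) (Config.nm c) (Config.s c) (Config.P c) x
    ... | s₁ , F , s₂ , w₀ , x′ , f with ≅′-⟹ (Config.rel c) w₀
    ... | V₀ , v₀ , r₀ with reach (Config.M c) (Config.nm c) (Config.t c) (Config.Q c) ≋-refl v₀
    ... | t₀ , Q₀ , e₀ , u₀ = go (input-answer c₀ (≅′-respects ≋-refl r₀ e₀) x′)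
      where
      open Config c
      c₀ : Config _ _
      c₀ = record
        { D = D ; nm = nm ; L = L ; M = M ; s = s₁ ; t = t₀ ; P = P ; Q = Q₀
        ; rel = ≅′-respects ≋-refl r₀ e₀ ; ranks = ranks }
      go : Input c₀ (name nm (srv x)) F → Call c x d
      go record { m = m ; t₁ = t₁ ; Q₁ = Q₁ ; fs = fs ; ready = w ; step = y ; after = v ; rel′ = r }
        with normal-input⁻ M nm t₁ Q₁ y
      ... | inj₁ (_ , _ , _ , e , _) with inj nm e
      ...   | ()
      go record { m = m ; t₁ = t₁ ; Q₁ = Q₁ ; fs = fs ; ready = w ; step = y ; after = v ; rel′ = r }
        | inj₂ (x₁ , t′ , e , g) with refl ← inj nm e
        with reach (addY M d) (addTrg nm m fs) t′ (wk Q₁ ∥ (wk (M.A x) · var zero)) (g m fs d) v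
      ... | t₂ , Q₂ , h , v₂ = record
        { m = m ; s₂ = s₂ ; t₂ = t₂ ; Q₁ = Q₁ ; Q₂ = Q₂ ; fs = fs ; ready = u₀ ◅◅ w ; after = v₂ ; rel′ = ≅′-respects (≋-sym (f m fs d)) r h }

    module _ (c : Config p q) where
      open Config c

      pub≢trg : ∀ {a j} → _≡_ {A = Index p q} (pub a) (trg j) → ⊥
      pub≢trg ()

      record Transmit (a e : ℕ) (F : Term q abs) (P′ : Term q proc) : Set where
        field
          {m j e′} : ℕ
          {t₂}  : Fin (suc p) → Bool
          {G}   : Term q abs
          {Q₁ Q′ Q₂} : Term q proc
          fs    : Fresh nm m
          ready : sub M.δ Q ⟹ sub M.δ Q₁
          step  : Q₁ ↦⟨ j ∣ snd (M.k + a) ⟩ con e′ G Q′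
          after : sub (renN (e′ +_) ∘ M.δ) Q′ ⟹ sub (renN (e′ +_) ∘ M.δ) Q₂
          rel′  : normal (addX (shift L e) F) (addSrv nm m fs) (false ◂ s) P′ ≅′
                  normal (addX (shift M e′) G) (addSrv nm m fs) t₂ Q₂

        next : Config (suc p) q
        next = sent c (shift L e) (shift M e′) (ranks-shift ranks _ _) F G fs (false ◂ s) t₂ P′ Q₂ rel′

      transmit : ∀ {a e F P′} → P ↦⟨ i ∣ snd (L.k + a) ⟩ con e F P′ → Transmit a e F P′
      transmit {a = a} {e} {F} {P′} x = go (proj₂ (proj₂ out₀)) (output-answer c rel (proj₁ (proj₂ out₀)))
        where
        out₀ : ∃[ K ] normal L nm s P ↦⟨ _ ∣ snd (name nm (pub a)) ⟩ K × AfterOutput L nm K e F s P′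
        out₀ = normal-output L nm s {P} {a} {e} {F} {P′} x
        module _ {K : Con 0} (f : AfterOutput L nm K e F s P′) (o : Output c (name nm (pub a)) K) where
          open Output o
          finish : _ → Transmit a e F P′
          finish (inj₁ (a′ , e′ , G , Q′ , _ , eq , y , g)) = own-case (inj nm eq) y
            (reach (addX (shift M e′) G) (addSrv nm m fs) (false ◂ t₁) Q′ (g m fs) after)
            where
            own-case : pub a ≡ pub a′ → Q₁ ↦⟨ _ ∣ snd (M.k + a′) ⟩ con e′ G Q′ → _ → Transmit a e F P′
            own-case refl y (t₂ , Q₂ , h , v₂) = record
              { m = m ; t₂ = t₂ ; e′ = e′ ; Q₁ = Q₁ ; G = G ; Q′ = Q′ ; Q₂ = Q₂ ; fs = fs
              ; ready = ready ; step = y ; after = v₂ ; rel′ = ≅′-respects (≋-sym (f m fs)) rel′ h }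
          finish (inj₂ (_ , _ , _ , _ , eq , _)) = ⊥-elim (pub≢trg (inj nm eq))
          go : Transmit a e F P′
          go = finish (normal-output⁻ M nm t₁ Q₁ step)

      record Return (j : Fin q) (F : Term q abs) (P′ : Term q proc) : Set where
        field
          {m e} : ℕ
          {t₂}  : Fin (suc p) → Bool
          {G}   : Term q abs
          {Q₁ Q′ Q₂} : Term q proc
          fs    : Fresh nm m
          ready : sub M.δ Q ⟹ sub M.δ Q₁
          shape : Q₁ ≋ ν^ e (var j · G ∥ Q′)
          after : sub (renN (e +_) ∘ M.δ) Q′ ⟹ sub (renN (e +_) ∘ M.δ) Q₂
          rel′  : normal (addX L F) (addSrv nm m fs) (false ◂ s) P′ ≅′
                  normal (addX (shift M e) G) (addSrv nm m fs) t₂ Q₂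

        next : Config (suc p) q
        next = sent c L (shift M e)
          (record { Ranks ranks ; B< = λ i → Ranks.B< ranks i ∘ renN-var }) F G fs (false ◂ s) t₂ P′ Q₂ rel′

      -- In the test the call is an output on the name of trigger `j`. The answer must use the same
      -- name, and only a call of the same variable does, since public names and the other triggers
      -- have different ones.
      call-Y : ∀ j F P′ → P ≡ var j · F ∥ P′ → Return j F P′
      call-Y j F P′ refl = go (proj₂ (proj₂ out₀)) (output-answer c rel (proj₁ (proj₂ out₀)))
        where
        out₀ : ∃[ K ] normal L nm s P ↦⟨ 1 ∣ snd (name nm (trg j)) ⟩ K × (∀ m (fs : Fresh nm m) →
          plug K (ask m) ≋ normal (addX L F) (addSrv nm m fs) (false ◂ s) P′)
        out₀ = normal-call L nm s j F P′
        module _ {K : Con 0} (f : ∀ m (fs : Fresh nm m) →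
                          plug K (ask m) ≋ normal (addX L F) (addSrv nm m fs) (false ◂ s) P′)
                 (o : Output c (name nm (trg j)) K) where
          open Output o
          finish : _ → Return j F P′
          finish (inj₁ (_ , _ , _ , _ , _ , eq , _)) = ⊥-elim (pub≢trg (sym (inj nm eq)))
          finish (inj₂ (j′ , e , G , Q′ , eq , shape , g)) = call-case (inj nm eq) shape
            (reach (addX (shift M e) G) (addSrv nm m fs) (false ◂ t₁) Q′ (g m fs) after)
            where
            call-case : trg j ≡ trg j′ → Q₁ ≋ ν^ e (var j′ · G ∥ Q′) → _ → Return j F P′
            call-case refl shape (t₂ , Q₂ , h , v₂) = record
              { m = m ; t₂ = t₂ ; e = e ; Q₁ = Q₁ ; G = G ; Q′ = Q′ ; Q₂ = Q₂ ; fs = fs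
              ; ready = ready ; shape = shape ; after = v₂ ; rel′ = ≅′-respects (≋-sym (f m fs)) rel′ h }
          go : Return j F P′
          go = finish (normal-output⁻ M nm t₁ Q₁ step)

    -- Hops: a called variable of the common code becomes an application run
    -- by the process under test, and conversely.

    call-X-realʳ : (c : Config p q) → let open Config c in ∀ x d C (h : Call c x d) →
      realʳ ((var x · d) ∥ C) ⟹ Config.realʳ (Call.next h) C
    call-X-realʳ c x d C h =
      real-⟹ M {Q} {Q₁} ((var x · d) ∥ C) ready ◅◅
      ≋⇒⟹ (ν^-≋ M.k (≋-trans (∥-cong ∥-comm ≋-refl) (≋-trans ∥-assoc (∥-cong ≋-refl
        (≋-trans ∥-comm (∥-cong (≡⇒≋ (sym (sub-◂-wk (common M d) M.δ Q₁)))
          (≡⇒≋ (cong (_· common M d) (trans (M.σ-≡ x) (sym (sub-◂-wk (common M d) M.δ (M.A x)))))))))))) ◅◅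
      real-⟹ (addY M d) {wk Q₁ ∥ (wk (M.A x) · var zero)} {Q₂} C after
      where
      open Config c
      open Call h

    call-Y-realʳ : (c : Config p q) → let open Config c in ∀ j F P′ C (h : Return c j F P′) →
      realʳ C ⟹ Config.realʳ (Return.next h) (wk C ∥ (wk (D j) · var zero))
    call-Y-realʳ c j F P′ C h =
      real-⟹ M {Q} {Q₁} C ready ◅◅
      ≋⇒⟹ (≋-trans (real-≋ M {C = C} shape ≋-refl) (≋-trans (∼*⇒≋ (real-shift M e (var j · G ∥ Q′) C))
        (ν^-≋ (M.k + e) (≋-trans (≋-sym ∥-assoc) (∥-cong (∥-cong
          (≡⇒≋ (sym (common-addX (shift M e) G C)))
          (≡⇒≋ (cong (_· sub (renN (e +_) ∘ M.δ) G)
            (trans (Frame.δ-≡ (shift M e) j) (sym (common-addX (shift M e) G (D j)))))))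
          ≋-refl))))) ◅◅
      real-⟹ (addX (shift M e) G) {Q′} {Q₂} (wk C ∥ (wk (D j) · var zero)) after
      where
      open Config c
      open Return h

    -- `T` is matched up to `≡ₛ`, so that the cost of its transitions is kept for the induction; `U`
    -- may make silent moves and use β. The `g` names are those of the common code that a call has
    -- brought outside the frame.
    Advance : Proc → Proc → Set
    Advance T U = ∃[ g ] ∃[ p ] ∃[ q ] ∃[ c ] ∃[ C ]
      (T ≡ₛ ν^ g (Config.realˡ {p} {q} c C) × U ⟹ ν^ g (Config.realʳ c C))

    advance : ∀ {T T′ U U′} → T ≡ₛ T′ → U ⟹ U′ → Advance T′ U′ → Advance T U
    advance e w (g , p , q , c , C , f , v) = g , p , q , c , C , e ◅◅ f , w ◅◅ v

    advance-ν^ : ∀ g {T U} → Advance T U → Advance (ν^ g T) (ν^ g U)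
    advance-ν^ g (h , p , q , c , C , f , v) =
      g + h , p , q , c , C ,
      ν^-≡ₛ g f ◅◅ ≡⇒≡ₛ (sym (ν^-+ g h _)) , ν^-⟹ g v ◅◅ ≋⇒⟹ (≡⇒≋ (sym (ν^-+ g h _)))

    wk-ƛ-·-var : ∀ (T : Term (suc n) proc) → wk (ƛ T) · var zero ≋ T
    wk-ƛ-·-var T = ≋-trans β (≡⇒≋ (trans (sub-renV (single (var zero)) (ext suc) T)
                                    (sub-var (λ { zero → refl ; (suc x) → refl }) T)))

    ƛ-injective : ∀ {T U : Term (suc n) proc} → _≡_ {A = Term n abs} (ƛ T) (ƛ U) → T ≡ U
    ƛ-injective refl = refl

    view : (A : Term n abs) → (∃[ x ] A ≡ var x) ⊎ (∃[ T ] A ≡ ƛ T)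
    view (var x) = inj₁ (x , refl)
    view (ƛ T)   = inj₂ (T , refl)

    module _ (c : Config p q) where
      open Config c

      module _ (x : Fin p) (d : Term p abs) (C : Term p proc) {b : Term 1 proc} (h : Call c x d) where
        open Call h

        -- The called code `T` is found in the tested process, so it leaves the common code and runs
        -- next to `P`, with the new variable standing for its argument.
        call-X-ƛ : ∀ {T} → L.σ x ≡ ƛ b → L.A x ≡ ƛ T →
          Advance (ν^ L.k ((b [ common L d ] ∥ common L C) ∥ sub L.δ P)) (realʳ ((var x · d) ∥ C))
        call-X-ƛ {T} σ≡ A≡ =
          0 , _ , _ , replace next (wk P ∥ T) (∥-cong ≋-refl
            (≋-trans (≡⇒≋ (cong (λ A → wk A · var zero) A≡)) (wk-ƛ-·-var T))) , C ,
          ν^-≡ₛ L.k (∥-cong* (∥-comm-≡ₛ _ _) ε ◅◅ ∥-assoc-≡ₛ _ _ _ ◅◅ ∥-cong* ε (∥-comm-≡ₛ _ _ ◅◅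
            ∥-cong* (≡⇒≡ₛ (sym (sub-◂-wk (common L d) L.δ P)))
                    (≡⇒≡ₛ (trans (cong (_[ common L d ]) b≡) (exts-[] L.δ T (common L d)))))) ,
          call-X-realʳ c x d C h
          where
          b≡ : b ≡ sub (exts L.δ) T
          b≡ = ƛ-injective (trans (sym σ≡) (trans (L.σ-≡ x) (cong (sub L.δ) A≡)))

        -- The object called is itself a variable, so its code must be sought on the common side.
        -- The call is passed on as a call by the tested process, with its argument behind the new
        -- variable `var zero`.
        call-X-var : ∀ {j} → L.A x ≡ var j →
          (∀ P≋ → let c′ = replace next ((var (suc j) · var zero) ∥ wk P) P≋ in
            Advance (ν^ L.k (common L C ∥ (b [ common L d ] ∥ sub (Config.L.δ c′) (wk P)))) (Config.realʳ c′ C)) →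
          Advance (ν^ L.k ((b [ common L d ] ∥ common L C) ∥ sub L.δ P)) (realʳ ((var x · d) ∥ C))
        call-X-var A≡ adv = advance
          (ν^-≡ₛ L.k (∥-cong* (∥-comm-≡ₛ _ _) ε ◅◅ ∥-assoc-≡ₛ _ _ _ ◅◅ ∥-cong* ε
            (∥-cong* ε (≡⇒≡ₛ (sym (sub-◂-wk (common L d) L.δ P))))))
          (call-X-realʳ c x d C h)
          (adv (≋-trans ∥-comm (∥-cong (≡⇒≋ (cong (λ A → wk A · var zero) A≡)) ≋-refl)))

      module _ (j : Fin q) (F : Term q abs) (P′ : Term q proc) (C : Term p proc) {b : Term 1 proc}
               (h : Return c j F P′) where
        open Return h

        call-Y-ƛ : ∀ {T} → L.δ j ≡ ƛ b → D j ≡ ƛ T →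
          Advance (ν^ L.k (common L C ∥ (b [ sub L.δ F ] ∥ sub L.δ P′))) (realʳ C)
        call-Y-ƛ {T} δ≡ D≡ =
          0 , _ , _ , next , (wk C ∥ T) ,
          ν^-≡ₛ L.k (reverse* (∥-assoc-≡ₛ _ _ _) ◅◅ ∥-cong* (∥-cong*
            (≡⇒≡ₛ (sym (common-addX L F C)))
            (≡⇒≡ₛ (trans (cong (_[ sub L.δ F ]) b≡) (exts-[] L.σ (renN (L.k +_) T) (sub L.δ F))))) ε) ,
          call-Y-realʳ c j F P′ C h ◅◅ ≋⇒⟹ (real-≋ (Config.M next) {Q₂} ≋-refl (∥-cong (≋-refl {T = wk C})
            (≋-trans (≡⇒≋ (cong (λ A → wk A · var zero) D≡)) (wk-ƛ-·-var T))))
          where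
          b≡ : b ≡ sub (exts L.σ) (renN (L.k +_) T)
          b≡ = ƛ-injective (trans (sym δ≡) (trans (L.δ-≡ j) (cong (common L) D≡)))

        call-Y-var : ∀ {x} → D j ≡ var x →
          Advance (ν^ L.k ((b [ sub L.δ F ] ∥ common (Config.L next) (wk C)) ∥ sub L.δ P′))
                  (Config.realʳ next ((var (suc x) · var zero) ∥ wk C)) →
          Advance (ν^ L.k (common L C ∥ (b [ sub L.δ F ] ∥ sub L.δ P′))) (realʳ C)
        call-Y-var D≡ = advance
          (ν^-≡ₛ L.k (reverse* (∥-assoc-≡ₛ _ _ _) ◅◅ ∥-cong* (∥-comm-≡ₛ _ _ ◅◅ ∥-cong* ε
            (≡⇒≡ₛ (sym (common-addX L F C)))) ε))
          (call-Y-realʳ c j F P′ C h ◅◅ ≋⇒⟹ (real-≋ (Config.M next) {Q₂} ≋-refl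
            (≋-trans ∥-comm (∥-cong (≡⇒≋ (cong (λ A → wk A · var zero) D≡)) (≋-refl {T = wk C})))))

    -- `b` is the code reached at the end of the hops. A hop performs no β-step on the left, so the
    -- recursion is on `r`, a bound on the rank of the called variable; `A<` and `D<` make it
    -- decrease.
    chain-X : ∀ r (c : Config p q) → let open Config c in ∀ x d C {b} → Ranks.rX ranks x < r → L.σ x ≡ ƛ b →
      Advance (ν^ L.k ((b [ common L d ] ∥ common L C) ∥ sub L.δ P)) (realʳ ((var x · d) ∥ C))
    chain-Y : ∀ r (c : Config p q) → let open Config c in ∀ j F P′ C {b} → Ranks.rY ranks j < r → L.δ j ≡ ƛ b →
      P ≡ var j · F ∥ P′ →
      Advance (ν^ L.k (common L C ∥ (b [ sub L.δ F ] ∥ sub L.δ P′))) (realʳ C)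
    chain-X (suc r) c x d C {b} x<r σ≡ = go (view (L.A x))
      where
      open Config c
      h = call-X c x d
      go : _ → _
      go (inj₂ (T , A≡)) = call-X-ƛ c x d C h σ≡ A≡
      go (inj₁ (j , A≡)) = call-X-var c x d C {b} h A≡ λ P≋ →
        chain-Y r (replace (Call.next h) ((var (suc j) · var zero) ∥ wk P) P≋) (suc j) (var zero) (wk P) C {b}
          (≤-trans (Ranks.A< ranks x A≡) (s≤s⁻¹ x<r))
          (trans (sym (trans (L.σ-≡ x) (cong (sub L.δ) A≡))) σ≡) refl
    chain-Y (suc r) c j F P′ C {b} j<r δ≡ P≡ = go (view (D j))
      where
      open Config c
      h = call-Y c j F P′ P≡
      go : _ → _
      go (inj₂ (T , D≡)) = call-Y-ƛ c j F P′ C h δ≡ D≡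
      go (inj₁ (x , D≡)) = call-Y-var c j F P′ C {b} h D≡
        (chain-X r (Return.next h) (suc x) (var zero) (wk C) {b}
          (≤-trans (Ranks.D< ranks j D≡) (s≤s⁻¹ j<r))
          (trans (sym (trans (L.δ-≡ j) (cong (common L) D≡))) δ≡))

    module _ (c : Config p q) (C : Term p proc) where
      open Config c

      -- The argument of the call can mention the `e` restrictions above it, and the tested process
      -- is about to refer to it by a variable. The restrictions are therefore made public first, by
      -- `common-names`.
      advance-call-X : ∀ {T} (k : CallStep L.σ (renN (L.k +_) C) T) →
        Advance (ν^ L.k (T ∥ sub L.δ P)) (realʳ C)
      advance-call-X {T} k = go (renN-calls⁻ (L.k +_) C calls)
        where
        open CallStep k using (e; x; calls; step) renaming (D to D₁; T′ to C₁)
        open BlockSwap (blockSwap L.k e)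
        c′ = common-names c e
        go : (∃₂ λ D₀ C₀ → Calls C e x D₀ C₀ ×
                D₁ ≡ renN (lift^ e (L.k +_)) D₀ × C₁ ≡ renN (lift^ e (L.k +_)) C₀) → _
        go (D₀ , C₀ , c₀ , D≡ , C≡) = advance
          (ν^-≡ₛ L.k (∥-cong* step ε) ◅◅ ν^-up L e _ P ◅◅
           ν^-≡ₛ e (ν^-≡ₛ L.k (≡⇒≡ₛ (cong (_∥ sub (Frame.δ (up L e)) (renN (lift^ L.k (e +_)) P))
             (cong₂ _∥_
               (trans (renN-apply θ (renN (e +_) (L.σ x)) (sub (renN (e +_) ∘ L.σ) D₁))
                 (cong₂ apply (trans (θ-σ L e x) (proj₂ b))
                              (trans (cong (renN θ ∘ sub (renN (e +_) ∘ L.σ)) D≡) (θ-common L e D₀))))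
               (trans (cong (renN θ ∘ sub (renN (e +_) ∘ L.σ)) C≡) (θ-common L e C₀)))))))
          (≋⇒⟹ (≋-trans (real-≋ M {Q} ≋-refl (∼*⇒≋ (calls-≡ₛ c₀)))
                         (∼*⇒≋ (real-up M e Q ((var x · D₀) ∥ C₀)))))
          (advance-ν^ e (chain-X _ c′ x D₀ C₀ {proj₁ b} (n<1+n _) (proj₂ b)))
          where
          b : ∃[ T ] Config.L.σ c′ x ≡ ƛ T
          b = closed-ƛ (Config.L.σ c′ x)

      -- Dually, restrictions above a call by the tested process become private names of the left
      -- frame; the common code does not know them.
      advance-call-Y : ∀ {T} (k : CallStep L.δ P T) →
        Advance (ν^ L.k (common L C ∥ T)) (realʳ C)
      advance-call-Y {T} k = advance
        (ν^-≡ₛ L.k (∥-cong* ε step) ◅◅ ν^-shift L e C _ ◅◅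
         ν^-≡ₛ (L.k + e) (∥-cong* ε (≡⇒≡ₛ (cong (λ A → apply A (sub (renN (e +_) ∘ L.δ) F) ∥
                                                         sub (renN (e +_) ∘ L.δ) P′) (proj₂ b)))))
        ε
        (chain-Y _ c′ j F P′ C {proj₁ b} (n<1+n _) (proj₂ b) refl)
        where
        open CallStep k using (e; calls; step) renaming (x to j; D to F; T′ to P′)
        c′ = private-names c e (var j · F ∥ P′) (∼*⇒≋ (calls-≡ₛ calls))
        b : ∃[ T ] Config.L.δ c′ j ≡ ƛ T
        b = closed-ƛ (Config.L.δ c′ j)

      advance-⇝ : ∀ {T} → realˡ C ⇝ T → Advance T (realʳ C)
      advance-⇝ d = go (ν^-⇝⁻ L.k d)
        where
        go-common : ∀ {V} → (∃[ T′ ] renN (L.k +_) C ⇝ T′ × V ≡ sub L.σ T′) ⊎ CallStep L.σ (renN (L.k +_) C) V →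
                    Advance (ν^ L.k (V ∥ sub L.δ P)) (realʳ C)
        go-common (inj₁ (_ , d₁ , refl)) = step (renN-⇝⁻ (L.k +_) C d₁)
          where
          step : ∀ {V} → ∃[ C′ ] C ⇝ C′ × V ≡ renN (L.k +_) C′ →
                Advance (ν^ L.k (sub L.σ V ∥ sub L.δ P)) (realʳ C)
          step (C′ , d₂ , refl) = 0 , _ , _ , c , C′ , ε , ≋⇒⟹ (real-≋ M {Q} ≋-refl (⇝⇒≋ d₂))
        go-common (inj₂ k) = advance-call-X k
        go-tested : ∀ {V} → (∃[ P′ ] P ⇝ P′ × V ≡ sub L.δ P′) ⊎ CallStep L.δ P V →
                    Advance (ν^ L.k (common L C ∥ V)) (realʳ C)
        go-tested (inj₁ (P′ , d₁ , refl)) = 0 , _ , _ , replace c P′ (⇝⇒≋ d₁) , C , ε , ε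
        go-tested (inj₂ k) = advance-call-Y k
        go : ∀ {T} → ∃[ T′ ] common L C ∥ sub L.δ P ⇝ T′ × T ≡ ν^ L.k T′ → Advance T (realʳ C)
        go (_ , parl d₀ , refl) = go-common (sub-⇝⁻ L.σ (renN (L.k +_) C) d₀)
        go (_ , parr d₀ , refl) = go-tested (sub-⇝⁻ L.δ P d₀)

-- The candidate context bisimulation

module _ where

  private variable
    n i p q : ℕ

  open Names using (name; inj; supply)

  module Candidate {R : Rel Proc 0ℓ} (isNB : IsNormalBisimulation R) where
    open UpTo≋ isNB
    open Soundness isNB

    infix 4 _≈′_

    record _≈′_ (X Y : Proc) : Set where
      constructor cfg
      field
        g     : ℕ
        {x y} : ℕ
        c     : Config x y
        C     : Term x proc
        left  : X ≋ ν^ g (Config.realˡ c C)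
        right : ν^ g (Config.realʳ c C) ≋ Y

    ≈′-sym : ∀ {X Y} → X ≈′ Y → Y ≈′ X
    ≈′-sym (cfg g c C e f) = cfg g (flip c) C (≋-sym f) (≋-sym e)

    ≈′-respects : ∀ {X X′ Y Y′} → X′ ≋ X → X ≈′ Y → Y ≋ Y′ → X′ ≈′ Y′
    ≈′-respects e (cfg g c C e′ f′) f = cfg g c C (≋-trans e e′) (≋-trans f′ f)

    ≈′-ν : ∀ {X Y} → X ≈′ Y → ν X ≈′ ν Y
    ≈′-ν (cfg g c C e f) = cfg (suc g) c C (ν-cong e) (ν-cong f)

    continue : Con 0 → Proc → Con 0
    continue (con k A _) X = con k A X

    -- The answer to an input may depend on the object `A`. After an output, the silent moves are
    -- made by the continuation alone, before the context `E` is chosen.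
    Match : (α : Act) → Res 0 α → Proc → Set
    Match τ       X Y = ∃[ Y′ ] Y ⟹ Y′ × X ≈′ Y′
    Match (rcv a) F Y = ∀ A → ∃[ Y₁ ] ∃[ j ] ∃[ G ] ∃[ Y′ ]
      (Y ⟹ Y₁ × Y₁ ↦⟨ j ∣ rcv a ⟩ G × G [ A ] ⟹ Y′ × F [ A ] ≈′ Y′)
    Match (snd a) K Y = ∃[ Y₁ ] ∃[ j ] ∃[ L ] ∃[ Y′ ]
      (Y ⟹ Y₁ × Y₁ ↦⟨ j ∣ snd a ⟩ L × Con.cont L ⟹ Y′ ×
       (∀ E → plug K E ≈′ plug (continue L Y′) E))

    match-respects : ∀ α {X X′ Y Y′} → Equiv α X′ X → Y′ ⟹ Y → Match α X Y → Match α X′ Y′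
    match-respects τ       e w (Y₁ , v , r) = Y₁ , w ◅◅ v , ≈′-respects e r ≋-refl
    match-respects (rcv a) e w h A with h A
    ... | _ , _ , _ , _ , v , d , u , r =
      _ , _ , _ , _ , w ◅◅ v , d , u , ≈′-respects ([]-≋ e ≋-refl) r ≋-refl
    match-respects (snd a) e w (_ , _ , _ , _ , v , d , u , r) =
      _ , _ , _ , _ , w ◅◅ v , d , u , λ E → ≈′-respects (e E) (r E) ≋-refl

    match-ν : ∀ α {X Y} → Match (renA suc α) X Y → Match α (νR α X) (ν Y)
    match-ν τ (Y′ , w , r) = ν Y′ , ν-⟹ w , ≈′-ν r
    match-ν (rcv a) {F} h A with h (renN suc A)
    ... | _ , _ , G , Y′ , w , d , u , r = _ , _ , _ , ν Y′ , ν-⟹ w , res d ,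
      ≋⇒⟹ (≡⇒≋ (ν-[] G A)) ◅◅ ν-⟹ u , ≈′-respects (≡⇒≋ (ν-[] F A)) (≈′-ν r) ≋-refl
    match-ν (snd a) {K} (_ , _ , L , Y′ , w , d , u , r) = _ , _ , _ , Y′ , ν-⟹ w , res d , u , λ E →
      ≈′-respects (≡⇒≋ (plug-νC K E)) (≈′-ν (r (renN suc E))) (≡⇒≋ (sym (plug-νC (continue L Y′) E)))

    Simulated : ℕ → Proc → Proc → Set
    Simulated n X Y = ∀ {α S} → X ↦⟨ n ∣ α ⟩ S → Match α S Y

    simulated-ν^ : ∀ g {X Y} → Simulated n X Y → Simulated n (ν^ g X) (ν^ g Y)
    simulated-ν^ zero    h d = h d
    simulated-ν^ (suc g) h (res {α = α} d) = match-ν α (simulated-ν^ g h d)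

    module _ (c : Config p q) (C : Term p proc) where
      open Config c

      private
        base : ∀ {X Y} {p q} (c′ : Config p q) C′ →
               X ≋ Config.realˡ c′ C′ → Config.realʳ c′ C′ ≋ Y → X ≈′ Y
        base c′ C′ e f = cfg 0 c′ C′ e f

      match-common-τ : ∀ {C′} → C ↦⟨ i ∣ τ ⟩ C′ → Match τ (realˡ C′) (realʳ C)
      match-common-τ {C′ = C′} d =
        _ , tau⇒⟹ (ν^-τ M.k (parl (common-↦ M d))) , base c C′ ≋-refl ≋-refl

      match-common-input : ∀ {a F} → C ↦⟨ i ∣ rcv a ⟩ F →
        Match (rcv a) (ν^ L.k (sub (exts L.σ) (renN (L.k +_) F) ∥ wk (sub L.δ P))) (realʳ C)
      match-common-input {F = F} d A = _ , _ , _ , _ , ε , ν^-rcv M.k (parl (common-↦ M d)) , ε ,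
        base c (F [ weaken A ]) (≡⇒≋ (real-common-input L P F A)) (≡⇒≋ (sym (real-common-input M Q F A)))

      match-common-output : ∀ {a e G C′} → C ↦⟨ i ∣ snd a ⟩ con e G C′ →
        Match (snd a) (con (L.k + e) (sub (renN (e +_) ∘ L.σ) (renN (lift^ e (L.k +_)) G))
          (sub (renN (e +_) ∘ L.σ) (renN (lift^ e (L.k +_)) C′) ∥ renN (e +_) (sub L.δ P))) (realʳ C)
      match-common-output {e = e} {G} {C′} d = _ , _ , _ , _ , ε , ν^-snd M.k (parl (common-↦ M d)) , ε , λ E →
        base c (ν^ e (renN (e +_) (weaken₁ E) [ G ] ∥ C′))
          (real-common-output L P e G C′ E) (≋-sym (real-common-output M Q e G C′ E))

      match-τ : ∀ {P′} → P ↦⟨ i ∣ τ ⟩ P′ → Match τ (real L P′ C) (realʳ C)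
      match-τ {P′ = P′} d = go (answer-τ c d)
        where
        go : (∃₂ λ t′ Q′ → normal L nm s P′ ≅′ normal M nm t′ Q′ × sub M.δ Q ⟹ sub M.δ Q′) → _
        go (t′ , Q′ , r , w) = real M Q′ C , real-⟹ M {Q} {Q′} C w , base c′ C ≋-refl ≋-refl
          where
          c′ : Config p q
          c′ = record { D = D ; nm = nm ; L = L ; M = M ; s = s ; t = t′ ; P = P′ ; Q = Q′
                      ; rel = r ; ranks = ranks }

      match-input : ∀ {a F} → P ↦⟨ i ∣ rcv (L.k + a) ⟩ F →
        Match (rcv a) (ν^ L.k (sub (exts L.δ) F ∥ wk (common L C))) (realʳ C)
      match-input {a = a} {F} d A = go (receive c d (weaken A))
        where
        go : Receive c a F (weaken A) → _
        go h = _ , _ , _ , real (addY M (weaken A)) Q₂ C ,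
          real-⟹ M {Q} {Q₁} C ready , ν^-rcv M.k (parr (sub-↦ M.δ step)) ,
          ≋⇒⟹ (real-input M C G A) ◅◅ real-⟹ (addY M (weaken A)) {G} {Q₂} C after ,
          base next C (real-input L C F A) ≋-refl
          where open Receive h

      match-output : ∀ {a e F P′} → P ↦⟨ i ∣ snd (L.k + a) ⟩ con e F P′ →
        Match (snd a) (con (L.k + e) (sub (renN (e +_) ∘ L.δ) F)
          (sub (renN (e +_) ∘ L.δ) P′ ∥ renN (e +_) (common L C))) (realʳ C)
      match-output {a = a} {e} {F} {P′} d = go (transmit c d)
        where
        go : Transmit c a e F P′ → _
        go h = _ , _ , _ , sub (renN (e′ +_) ∘ M.δ) Q₂ ∥ renN (e′ +_) (common M C) ,
          real-⟹ M {Q} {Q₁} C ready , ν^-snd M.k (parr (sub-↦ M.δ step)) ,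
          ∥-⟹ _ after , λ E →
          base next (weaken₁ E ∥ wk C) (real-output L C e F P′ E) (≋-sym (real-output M C e′ G Q₂ E))
          where open Transmit h

      match-com-output : ∀ {i j a E e F P′} → C ↦⟨ i ∣ rcv a ⟩ E → P ↦⟨ j ∣ snd (L.k + a) ⟩ con e F P′ →
        Match τ (ν^ L.k (plug (subC L.δ (con e F P′)) (sub (exts L.σ) (renN (L.k +_) E)))) (realʳ C)
      match-com-output {a = a} {E} {e} {F} {P′} d₁ d₂ = go (transmit c d₂)
        where
        go : Transmit c a e F P′ → _
        go h = real (addX (shift M e′) G) Q₂ E ,
          (real-⟹ M {Q} {Q₁} C ready ◅◅ tau⇒⟹ (ν^-τ M.k (coml (common-↦ M d₁) (sub-↦ M.δ step))) ◅◅
           ≋⇒⟹ (≡⇒≋ (real-com-output M e′ G Q′ E)) ◅◅ real-⟹ (addX (shift M e′) G) {Q′} {Q₂} E after) ,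
          base next E (≡⇒≋ (real-com-output L e F P′ E)) ≋-refl
          where open Transmit h

    -- The object `G` can mention the names extruded with it, so the communication is replayed with
    -- these already public. On the right, `snd-shape` puts them in front of a plain output, which
    -- then communicates with the input found by `receive`.
    match-com-input : (c : Config p q) → let open Config c in ∀ C {i j a e G C′ F} →
      C ↦⟨ i ∣ snd a ⟩ con e G C′ → P ↦⟨ j ∣ rcv (L.k + a) ⟩ F →
      Match τ (ν^ L.k (plug (subC L.σ (renC (L.k +_) (con e G C′))) (sub (exts L.δ) F))) (realʳ C)
    match-com-input c C {a = a} {e} {G} {C′} {F} d₁ d₂ =
      go (snd-shape d₁) (receive c′ d₂′ G)
      where
      open Config c
      c′ = common-names c e
      F′ : Term (suc _) proc
      F′ = renN (lift^ L.k (e +_)) F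
      M′ = Config.M c′
      d₂′ : Config.P c′ ↦⟨ _ ∣ rcv (L.k + (e + a)) ⟩ F′
      d₂′ = castRcv (lift^-shift L.k (e +_) a) (renN-↦ (lift^ L.k (e +_)) d₂)
      go : (∃₂ λ Y Z → C ≋ ν^ e (out (e + a) G Y ∥ Z) × Y ∥ Z ≋ C′) → Receive c′ (e + a) F′ G → _
      go (Y , Z , f , g) h = ν^ e (real (addY M′ G) (Receive.Q₂ h) C′) ,
        (≋⇒⟹ (≋-trans (real-≋ M {Q} ≋-refl f) (∼*⇒≋ (real-up M e Q (out (e + a) G Y ∥ Z)))) ◅◅
         ν^-⟹ e (real-⟹ M′ {Config.Q c′} {Q₁} (out (e + a) G Y ∥ Z) ready ◅◅
                  tau⇒⟹ (ν^-τ M.k (comr (parl out) (sub-↦ (Frame.δ M′) step))) ◅◅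
                  ≋⇒⟹ (ν^-≋ M.k after-com) ◅◅
                  real-⟹ (addY M′ G) {H} {Q₂} C′ after)) ,
        cfg e next C′ (real-com-input L e G C′ F) ≋-refl
        where
        open Receive h renaming (G to H)
        after-com : plug (parC (con 0 (common M′ G) (common M′ Y)) (common M′ Z)) (sub (exts (Frame.δ M′)) H) ≋
                    common M′ C′ ∥ sub (Frame.δ (addY M′ G)) H
        after-com = ≋-trans (∥-cong
            (≡⇒≋ (trans (cong (_[ common M′ G ]) (renN-0+ (sub (exts (Frame.δ M′)) H)))
                        (exts-[] (Frame.δ M′) H (common M′ G))))
            (≋-trans (∥-cong ≋-refl (≡⇒≋ (renN-0+ (common M′ Z))))
                     (sub-≋ (Frame.σ M′) (renN-≋ (M.k +_) g))))
          ∥-comm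

    module _ (c : Config p q) (C : Term p proc) where
      open Config c

      -- By `sub-↦⁻` the acting prefixes belong to `C` or `P`. The equation `i ≡ 0` in `inner` is
      -- split over the two partners of a communication.
      simulated-0 : Simulated 0 (realˡ C) (realʳ C)
      simulated-0 {τ} d = top (ν^-τ⁻ L.k d)
        where
        inner : ∀ {i S} → i ≡ 0 → common L C ∥ sub L.δ P ↦⟨ i ∣ τ ⟩ S → Match τ (ν^ L.k S) (realʳ C)
        inner z (parl d) with common-τ⁻ L C z d
        ... | _ , d₀ , refl = match-common-τ c C d₀
        inner z (parr d) with sub-↦⁻ L.δ P z refl d
        ... | P′ , d₀ , refl = match-respects τ (ν^-≋ L.k ∥-comm) ε (match-τ c C d₀)
        inner z (coml {i = i} d e)
          with common-rcv⁻ L C (m+n≡0⇒m≡0 i z) d | sub-↦⁻ L.δ P (m+n≡0⇒n≡0 i z) refl e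
        ... | _ , _ , d₀ , refl , refl | con _ _ _ , e₀ , refl = match-com-output c C d₀ e₀
        inner z (comr {j = j} d e)
          with common-snd⁻ L C (m+n≡0⇒n≡0 j z) d | sub-↦⁻ L.δ P (m+n≡0⇒m≡0 j z) refl e
        ... | _ , con _ _ _ , d₀ , refl , refl | _ , e₀ , refl = match-com-input c C d₀ e₀
        top : ∀ {X} → ∃[ S ] common L C ∥ sub L.δ P ↦⟨ 0 ∣ τ ⟩ S × X ≡ ν^ L.k S → Match τ X (realʳ C)
        top (_ , d₀ , refl) = inner refl d₀
      simulated-0 {rcv a} d = top (ν^-rcv⁻ L.k d)
        where
        top : ∀ {X} → ∃[ F ] common L C ∥ sub L.δ P ↦⟨ 0 ∣ rcv (L.k + a) ⟩ F × X ≡ ν^ L.k F →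
              Match (rcv a) X (realʳ C)
        top (_ , parl d₀ , refl) with common-rcv⁻ L C refl d₀
        ... | b , F , d₁ , e , refl with refl ← +-cancelˡ-≡ L.k _ _ e = match-common-input c C d₁
        top (_ , parr d₀ , refl) with sub-↦⁻ L.δ P refl refl d₀
        ... | F , d₁ , refl = match-input c C d₁
      simulated-0 {snd a} d = top (ν^-snd⁻ L.k d)
        where
        top : ∀ {K} → ∃[ e ] ∃[ A ] ∃[ X ] (common L C ∥ sub L.δ P ↦⟨ 0 ∣ snd (L.k + a) ⟩ con e A X ×
                K ≡ con (L.k + e) A X) → Match (snd a) K (realʳ C)
        top (_ , _ , _ , parl d₀ , refl) with common-snd⁻ L C refl d₀
        ... | b , con _ _ _ , d₁ , e , refl with refl ← +-cancelˡ-≡ L.k _ _ e = match-common-output c C d₁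
        top (_ , _ , _ , parr d₀ , refl) with sub-↦⁻ L.δ P refl refl d₀
        ... | con _ _ _ , d₁ , refl = match-output c C d₁

    -- The cost is the only measure, as a call may enlarge both parts and the frame. `advance-⇝`
    -- turns the contractum into a configuration by `≡ₛ` alone, so `≡ₛ-↦` preserves the cost `n` for
    -- the induction.
    simulated : ∀ n (c : Config p q) C → Simulated n (Config.realˡ c C) (Config.realʳ c C)
    simulated zero    c C d = simulated-0 c C d
    simulated (suc n) c C {α} {S} d = go (contract refl d)
      where
      go : ∃[ T ] Config.realˡ c C ⇝ T × T ↦⟨ n ∣ α ⟩ S → Match α S (Config.realʳ c C)
      go (T , b , d₁) = go′ (advance-⇝ c C b)
        where
        go′ : Advance T (Config.realʳ c C) → Match α S (Config.realʳ c C)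
        go′ (g , _ , _ , c′ , C′ , e , w) = go″ (≡ₛ-↦ e d₁)
          where
          go″ : ∃[ S′ ] ν^ g (Config.realˡ c′ C′) ↦⟨ n ∣ α ⟩ S′ × Equiv α S S′ → Match α S (Config.realʳ c C)
          go″ (S′ , d₂ , f) = match-respects α f w (simulated-ν^ g (simulated n c′ C′) d₂)

    ≈′-simulates : ∀ {X Y α S} → X ≈′ Y → X ↦⟨ i ∣ α ⟩ S → Match α S Y
    ≈′-simulates {α = α} (cfg g c C e f) d = go (≋-↦ e d)
      where
      go : (∃₂ λ j S′ → ν^ g (Config.realˡ c C) ↦⟨ j ∣ α ⟩ S′ × Equiv α _ S′) → Match α _ _
      go (j , S′ , d₁ , q) = match-respects α q (≋⇒⟹ (≋-sym f)) (simulated-ν^ g (simulated j c C) d₁)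

    isContextBisimulation : IsContextBisimulation _≈′_
    isContextBisimulation = record { symmetric = ≈′-sym ; nonOutput = non-output ; output = output′ }
      where
      non-output : ∀ {P Q α P′} → P ≈′ Q → NonOutput α → P —[ α ]→ P′ → ∃[ Q′ ] (Q ⇒̂[ α ] Q′ × P′ ≈′ Q′)
      non-output r τ d with complete d
      ... | _ , X , d₀ , e with ≈′-simulates r d₀
      ... | Y , w , r′ with ⟹⇒⇒ w
      ... | Q′ , ds , f = Q′ , ds , ≈′-respects (≋-sym e) r′ (≋-sym f)
      non-output r (recv a A) d with complete d
      ... | _ , F , d₀ , e with ≈′-simulates r d₀ A
      ... | Y₁ , _ , G , Y′ , w , d₁ , w′ , r′ with ⟹⇒⇒ w | ⟹⇒⇒ w′
      ... | Q₁ , ds , f | Q′ , ds′ , f′ =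
        Q′ , (Q₁ , _ , ds , str f (recv-sound d₁ A) ≋-refl , ds′) , ≈′-respects (≋-sym e) r′ (≋-sym f′)
      output′ : ∀ {P Q k a A P′} → P ≈′ Q → P —[ send k a A ]→ P′ →
        ∃[ l ] ∃[ B ] ∃[ Q′ ] (Q ⇒[ send l a B ] Q′ × ((E : Term 1 proc) →
          ν^ k (renN (k +_) E [ A ] ∥ P′) ≈′ ν^ l (renN (l +_) E [ B ] ∥ Q′)))
      output′ r d with complete d
      ... | _ , K , d₀ , e with ≈′-simulates r d₀
      ... | Y₁ , _ , L@(con _ _ _) , Y′ , w , d₁ , w′ , r′ = go (send-sound d₁) (⟹⇒⇒ w)
        where
        go : Send Y₁ _ L → _ → _
        go o (Q₁ , ds , f) = go′ (⟹⇒⇒ (H-⟹ w′))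
          where
          open Send o
          go′ : _ → _
          go′ (Q′ , ds′ , f′) = k , B , Q′ , (Q₁ , _ , ds , str f step ≋-refl , ds′) , λ E →
            ≈′-respects (≋-sym (e E)) (r′ E)
              (≋-trans (≋-sym (H-plug Y′ E)) (ν^-≋ k (∥-cong ≋-refl (≋-sym f′))))

  -- The initial configuration

  double : ℕ → ℕ
  double zero    = zero
  double (suc a) = suc (suc (double a))

  double-injective : Inj double
  double-injective {zero}  {zero}  e = refl
  double-injective {suc a} {suc b} e = cong suc (double-injective (suc-injective (suc-injective e)))

  double≢odd : ∀ a b → double a ≢ suc (double b)
  double≢odd (suc a) (suc b) e = double≢odd a b (suc-injective (suc-injective e))

  a≤double : ∀ a → a ≤ double a
  a≤double zero    = z≤n
  a≤double (suc a) = s≤s (m≤n⇒m≤1+n (a≤double a))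

  lift^-below : ∀ N {ρ a} → a < N → lift^ N ρ a ≡ a
  lift^-below (suc N) {a = zero}  a<N = refl
  lift^-below (suc N) {a = suc a} a<N = cong suc (lift^-below N (s≤s⁻¹ a<N))

  -- The public names below N stand for themselves, and the names N + (2K + 1)
  -- remain available for triggers and servers.
  initialNames : ℕ → Names (Index 0 0)
  initialNames N = record
    { name   = λ { (pub a) → lift^ N double a }
    ; inj    = λ { {pub a} {pub b} e → cong pub (lift^-injective N double-injective e) }
    ; supply = λ K → N + suc (double K) ,
        ≤-trans (m≤n⇒m≤1+n (a≤double K)) (m≤n+m _ N) ,
        λ { (pub a) e → odd a (lift^-shift⁻ N a e) }
    }
    where
    odd : ∀ {K} a → ∃[ y ] a ≡ N + y × double y ≡ suc (double K) → ⊥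
    odd {K} a (y , _ , e) = double≢odd y K e

  renN-below : ∀ {s} N {ρ} (T : Term n s) → (∀ a → N ≤ a → a ∉fn T) → renN (lift^ N ρ) T ≡ T
  renN-below N (var x)     f = refl
  renN-below N (ƛ T)       f = cong ƛ (renN-below N T f)
  renN-below N 𝟎           f = refl
  renN-below N (inp a T)   f = cong₂ inp (lift^-below N (≰⇒> λ le → f a le (inj₁ refl)))
                                         (renN-below N T λ b le → f b le ∘ inj₂)
  renN-below N {ρ} (out a A T) f
    rewrite lift^-below N {ρ} {a} (≰⇒> λ le → f a le (inj₁ refl)) =
    cong₂ (out a) (renN-below N A λ b le → f b le ∘ inj₂ ∘ inj₁)
                  (renN-below N T λ b le → f b le ∘ inj₂ ∘ inj₂)
  renN-below N (T ∥ U)     f = cong₂ _∥_ (renN-below N T λ b le → f b le ∘ inj₁)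
                                         (renN-below N U λ b le → f b le ∘ inj₂)
  renN-below N (ν T)       f = cong ν (renN-below (suc N) T λ { (suc b) le → f b (s≤s⁻¹ le) })
  renN-below N (A · B)     f = cong₂ _·_ (renN-below N A λ b le → f b le ∘ inj₁)
                                         (renN-below N B λ b le → f b le ∘ inj₂)

  ≅⇒≈ : ∀ {P Q} → P ≅ Q → P ≈ Q
  ≅⇒≈ {P} {Q} (R , isNB , r) = _≈′_ , isContextBisimulation ,
    -- Nothing has been exchanged yet: the common code is `𝟎`, the frame is empty, and up to
    -- congruence the tests are `P` and `Q` themselves because their names lie below `N`.
    cfg 0 initial 𝟎 (≋-sym (initial-real P)) (initial-real Q)
    where
    open Candidate isNB
    open UpTo≋ isNB
    open Soundness isNB
    N = proj₁ (bound (P ∥ Q))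
    frame : Frame {0} {0} λ ()
    frame = record { k = 0 ; A = λ () ; σ = λ () ; δ = λ () ; σ-≡ = λ () ; δ-≡ = λ () }
    closed : ∀ {σ : Sub 0 0} (T : Proc) → sub σ T ≡ T
    closed = sub-var λ ()
    initial-real : ∀ T → real frame T 𝟎 ≋ T
    initial-real T = ≋-trans ∥-comm (≋-trans ∥-identity (≡⇒≋ (closed T)))
    initial-normal : ∀ T → (∀ a → N ≤ a → a ∉fn T) → normal frame (initialNames N) (λ ()) T ≋ T
    initial-normal T f = ≋-trans ∥-identity (≡⇒≋ (trans (closed _) (renN-below N T f)))
    initial : Config 0 0
    initial = record
      { D = λ () ; nm = initialNames N ; L = frame ; M = frame ; s = λ () ; t = λ () ; P = P ; Q = Q
      ; rel = via (initial-normal P λ a le → proj₂ (bound (P ∥ Q)) a le ∘ inj₁) r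
                  (≋-sym (initial-normal Q λ a le → proj₂ (bound (P ∥ Q)) a le ∘ inj₂))
      ; ranks = record { rX = λ () ; rY = λ () ; now = 0 ; rX< = λ () ; rY< = λ ()
                       ; D< = λ () ; A< = λ () ; B< = λ () } }

theorem1 : (P Q : Proc) → (P ≅ Q) ⇔ (P ≈ Q)
theorem1 P Q = mk⇔ ≅⇒≈ ≈⇒≅
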